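{- There are $\mathbb{Q}(e_1,e_2,\dots)$-linear maps $U_k\colon V_k\to\hat V_k$, for all integers $k\ge0$, with $U_0=1$ (that is, $U_0b_\emptyset=\hat b_\emptyset$), such that for all $k\ge1$ \[ U_kM_{k-1}=\hat M_{k-1}U_{k-1}\qquad\text{and}\qquad \hat D_kU_k=U_{k-1}D_k . \]
   Context: Let $\bm x=(x_1,x_2,\dots)$ be infinitely many commuting variables, one for each color in $\{1,2,\dots\}$, and let $e_j$ be the elementary symmetric functions in $\bm x$ ($e_0=1$). Let $I_k$ be the set of $k$-tuples of distinct positive integers; $I_0=\{\emptyset\}$. For tuples, $b_{\sigma,y}$ denotes the basis vector indexed by $\sigma$ with $y$ appended, and similarly for $\hat b$. Tableau side. $V_k$ is the $\mathbb{Q}(e_1,e_2,\dots)$-vector space with basis $\{b_\sigma:\sigma\in I_k\}$. For $\sigma\in I_k$ and a positive integer $y$, set \[ A(1\mid\sigma)=\prod_r\frac{\sigma_r-1}{\sigma_r},\qquad A(\sigma_r+1\mid\sigma)=\frac{\sigma_r+1}{\sigma_r}\prod_{r'\ne r}\frac{\sigma_r-\sigma_{r'}+1}{\sigma_r-\sigma_{r'}}, \] and $A(y\mid\sigma)=0$ for all other $y$ (these formulas also give $A(y\mid\sigma)=0$ when $y\in\sigma$; empty products are $1$). Define linear maps $M_k\colon V_k\to V_{k+1}$ ($k\ge0$) and $D_k\colon V_k\to V_{k-1}$ ($k\ge1$) by \[ M_kb_\sigma=\sum_{y\notin\sigma}A(y\mid\sigma)\,b_{\sigma,y},\qquad D_kb_\sigma=\frac{e_{\sigma_1}}{e_{\sigma_1-1}}\,b_{\sigma_2,\dots,\sigma_k}.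 \] Color side. $\hat V_k$ is the $\mathbb{Q}(e_1,e_2,\dots)$-vector space of infinite formal sums $\sum_{i\in I_k}F(x_{i_1},\dots,x_{i_k})\,\hat b_i$, where $F$ is an element of $x_1\cdots x_k\,\mathbb{Q}(e_1,e_2,\dots)[x_1,\dots,x_k]$, viewed as a polynomial in $k$ indeterminates with coefficients in $\mathbb{Q}(e_1,e_2,\dots)$ (the same $F$ for all $i$). In particular $\hat V_0=\mathbb{Q}(e_1,e_2,\dots)\hat b_\emptyset$. The maps $\hat M_k\colon\hat V_k\to\hat V_{k+1}$ ($k\ge0$) and $\hat D_k\colon\hat V_k\to\hat V_{k-1}$ ($k\ge1$) are given, extended termwise to infinite sums, by \[ \hat M_k\hat b_i=\sum_{c\notin i}x_c\,\hat b_{i,c},\qquad \hat D_k\hat b_i=\hat b_{i_2,\dots,i_k}. \] Thus $\hat D_k$ sends $\sum_iF(x_{i_1},\dots,x_{i_k})\hat b_i$ to $\sum_{i'\in I_{k-1}}\bigl(\sum_{c\notin i'}F(x_c,x_{i'_1},\dots,x_{i'_{k-1}})\bigr)\hat b_{i'}$, where the inner infinite sum is evaluated using $\sum_{c\ge1}x_c^m=p_m\in\mathbb{Q}[e_1,e_2,\dots]$ for $m\ge1$. -}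

module Defs where

open import Algebra.Bundles using (CommutativeRing)
open import Algebra.Module.Bundles using (Module)
open import Algebra.Module.Structures.Biased using (IsModuleFromLeft)
import Algebra.Properties.CommutativeMonoid.Sum as MonoidSum
import Algebra.Properties.Group as GroupProperties
import Algebra.Properties.Ring as RingProperties
import Algebra.Properties.Semiring.Exp as SemiringExp
import Algebra.Properties.Semiring.Mult as SemiringMult
import Algebra.Solver.Ring.NaturalCoefficients.Default as SemiringSolver
open import Data.Bool.Base using (true; false; if_then_else_)
open import Data.Empty using (⊥; ⊥-elim)
open import Data.Fin.Base using (Fin; toℕ)
import Data.Fin.Properties as Fin
open import Data.Integer.Base using (+_)
import Data.Integer.Properties as ℤ
open import Data.List.Base using (List; []; _∷_; _++_; map; concatMap; length)
import Data.List.Base as List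
open import Data.Nat.Base using (ℕ; zero; suc; pred; NonZero; z≤n; s≤s)
import Data.Nat.Base as ℕ
import Data.Nat.Properties as ℕ
open import Data.Product.Base using (∃; _×_; _,_; proj₁; proj₂)
open import Data.Rational.Base using (ℚ; 0ℚ; 1ℚ; _÷_)
import Data.Rational.Base as ℚ
import Data.Rational.Properties as ℚ
open import Data.Rational.Unnormalised.Base using (mkℚᵘ; *≡*)
open import Data.Sum.Base using (_⊎_; inj₁; inj₂)
open import Data.Vec.Base using (Vec; []; _∷_; _∷ʳ_; lookup; tail; head; updateAt; tabulate)
import Data.Vec.Properties as Vec
open import Data.Vec.Membership.Propositional using (_∈_; _∉_)
open import Data.Vec.Membership.DecPropositional ℕ._≟_ using (_∈?_)
open import Data.Vec.Relation.Unary.All using (All; []; _∷_) renaming (tail to All-tail)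
import Data.Vec.Relation.Unary.All.Properties as AllProperties
open import Data.Vec.Relation.Unary.Any using (here; there)
open import Data.Vec.Relation.Unary.AllPairs using ([]; _∷_)
open import Data.Vec.Relation.Unary.Unique.Propositional using (Unique)
open import Data.Vec.Relation.Unary.Unique.Propositional.Properties using (lookup-injective)
import Data.Vec.Relation.Unary.Unique.Propositional.Properties as UniqueProperties
open import Function.Base using (_∘_)
open import Level using (Level; 0ℓ; _⊔_)
import Relation.Binary
open import Relation.Binary.Bundles using (DecSetoid)
open import Relation.Binary.PropositionalEquality using (_≡_; _≢_)
import Relation.Binary.PropositionalEquality as ≡
import Relation.Binary.Reasoning.Setoid as SetoidReasoning
import Relation.Nullary.Decidable as Dec
open import Relation.Unary using (Decidable)
open import Relation.Nullary using (¬_; Dec; yes; no; does)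

-- The free R-module on B: finite formal linear combinations, two of them being
-- equal when all their coefficients are.
module FreeModule {r ℓ b ℓb : Level}
                  (R : CommutativeRing r ℓ) (B : DecSetoid b ℓb) where

  open CommutativeRing R renaming (Carrier to Scalar)
  open RingProperties ring
  open SetoidReasoning setoid
  open SemiringSolver commutativeSemiring using (solve; _:=_; _:*_; _:+_; con)
  private module B = DecSetoid B
  open B using () renaming (Carrier to Basis; _≈_ to _∼_; _≟_ to _∼?_)

  Combination : Set (r ⊔ b)
  Combination = List (Scalar × Basis)

  δ : Basis → Basis → Scalar
  δ x y = if does (x ∼? y) then 1# else 0#

  pair : (Basis → Scalar) → Combination → Scalar
  pair φ []            = 0#
  pair φ ((a , x) ∷ v) = a * φ x + pair φ v

  coeff : Basis → Combination → Scalar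
  coeff x = pair (δ x)

  infix 4 _≋_
  record _≋_ (v w : Combination) : Set (ℓ ⊔ b) where
    constructor mk≋
    field coeff≈ : ∀ x → coeff x v ≈ coeff x w
  open _≋_ public

  infixr 7 _·_
  _·_ : Scalar → Combination → Combination
  a · v = map (λ (c , x) → a * c , x) v

  ⟦_⟧ : Basis → Combination
  ⟦ x ⟧ = (1# , x) ∷ []

  Respectful : (Basis → Scalar) → Set (b ⊔ ℓ ⊔ ℓb)
  Respectful φ = ∀ {x y} → x ∼ y → φ x ≈ φ y

  δ-yes : ∀ {x y} → x ∼ y → δ x y ≈ 1#
  δ-yes {x} {y} x∼y with x ∼? y
  ... | yes _   = refl
  ... | no  x≁y = ⊥-elim (x≁y x∼y)

  δ-no : ∀ {x y} → ¬ (x ∼ y) → δ x y ≈ 0#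
  δ-no {x} {y} x≁y with x ∼? y
  ... | yes x∼y = ⊥-elim (x≁y x∼y)
  ... | no  _   = refl

  δ-≡ : ∀ {x x′ y y′} → (x ∼ y → x′ ∼ y′) → (x′ ∼ y′ → x ∼ y) → δ x y ≈ δ x′ y′
  δ-≡ {x} {x′} {y} {y′} f g with x ∼? y
  ... | yes p = sym (δ-yes (f p))
  ... | no ¬p = sym (δ-no (¬p ∘ g))

  δ-respˡ : ∀ {x x′} y → x ∼ x′ → δ x y ≈ δ x′ y
  δ-respˡ y p = δ-≡ (B.trans (B.sym p)) (B.trans p)

  δ-resp : ∀ x → Respectful (δ x)
  δ-resp x p = δ-≡ (λ q → B.trans q p) (λ q → B.trans q (B.sym p))

  pair-++ : ∀ φ v w → pair φ (v ++ w) ≈ pair φ v + pair φ w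
  pair-++ φ []            w = sym (+-identityˡ _)
  pair-++ φ ((a , x) ∷ v) w = trans (+-congˡ (pair-++ φ v w)) (sym (+-assoc _ _ _))

  pair-· : ∀ φ a v → pair φ (a · v) ≈ a * pair φ v
  pair-· φ a []            = sym (zeroʳ a)
  pair-· φ a ((c , x) ∷ v) = trans (+-congˡ (pair-· φ a v))
    (solve 4 (λ a c f s → a :* c :* f :+ a :* s := a :* (c :* f :+ s)) refl a c (φ x) (pair φ v))

  pair-φ : ∀ {φ ψ} v → (∀ x → φ x ≈ ψ x) → pair φ v ≈ pair ψ v
  pair-φ []            e = refl
  pair-φ ((a , x) ∷ v) e = +-cong (*-congˡ (e x)) (pair-φ v e)

  pair-+ : ∀ φ ψ v → pair (λ x → φ x + ψ x) v ≈ pair φ v + pair ψ v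
  pair-+ φ ψ []            = sym (+-identityˡ 0#)
  pair-+ φ ψ ((a , x) ∷ v) = trans (+-congˡ (pair-+ φ ψ v))
    (solve 5 (λ a f g s t → a :* (f :+ g) :+ (s :+ t) := (a :* f :+ s) :+ (a :* g :+ t))
      refl a (φ x) (ψ x) (pair φ v) (pair ψ v))

  pair-* : ∀ a φ v → pair (λ x → a * φ x) v ≈ a * pair φ v
  pair-* a φ []            = sym (zeroʳ a)
  pair-* a φ ((c , x) ∷ v) = trans (+-congˡ (pair-* a φ v))
    (solve 4 (λ a c f s → c :* (a :* f) :+ a :* s := a :* (c :* f :+ s)) refl a c (φ x) (pair φ v))

  pair-0 : ∀ v → pair (λ _ → 0#) v ≈ 0#
  pair-0 []            = refl
  pair-0 ((c , x) ∷ v) = trans (+-cong (zeroʳ c) (pair-0 v)) (+-identityˡ 0#)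

  remove : Basis → Combination → Combination
  remove x []            = []
  remove x ((a , y) ∷ v) with x ∼? y
  ... | yes _ = remove x v
  ... | no  _ = (a , y) ∷ remove x v

  remove-length : ∀ x v → length (remove x v) ℕ.≤ length v
  remove-length x []            = z≤n
  remove-length x ((a , y) ∷ v) with x ∼? y
  ... | yes _ = ℕ.m≤n⇒m≤1+n (remove-length x v)
  ... | no  _ = s≤s (remove-length x v)

  pair-remove : ∀ {φ} → Respectful φ → ∀ x v →
                pair φ v ≈ coeff x v * φ x + pair φ (remove x v)
  pair-remove {φ} resp x [] = sym (trans (+-congʳ (zeroˡ _)) (+-identityˡ 0#))
  pair-remove {φ} resp x ((a , y) ∷ v) with x ∼? y
  ... | yes x∼y = trans (+-cong (*-congˡ (resp (B.sym x∼y))) (pair-remove resp x v))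
    (solve 4 (λ a f k s → a :* f :+ (k :* f :+ s) := (a :* con 1 :+ k) :* f :+ s)
      refl a (φ x) (coeff x v) (pair φ (remove x v)))
  ... | no  _   = trans (+-congˡ (pair-remove resp x v))
    (solve 5 (λ a g f k s → a :* g :+ (k :* f :+ s) := (a :* con 0 :+ k) :* f :+ (a :* g :+ s))
      refl a (φ y) (φ x) (coeff x v) (pair φ (remove x v)))

  coeff-remove-same : ∀ {x y} → x ∼ y → ∀ v → coeff y (remove x v) ≈ 0#
  coeff-remove-same         x∼y []            = refl
  coeff-remove-same {x} {y} x∼y ((a , z) ∷ v) with x ∼? z
  ... | yes _   = coeff-remove-same x∼y v
  ... | no  x≁z = trans (+-cong (trans (*-congˡ (δ-no (x≁z ∘ B.trans x∼y))) (zeroʳ a))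
                                (coeff-remove-same x∼y v)) (+-identityˡ 0#)

  coeff-remove-other : ∀ {x y} → ¬ (x ∼ y) → ∀ v → coeff y (remove x v) ≈ coeff y v
  coeff-remove-other {x} {y} x≁y v = sym (begin
    coeff y v                                    ≈⟨ pair-remove (δ-resp y) x v ⟩
    coeff x v * δ y x + coeff y (remove x v)     ≈⟨ +-congʳ (*-congˡ (δ-no (x≁y ∘ B.sym))) ⟩
    coeff x v * 0# + coeff y (remove x v)        ≈⟨ +-congʳ (zeroʳ _) ⟩
    0# + coeff y (remove x v)                    ≈⟨ +-identityˡ _ ⟩
    coeff y (remove x v)                         ∎)

  vanish : ∀ {φ} → Respectful φ → ∀ v → (∀ x → coeff x v * φ x ≈ 0#) → pair φ v ≈ 0#
  vanish {φ} resp v = go (length v) v ℕ.≤-refl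
    where
    go : ∀ n v → length v ℕ.≤ n → (∀ x → coeff x v * φ x ≈ 0#) → pair φ v ≈ 0#
    go n       []            _       _ = refl
    go (suc n) ((a , x) ∷ v) (s≤s l) h = begin
      pair φ w                                ≈⟨ pair-remove resp x w ⟩
      coeff x w * φ x + pair φ (remove x w)   ≈⟨ +-cong (h x) (go n (remove x w) len h′) ⟩
      0# + 0#                                 ≈⟨ +-identityˡ 0# ⟩
      0#                                      ∎
      where
      w = (a , x) ∷ v
      len : length (remove x w) ℕ.≤ n
      len with x ∼? x
      ... | yes _   = ℕ.≤-trans (remove-length x v) l
      ... | no  x≁x = ⊥-elim (x≁x B.refl)
      h′ : ∀ y → coeff y (remove x w) * φ y ≈ 0#
      h′ y with x ∼? y
      ... | yes x∼y = trans (*-congʳ (coeff-remove-same x∼y w)) (zeroˡ _)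
      ... | no  x≁y = trans (*-congʳ (coeff-remove-other x≁y w)) (h y)

  pair-neg : ∀ φ w → pair φ ((- 1#) · w) ≈ - pair φ w
  pair-neg φ w = trans (pair-· φ (- 1#) w) (-1*x≈-x _)

  x-x≈0 : ∀ {x y} → x ≈ y → x + - y ≈ 0#
  x-x≈0 e = trans (+-congʳ e) (-‿inverseʳ _)

  pair-cong : ∀ {φ} → Respectful φ → ∀ {v w} → v ≋ w → pair φ v ≈ pair φ w
  pair-cong {φ} resp {v} {w} (mk≋ e) = begin
    pair φ v                              ≈⟨ +-identityʳ _ ⟨
    pair φ v + 0#                         ≈⟨ +-congˡ (-‿inverseˡ _) ⟨
    pair φ v + (- pair φ w + pair φ w)    ≈⟨ +-assoc _ _ _ ⟨
    pair φ v + - pair φ w + pair φ w      ≈⟨ +-congʳ zero-diff ⟩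
    0# + pair φ w                         ≈⟨ +-identityˡ _ ⟩
    pair φ w                              ∎
    where
    diff = v ++ (- 1#) · w
    pair-diff : ∀ ψ → pair ψ diff ≈ pair ψ v + - pair ψ w
    pair-diff ψ = trans (pair-++ ψ v _) (+-congˡ (pair-neg ψ w))
    zero-diff : pair φ v + - pair φ w ≈ 0#
    zero-diff = trans (sym (pair-diff φ)) (vanish resp diff
      (λ x → trans (*-congʳ (trans (pair-diff (δ x)) (x-x≈0 (e x)))) (zeroˡ _)))

  module≋ : Module R (r ⊔ b) (ℓ ⊔ b)
  module≋ = record
    { Carrierᴹ = Combination
    ; _≈ᴹ_     = _≋_
    ; _+ᴹ_     = _++_
    ; 0ᴹ       = []
    ; -ᴹ_      = λ v → (- 1#) · v
    ; _*ₗ_     = _·_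
    ; isModule = IsModuleFromLeft.isModule {commutativeRing = R} record
      { isLeftModule = record
        { isLeftSemimodule = record
          { +ᴹ-isCommutativeMonoid = record
            { isMonoid = record
              { isSemigroup = record
                { isMagma = record
                  { isEquivalence = record
                    { refl  = mk≋ λ _ → refl
                    ; sym   = λ p → mk≋ λ x → sym (coeff≈ p x)
                    ; trans = λ p q → mk≋ λ x → trans (coeff≈ p x) (coeff≈ q x)
                    }
                  ; ∙-cong = λ {v} {v′} {w} {w′} p q → mk≋ λ x →
                      trans (pair-++ (δ x) v w)
                      (trans (+-cong (coeff≈ p x) (coeff≈ q x))
                      (sym (pair-++ (δ x) v′ w′)))
                  }
                ; assoc = λ u v w → mk≋ λ x →
                    trans (pair-++ _ (u ++ v) w) (trans (+-congʳ (pair-++ _ u v))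
                    (trans (+-assoc _ _ _)
                    (sym (trans (pair-++ _ u (v ++ w)) (+-congˡ (pair-++ _ v w))))))
                }
              ; identity = (λ v → mk≋ λ x → refl)
                         , (λ v → mk≋ λ x → trans (pair-++ _ v []) (+-identityʳ _))
              }
            ; comm = λ v w → mk≋ λ x →
                trans (pair-++ _ v w) (trans (+-comm _ _) (sym (pair-++ _ w v)))
            }
          ; isPreleftSemimodule = record
            { *ₗ-cong = λ {a} {a′} {v} {v′} p q → mk≋ λ x →
                trans (pair-· _ a v) (trans (*-cong p (coeff≈ q x)) (sym (pair-· _ a′ v′)))
            ; *ₗ-zeroˡ = λ v → mk≋ λ x → trans (pair-· _ 0# v) (zeroˡ _)
            ; *ₗ-distribʳ = λ v a c → mk≋ λ x →
                trans (pair-· _ (a + c) v) (trans (distribʳ _ a c)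
                (sym (trans (pair-++ _ (a · v) (c · v)) (+-cong (pair-· _ a v) (pair-· _ c v)))))
            ; *ₗ-identityˡ = λ v → mk≋ λ x → trans (pair-· _ 1# v) (*-identityˡ _)
            ; *ₗ-assoc = λ a c v → mk≋ λ x →
                trans (pair-· _ (a * c) v) (trans (*-assoc a c _)
                (sym (trans (pair-· _ a (c · v)) (*-congˡ (pair-· _ c v)))))
            ; *ₗ-zeroʳ = λ a → mk≋ λ x → refl
            ; *ₗ-distribˡ = λ a v w → mk≋ λ x →
                trans (pair-· _ a (v ++ w)) (trans (*-congˡ (pair-++ _ v w)) (trans (distribˡ a _ _)
                (sym (trans (pair-++ _ (a · v) (a · w)) (+-cong (pair-· _ a v) (pair-· _ a w))))))
            }
          }
        ; -ᴹ‿cong = λ {v} {w} p → mk≋ λ x →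
            trans (pair-neg _ v) (trans (-‿cong (coeff≈ p x)) (sym (pair-neg _ w)))
        ; -ᴹ‿inverse =
              (λ v → mk≋ λ x → trans (pair-++ _ ((- 1#) · v) v)
                                     (trans (+-congʳ (pair-neg _ v)) (-‿inverseˡ _)))
            , (λ v → mk≋ λ x → trans (pair-++ _ v ((- 1#) · v))
                                     (trans (+-congˡ (pair-neg _ v)) (-‿inverseʳ _)))
        }
      }
    }

  module ≋ = Module module≋

extend : ∀ {r ℓ b₁ ℓ₁ b₂ ℓ₂} (R : CommutativeRing r ℓ)
         (B₁ : DecSetoid b₁ ℓ₁) (B₂ : DecSetoid b₂ ℓ₂) →
         (DecSetoid.Carrier B₁ → FreeModule.Combination R B₂) →
         FreeModule.Combination R B₁ → FreeModule.Combination R B₂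
extend R B₁ B₂ f = concatMap (λ (a , x) → a · f x)
  where open FreeModule R B₂ using (_·_)

-- Monomials in variables t₁, t₂, …: the (n+1)-st entry of the list is the
-- exponent of t_{n+1}, and all further exponents are 0.

Monomial : Set
Monomial = List ℕ

at : Monomial → ℕ → ℕ
at []      n       = 0
at (a ∷ α) zero    = a
at (a ∷ α) (suc n) = at α n

infix 4 _≐_
record _≐_ (α β : Monomial) : Set where
  constructor mk≐
  field at≡ : ∀ n → at α n ≡ at β n
open _≐_ public

infixl 6 _⊕_
_⊕_ : Monomial → Monomial → Monomial
[]      ⊕ β       = β
(a ∷ α) ⊕ []      = a ∷ α
(a ∷ α) ⊕ (b ∷ β) = a ℕ.+ b ∷ α ⊕ β

-- The monomial t_c ^ m, with t₀ = 1.
power : ℕ → ℕ → Monomial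
power zero    m = []
power (suc n) m = List.replicate n 0 ++ m ∷ []

at-⊕ : ∀ α β n → at (α ⊕ β) n ≡ at α n ℕ.+ at β n
at-⊕ []      β       n       = ≡.refl
at-⊕ (a ∷ α) []      zero    = ≡.sym (ℕ.+-identityʳ a)
at-⊕ (a ∷ α) []      (suc n) = ≡.sym (ℕ.+-identityʳ _)
at-⊕ (a ∷ α) (b ∷ β) zero    = ≡.refl
at-⊕ (a ∷ α) (b ∷ β) (suc n) = at-⊕ α β n

infix 4 _≺_
_≺_ : Monomial → Monomial → Set
α ≺ β = ∃ λ n → (∀ {j} → j ℕ.< n → at α j ≡ at β j) × at α n ℕ.< at β n

compare-monomials : ∀ α β → (α ≐ β) ⊎ (α ≺ β) ⊎ (β ≺ α)
compare-monomials [] [] = inj₁ (mk≐ λ _ → ≡.refl)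
compare-monomials [] (zero ∷ β) with compare-monomials [] β
... | inj₁ (mk≐ e) = inj₁ (mk≐ λ { zero → ≡.refl ; (suc n) → e n })
... | inj₂ (inj₁ (n , e , l)) = inj₂ (inj₁ (suc n , (λ { {zero} _ → ≡.refl ; {suc j} (s≤s p) → e p }) , l))
... | inj₂ (inj₂ (n , e , ()))
compare-monomials [] (suc b ∷ β) = inj₂ (inj₁ (0 , (λ ()) , s≤s z≤n))
compare-monomials (zero ∷ α) [] with compare-monomials α []
... | inj₁ (mk≐ e) = inj₁ (mk≐ λ { zero → ≡.refl ; (suc n) → e n })
... | inj₂ (inj₁ (n , e , ()))
... | inj₂ (inj₂ (n , e , l)) = inj₂ (inj₂ (suc n , (λ { {zero} _ → ≡.refl ; {suc j} (s≤s p) → e p }) , l))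
compare-monomials (suc a ∷ α) [] = inj₂ (inj₂ (0 , (λ ()) , s≤s z≤n))
compare-monomials (a ∷ α) (b ∷ β) with ℕ.<-cmp a b
... | Relation.Binary.tri< a<b _ _ = inj₂ (inj₁ (0 , (λ ()) , a<b))
... | Relation.Binary.tri> _ _ b<a = inj₂ (inj₂ (0 , (λ ()) , b<a))
... | Relation.Binary.tri≈ _ ≡.refl _ with compare-monomials α β
... | inj₁ (mk≐ e) = inj₁ (mk≐ λ { zero → ≡.refl ; (suc n) → e n })
... | inj₂ (inj₁ (n , e , l)) = inj₂ (inj₁ (suc n , (λ { {zero} _ → ≡.refl ; {suc j} (s≤s p) → e p }) , l))
... | inj₂ (inj₂ (n , e , l)) = inj₂ (inj₂ (suc n , (λ { {zero} _ → ≡.refl ; {suc j} (s≤s p) → e p }) , l))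

≺-irrefl : ∀ {α β} → α ≐ β → ¬ (α ≺ β)
≺-irrefl (mk≐ e) (n , _ , l) = ℕ.<-irrefl (e n) l

≺-trans : ∀ {α β γ} → α ≺ β → β ≺ γ → α ≺ γ
≺-trans {α} {β} {γ} (m , e , l) (n , f , k) with ℕ.<-cmp m n
... | Relation.Binary.tri< m<n _ _ =
      m , (λ p → ≡.trans (e p) (f (ℕ.<-trans p m<n))) , ≡.subst (at α m ℕ.<_) (f m<n) l
... | Relation.Binary.tri≈ _ ≡.refl _ = m , (λ p → ≡.trans (e p) (f p)) , ℕ.<-trans l k
... | Relation.Binary.tri> _ _ n<m =
      n , (λ p → ≡.trans (e (ℕ.<-trans p n<m)) (f p)) , ≡.subst (ℕ._< at γ n) (≡.sym (e n<m)) k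

≐-refl : ∀ {α} → α ≐ α
≐-refl = mk≐ λ _ → ≡.refl

≐-sym : ∀ {α β} → α ≐ β → β ≐ α
≐-sym p = mk≐ λ n → ≡.sym (at≡ p n)

≐-trans : ∀ {α β γ} → α ≐ β → β ≐ γ → α ≐ γ
≐-trans p q = mk≐ λ n → ≡.trans (at≡ p n) (at≡ q n)

≺-respˡ : ∀ {α β γ} → α ≐ β → α ≺ γ → β ≺ γ
≺-respˡ {γ = γ} (mk≐ e) (n , f , l) =
  n , (λ p → ≡.trans (≡.sym (e _)) (f p)) , ≡.subst (ℕ._< at γ n) (e n) l

≺-respʳ : ∀ {α β γ} → β ≐ γ → α ≺ β → α ≺ γ
≺-respʳ {α} (mk≐ e) (n , f , l) =
  n , (λ p → ≡.trans (f p) (e _)) , ≡.subst (at α n ℕ.<_) (e n) l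

_≐?_ : ∀ α β → Dec (α ≐ β)
α ≐? β with compare-monomials α β
... | inj₁ e        = yes e
... | inj₂ (inj₁ l) = no λ e → ≺-irrefl e l
... | inj₂ (inj₂ l) = no λ e → ≺-irrefl (≐-sym e) l

monomials : DecSetoid 0ℓ 0ℓ
monomials = record
  { Carrier = Monomial ; _≈_ = _≐_
  ; isDecEquivalence = record
    { isEquivalence = record { refl = ≐-refl ; sym = ≐-sym ; trans = ≐-trans }
    ; _≟_ = _≐?_ }
  }

⊕-cong : ∀ {α α′ β β′} → α ≐ α′ → β ≐ β′ → α ⊕ β ≐ α′ ⊕ β′
⊕-cong {α} {α′} {β} {β′} p q = mk≐ λ n →
  ≡.trans (at-⊕ α β n) (≡.trans (≡.cong₂ ℕ._+_ (at≡ p n) (at≡ q n)) (≡.sym (at-⊕ α′ β′ n)))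

⊕-comm : ∀ α β → α ⊕ β ≐ β ⊕ α
⊕-comm α β = mk≐ λ n →
  ≡.trans (at-⊕ α β n) (≡.trans (ℕ.+-comm (at α n) _) (≡.sym (at-⊕ β α n)))

⊕-assoc : ∀ α β γ → (α ⊕ β) ⊕ γ ≐ α ⊕ (β ⊕ γ)
⊕-assoc α β γ = mk≐ λ n →
  ≡.trans (at-⊕ (α ⊕ β) γ n) (≡.trans (≡.cong (ℕ._+ at γ n) (at-⊕ α β n))
  (≡.trans (ℕ.+-assoc (at α n) _ _)
  (≡.sym (≡.trans (at-⊕ α (β ⊕ γ) n) (≡.cong (at α n ℕ.+_) (at-⊕ β γ n))))))

⊕-cancelˡ : ∀ α {β γ} → α ⊕ β ≐ α ⊕ γ → β ≐ γ
⊕-cancelˡ α {β} {γ} (mk≐ e) = mk≐ λ n → ℕ.+-cancelˡ-≡ (at α n) _ _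
  (≡.trans (≡.sym (at-⊕ α β n)) (≡.trans (e n) (at-⊕ α γ n)))

⊕-monoʳ-≺ : ∀ α {β γ} → β ≺ γ → α ⊕ β ≺ α ⊕ γ
⊕-monoʳ-≺ α {β} {γ} (n , e , l) = n
  , (λ {j} p → ≡.trans (at-⊕ α β j) (≡.trans (≡.cong (at α j ℕ.+_) (e p)) (≡.sym (at-⊕ α γ j))))
  , ≡.subst₂ ℕ._<_ (≡.sym (at-⊕ α β n)) (≡.sym (at-⊕ α γ n)) (ℕ.+-monoʳ-< (at α n) l)

⊕-monoˡ-≺ : ∀ γ {α β} → α ≺ β → α ⊕ γ ≺ β ⊕ γ
⊕-monoˡ-≺ γ {α} {β} p =
  ≺-respˡ {γ = β ⊕ γ} (⊕-comm γ α) (≺-respʳ {γ ⊕ α} (⊕-comm γ β) (⊕-monoʳ-≺ γ {α} {β} p))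

module Polynomials {r ℓ} (R : CommutativeRing r ℓ) where

  open CommutativeRing R
  open FreeModule R monomials public
  open SemiringSolver commutativeSemiring using (solve; _:=_; _:*_; _:+_)

  Polynomial : Set r
  Polynomial = Combination

  infixl 7 _⊛_
  _⊛_ : Polynomial → Polynomial → Polynomial
  p ⊛ q = concatMap (λ (a , α) → map (λ (b , β) → a * b , α ⊕ β) q) p

  pair-⊛ : ∀ φ p q → pair φ (p ⊛ q) ≈ pair (λ α → pair (λ β → φ (α ⊕ β)) q) p
  pair-⊛ φ []            q = refl
  pair-⊛ φ ((a , α) ∷ p) q =
    trans (pair-++ φ (map _ q) (p ⊛ q)) (+-cong (row q) (pair-⊛ φ p q))
    where
    row : ∀ q → pair φ (map (λ (b , β) → a * b , α ⊕ β) q) ≈ a * pair (λ β → φ (α ⊕ β)) q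
    row []            = sym (zeroʳ a)
    row ((b , β) ∷ q) = trans (+-congˡ (row q))
      (solve 4 (λ a b f s → a :* b :* f :+ a :* s := a :* (b :* f :+ s)) refl a b (φ (α ⊕ β)) _)

  pair-swap : ∀ (f : Monomial → Monomial → Carrier) p q →
              pair (λ α → pair (f α) q) p ≈ pair (λ β → pair (λ α → f α β) p) q
  pair-swap f []            q = sym (pair-0 q)
  pair-swap f ((a , α) ∷ p) q = trans (+-cong (sym (pair-* a (f α) q)) (pair-swap f p q))
                                      (sym (pair-+ (λ β → a * f α β) _ q))

  ⊛-cong : ∀ {p p′ q q′} → p ≋ p′ → q ≋ q′ → p ⊛ q ≋ p′ ⊛ q′
  ⊛-cong {p} {p′} {q} {q′} e f = mk≋ λ μ →
    trans (pair-⊛ (δ μ) p q)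
    (trans (pair-cong (λ α∼α′ → pair-φ q (λ β → δ-resp μ (⊕-cong α∼α′ ≐-refl))) e)
    (trans (pair-φ p′ (λ α → pair-cong (λ β∼β′ → δ-resp μ (⊕-cong {α} ≐-refl β∼β′)) f))
    (sym (pair-⊛ (δ μ) p′ q′))))

  ⊛-comm : ∀ p q → p ⊛ q ≋ q ⊛ p
  ⊛-comm p q = mk≋ λ μ →
    trans (pair-⊛ (δ μ) p q)
    (trans (pair-swap (λ α β → δ μ (α ⊕ β)) p q)
    (trans (pair-φ q (λ β → pair-φ p (λ α → δ-resp μ (⊕-comm α β))))
    (sym (pair-⊛ (δ μ) q p))))

  ⊛-assoc : ∀ p q s → (p ⊛ q) ⊛ s ≋ p ⊛ (q ⊛ s)
  ⊛-assoc p q s = mk≋ λ μ →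
    trans (pair-⊛ (δ μ) (p ⊛ q) s)
    (trans (pair-⊛ _ p q)
    (trans (pair-φ p (λ α → trans
      (pair-φ q (λ β → pair-φ s (λ γ → δ-resp μ (⊕-assoc α β γ))))
      (sym (pair-⊛ (λ β → δ μ (α ⊕ β)) q s))))
    (sym (pair-⊛ (δ μ) p (q ⊛ s)))))

  ⊛-identityˡ : ∀ p → ⟦ [] ⟧ ⊛ p ≋ p
  ⊛-identityˡ p = mk≋ λ μ →
    trans (pair-⊛ (δ μ) ⟦ [] ⟧ p) (trans (+-identityʳ _) (*-identityˡ _))

  ⊛-distribʳ : ∀ s p q → (p ++ q) ⊛ s ≋ p ⊛ s ++ q ⊛ s
  ⊛-distribʳ s p q = mk≋ λ μ →
    trans (pair-⊛ (δ μ) (p ++ q) s) (trans (pair-++ _ p q)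
    (trans (+-cong (sym (pair-⊛ (δ μ) p s)) (sym (pair-⊛ (δ μ) q s)))
    (sym (pair-++ (δ μ) (p ⊛ s) (q ⊛ s)))))

  polynomialRing : CommutativeRing r ℓ
  polynomialRing = record
    { Carrier = Polynomial ; _≈_ = _≋_ ; _+_ = _++_ ; _*_ = _⊛_
    ; -_ = ≋.-ᴹ_ ; 0# = [] ; 1# = ⟦ [] ⟧
    ; isCommutativeRing = record
      { isRing = record
        { +-isAbelianGroup = ≋.+ᴹ-isAbelianGroup
        ; *-cong = ⊛-cong
        ; *-assoc = ⊛-assoc
        ; *-identity = ⊛-identityˡ
                     , (λ p → ≋.≈ᴹ-trans (⊛-comm p ⟦ [] ⟧) (⊛-identityˡ p))
        ; distrib = (λ s p q → ≋.≈ᴹ-trans (⊛-comm s (p ++ q)) (≋.≈ᴹ-trans (⊛-distribʳ s p q)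
                      (≋.+ᴹ-cong (⊛-comm p s) (⊛-comm q s))))
                  , ⊛-distribʳ
        }
      ; *-comm = ⊛-comm
      }
    }

IsZero : ∀ {r ℓ} (R : CommutativeRing r ℓ) → CommutativeRing.Carrier R → Set ℓ
IsZero R a = CommutativeRing._≈_ R a (CommutativeRing.0# R)

NoZeroDivisors : ∀ {r ℓ} → CommutativeRing r ℓ → Set (r ⊔ ℓ)
NoZeroDivisors R = ∀ {a b} → ¬ IsZero R a → ¬ IsZero R b → ¬ IsZero R (CommutativeRing._*_ R a b)

-- A polynomial ring over a discrete integral domain has no zero divisors: compare
-- the lexicographically leading coefficients.
module PolynomialDomain {r ℓ} (R : CommutativeRing r ℓ)
  (≈0? : Decidable (IsZero R)) (nonzero-* : NoZeroDivisors R) where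

  open CommutativeRing R
  open Polynomials R
  open RingProperties ring using (-‿distribˡ-*; -‿distribʳ-*; -0#≈0#)
  open SetoidReasoning setoid

  Occurs : Monomial → Polynomial → Set
  Occurs α []            = ⊥
  Occurs α ((_ , β) ∷ p) = (α ≐ β) ⊎ Occurs α p

  occurs? : ∀ α p → Dec (Occurs α p)
  occurs? α []            = no λ ()
  occurs? α ((_ , β) ∷ p) with α ≐? β | occurs? α p
  ... | yes e | _     = yes (inj₁ e)
  ... | no  _ | yes o = yes (inj₂ o)
  ... | no ¬e | no ¬o = no λ { (inj₁ e) → ¬e e ; (inj₂ o) → ¬o o }

  coeff-absent : ∀ α p → ¬ Occurs α p → coeff α p ≈ 0#
  coeff-absent α []            ¬o = refl
  coeff-absent α ((a , β) ∷ p) ¬o =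
    trans (+-cong (trans (*-congˡ (δ-no (¬o ∘ inj₁))) (zeroʳ a)) (coeff-absent α p (¬o ∘ inj₂)))
          (+-identityˡ 0#)

  infix 4 _≼_
  _≼_ : Monomial → Monomial → Set
  α ≼ μ = (α ≐ μ) ⊎ (α ≺ μ)

  ≼-≺-trans : ∀ {α β γ} → α ≼ β → β ≺ γ → α ≺ γ
  ≼-≺-trans {α} {β} {γ} (inj₁ e) l = ≺-respˡ {γ = γ} (≐-sym e) l
  ≼-≺-trans {α} {β} {γ} (inj₂ k) l = ≺-trans {α} {β} {γ} k l

  Leading : Polynomial → Set ℓ
  Leading p = ∃ λ μ → ¬ (coeff μ p ≈ 0#) × (∀ α → ¬ (coeff α p ≈ 0#) → α ≼ μ)

  leading : ∀ p → ¬ (p ≋ []) → Leading p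
  leading p p≉0 with scan p
    where
    scan : ∀ q → (∀ α → Occurs α q → coeff α p ≈ 0#)
               ⊎ ∃ λ μ → ¬ (coeff μ p ≈ 0#) × (∀ α → Occurs α q → ¬ (coeff α p ≈ 0#) → α ≼ μ)
    scan []            = inj₁ λ _ ()
    scan ((_ , β) ∷ q) with ≈0? (coeff β p) | scan q
    ... | yes z | inj₁ f = inj₁ λ
      { α (inj₁ e) → trans (pair-φ p (λ x → δ-respˡ x e)) z ; α (inj₂ o) → f α o }
    ... | yes z | inj₂ (μ , nz , f) = inj₂ (μ , nz , λ
      { α (inj₁ e) n → ⊥-elim (n (trans (pair-φ p (λ x → δ-respˡ x e)) z)) ; α (inj₂ o) n → f α o n })
    ... | no nz | inj₁ f = inj₂ (β , nz , λ
      { α (inj₁ e) n → inj₁ e ; α (inj₂ o) n → ⊥-elim (n (f α o)) })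
    ... | no nz | inj₂ (μ , nz′ , f) with compare-monomials β μ
    ... | inj₁ e = inj₂ (μ , nz′ , λ
      { α (inj₁ e′) n → inj₁ (≐-trans e′ e) ; α (inj₂ o) n → f α o n })
    ... | inj₂ (inj₁ l) = inj₂ (μ , nz′ , λ
      { α (inj₁ e′) n → inj₂ (≺-respˡ {γ = μ} (≐-sym e′) l) ; α (inj₂ o) n → f α o n })
    ... | inj₂ (inj₂ l) = inj₂ (β , nz , λ
      { α (inj₁ e′) n → inj₁ e′ ; α (inj₂ o) n → inj₂ (≼-≺-trans {α} {μ} {β} (f α o n) l) })
  ... | inj₁ f = ⊥-elim (p≉0 (mk≋ λ α → zero-at α (occurs? α p)))
    where
    zero-at : ∀ α → Dec (Occurs α p) → coeff α p ≈ 0#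
    zero-at α (yes o) = f α o
    zero-at α (no ¬o) = coeff-absent α p ¬o
  ... | inj₂ (μ , nz , f) = μ , nz , λ α n → below α n (occurs? α p)
    where
    below : ∀ α → ¬ (coeff α p ≈ 0#) → Dec (Occurs α p) → α ≼ μ
    below α n (yes o) = f α o n
    below α n (no ¬o) = ⊥-elim (n (coeff-absent α p ¬o))

  vanish-nonzero : ∀ {φ} → Respectful φ → ∀ p →
                   (∀ α → ¬ (coeff α p ≈ 0#) → φ α ≈ 0#) → pair φ p ≈ 0#
  vanish-nonzero {φ} resp p h = vanish resp p λ α → term α (≈0? (coeff α p))
    where
    term : ∀ α → Dec (coeff α p ≈ 0#) → coeff α p * φ α ≈ 0#
    term α (yes z) = trans (*-congʳ z) (zeroˡ _)
    term α (no nz) = trans (*-congˡ (h α nz)) (zeroʳ _)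

  leading-coeff : ∀ p q ((μ , _) : Leading p) ((ν , _) : Leading q) →
                  coeff (μ ⊕ ν) (p ⊛ q) ≈ coeff μ p * coeff ν q
  leading-coeff p q (μ , _ , hp) (ν , _ , hq) = begin
    coeff (μ ⊕ ν) (p ⊛ q)                              ≈⟨ pair-⊛ (δ (μ ⊕ ν)) p q ⟩
    pair g p                                           ≈⟨ pair-φ p split ⟩
    pair (λ α → coeff ν q * δ μ α + h α) p             ≈⟨ pair-+ (λ α → coeff ν q * δ μ α) h p ⟩
    pair (λ α → coeff ν q * δ μ α) p + pair h p        ≈⟨ +-cong (pair-* _ (δ μ) p) (vanish-nonzero h-resp p h-zero) ⟩
    coeff ν q * coeff μ p + 0#                         ≈⟨ +-identityʳ _ ⟩
    coeff ν q * coeff μ p                              ≈⟨ *-comm _ _ ⟩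
    coeff μ p * coeff ν q                              ∎
    where
    g h : Monomial → Carrier
    g α = pair (λ β → δ (μ ⊕ ν) (α ⊕ β)) q
    h α = g α + - (coeff ν q * δ μ α)
    g-resp : Respectful g
    g-resp e = pair-φ q λ β → δ-resp (μ ⊕ ν) (⊕-cong e ≐-refl)
    h-resp : Respectful h
    h-resp e = +-cong (g-resp e) (-‿cong (*-congˡ (δ-resp μ e)))
    split : ∀ α → g α ≈ coeff ν q * δ μ α + h α
    split α = sym (begin
      k + (g α + - k)   ≈⟨ +-congˡ (+-comm _ _) ⟩
      k + (- k + g α)   ≈⟨ +-assoc _ _ _ ⟨
      k + - k + g α     ≈⟨ +-congʳ (-‿inverseʳ k) ⟩
      0# + g α          ≈⟨ +-identityˡ _ ⟩
      g α               ∎)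
      where k = coeff ν q * δ μ α
    h-zero : ∀ α → ¬ (coeff α p ≈ 0#) → h α ≈ 0#
    h-zero α nz with hp α nz
    ... | inj₁ e = x-x≈0 (begin
      g α                                     ≈⟨ g-resp e ⟩
      g μ                                     ≈⟨ pair-φ q (λ β → δ-≡ {μ ⊕ ν} {ν} (⊕-cancelˡ μ) (⊕-cong {μ} ≐-refl)) ⟩
      coeff ν q                               ≈⟨ *-identityʳ _ ⟨
      coeff ν q * 1#                          ≈⟨ *-congˡ (δ-yes (≐-sym e)) ⟨
      coeff ν q * δ μ α                       ∎)
    ... | inj₂ l = x-x≈0 (trans
      (vanish-nonzero (λ e → δ-resp (μ ⊕ ν) (⊕-cong {α} ≐-refl e)) q
        (λ β nz′ → δ-no {μ ⊕ ν} {α ⊕ β} λ e → ≺-irrefl (≐-sym e) (small β (hq β nz′))))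
      (sym (trans (*-congˡ (δ-no {μ} {α} λ e → ≺-irrefl (≐-sym e) l)) (zeroʳ _))))
      where
      small : ∀ β → β ≼ ν → α ⊕ β ≺ μ ⊕ ν
      small β (inj₁ e) =
        ≺-respʳ {α ⊕ β} (⊕-cong {μ} ≐-refl e) (⊕-monoˡ-≺ β {α} {μ} l)
      small β (inj₂ k) =
        ≺-trans {α ⊕ β} {μ ⊕ β} {μ ⊕ ν} (⊕-monoˡ-≺ β {α} {μ} l) (⊕-monoʳ-≺ μ {β} {ν} k)

  nonzero-⊛ : ∀ {p q} → ¬ (p ≋ []) → ¬ (q ≋ []) → ¬ (p ⊛ q ≋ [])
  nonzero-⊛ {p} {q} p≉0 q≉0 (mk≋ e) = nonzero-* (proj₁ (proj₂ lp)) (proj₁ (proj₂ lq))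
    (trans (sym (leading-coeff p q lp lq)) (e (proj₁ lp ⊕ proj₁ lq)))
    where
    lp = leading p p≉0
    lq = leading q q≉0

  ≋0-stable : ∀ p → ¬ ¬ (p ≋ []) → p ≋ []
  ≋0-stable p ¬¬z = mk≋ λ μ → case≈0 μ (≈0? (coeff μ p))
    where
    case≈0 : ∀ μ → Dec (coeff μ p ≈ 0#) → coeff μ p ≈ 0#
    case≈0 μ (yes z) = z
    case≈0 μ (no nz) = ⊥-elim (¬¬z λ z → nz (coeff≈ z μ))

module FractionField {r ℓ} (R : CommutativeRing r ℓ)
  (1≉0 : ¬ IsZero R (CommutativeRing.1# R))
  (nonzero-* : NoZeroDivisors R)
  (≈0-stable : ∀ a → ¬ ¬ IsZero R a → IsZero R a) where

  open CommutativeRing R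
  open RingProperties ring using (-‿distribˡ-*)
  open SemiringSolver commutativeSemiring using (solve; _:=_; _:*_; _:+_; con)
  open SetoidReasoning setoid

  record Fraction : Set (r ⊔ ℓ) where
    constructor _/_⟨_⟩
    field
      num   : Carrier
      den   : Carrier
      den≉0 : ¬ (den ≈ 0#)
  open Fraction public

  infix 4 _≃_
  record _≃_ (x y : Fraction) : Set ℓ where
    constructor mk≃
    field cross : num x * den y ≈ num y * den x
  open _≃_ public

  cancel : ∀ {a b c} → ¬ (c ≈ 0#) → a * c ≈ b * c → a ≈ b
  cancel {a} {b} {c} c≉0 e = begin
    a                  ≈⟨ +-identityʳ a ⟨
    a + 0#             ≈⟨ +-congˡ (-‿inverseˡ b) ⟨
    a + (- b + b)      ≈⟨ +-assoc _ _ _ ⟨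
    a + - b + b        ≈⟨ +-congʳ (≈0-stable _ λ nz → nonzero-* nz c≉0 (begin
      (a + - b) * c        ≈⟨ distribʳ c a (- b) ⟩
      a * c + - b * c      ≈⟨ +-cong e (sym (-‿distribˡ-* b c)) ⟩
      b * c + - (b * c)    ≈⟨ -‿inverseʳ _ ⟩
      0#                   ∎)) ⟩
    0# + b             ≈⟨ +-identityˡ b ⟩
    b                  ∎

  ≃-trans : ∀ {x y z} → x ≃ y → y ≃ z → x ≃ z
  ≃-trans {a / b ⟨ _ ⟩} {c / d ⟨ d≉0 ⟩} {e / f ⟨ _ ⟩} (mk≃ p) (mk≃ q) = mk≃ (cancel d≉0 (begin
    a * f * d      ≈⟨ solve 3 (λ a f d → a :* f :* d := a :* d :* f) refl a f d ⟩
    a * d * f      ≈⟨ *-congʳ p ⟩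
    c * b * f      ≈⟨ solve 3 (λ c b f → c :* b :* f := c :* f :* b) refl c b f ⟩
    c * f * b      ≈⟨ *-congʳ q ⟩
    e * d * b      ≈⟨ solve 3 (λ e d b → e :* d :* b := e :* b :* d) refl e d b ⟩
    e * b * d      ∎))

  infixl 6 _⊞_
  infixl 7 _⊠_
  _⊞_ _⊠_ : Fraction → Fraction → Fraction
  (a / b ⟨ b≉0 ⟩) ⊞ (c / d ⟨ d≉0 ⟩) = (a * d + c * b) / b * d ⟨ nonzero-* b≉0 d≉0 ⟩
  (a / b ⟨ b≉0 ⟩) ⊠ (c / d ⟨ d≉0 ⟩) = (a * c) / b * d ⟨ nonzero-* b≉0 d≉0 ⟩

  ⊟_ : Fraction → Fraction
  ⊟ (a / b ⟨ b≉0 ⟩) = (- a) / b ⟨ b≉0 ⟩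

  ↑_ : Carrier → Fraction
  ↑ a = a / 1# ⟨ 1≉0 ⟩

  fractionField : CommutativeRing (r ⊔ ℓ) ℓ
  fractionField = record
    { Carrier = Fraction ; _≈_ = _≃_ ; _+_ = _⊞_ ; _*_ = _⊠_
    ; -_ = ⊟_ ; 0# = ↑ 0# ; 1# = ↑ 1#
    ; isCommutativeRing = record
      { isRing = record
        { +-isAbelianGroup = record
          { isGroup = record
            { isMonoid = record
              { isSemigroup = record
                { isMagma = record
                  { isEquivalence = record
                    { refl = mk≃ refl ; sym = λ p → mk≃ (sym (cross p)) ; trans = ≃-trans }
                  ; ∙-cong = λ {(a / b ⟨ _ ⟩)} {(a′ / b′ ⟨ _ ⟩)} {(c / d ⟨ _ ⟩)} {(c′ / d′ ⟨ _ ⟩)}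
                               (mk≃ p) (mk≃ q) → mk≃ (begin
                      (a * d + c * b) * (b′ * d′)
                        ≈⟨ solve 6 (λ a b c d b′ d′ → (a :* d :+ c :* b) :* (b′ :* d′)
                             := (a :* b′) :* (d :* d′) :+ (c :* d′) :* (b :* b′)) refl a b c d b′ d′ ⟩
                      (a * b′) * (d * d′) + (c * d′) * (b * b′)
                        ≈⟨ +-cong (*-congʳ p) (*-congʳ q) ⟩
                      (a′ * b) * (d * d′) + (c′ * d) * (b * b′)
                        ≈⟨ solve 6 (λ a′ b c′ d b′ d′ → (a′ :* b) :* (d :* d′) :+ (c′ :* d) :* (b :* b′)
                             := (a′ :* d′ :+ c′ :* b′) :* (b :* d)) refl a′ b c′ d b′ d′ ⟩
                      (a′ * d′ + c′ * b′) * (b * d) ∎)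
                  }
                ; assoc = λ (a / b ⟨ _ ⟩) (c / d ⟨ _ ⟩) (e / f ⟨ _ ⟩) → mk≃
                    (solve 6 (λ a b c d e f →
                       ((a :* d :+ c :* b) :* f :+ e :* (b :* d)) :* (b :* (d :* f))
                       := (a :* (d :* f) :+ (c :* f :+ e :* d) :* b) :* (b :* d :* f))
                     refl a b c d e f)
                }
              ; identity = (λ (a / b ⟨ _ ⟩) → mk≃
                    (solve 2 (λ a b → (con 0 :* b :+ a :* con 1) :* b := a :* (con 1 :* b)) refl a b))
                , (λ (a / b ⟨ _ ⟩) → mk≃
                    (solve 2 (λ a b → (a :* con 1 :+ con 0 :* b) :* b := a :* (b :* con 1)) refl a b))
              }
            ; inverse = (λ (a / b ⟨ _ ⟩) → mk≃ (*-cong′ b (-‿inverseˡ a)))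
                      , (λ (a / b ⟨ _ ⟩) → mk≃ (*-cong′ b (-‿inverseʳ a)))
            ; ⁻¹-cong = λ {(a / b ⟨ _ ⟩)} {(c / d ⟨ _ ⟩)} (mk≃ p) → mk≃
                (trans (sym (-‿distribˡ-* a d)) (trans (-‿cong p) (-‿distribˡ-* c b)))
            }
          ; comm = λ (a / b ⟨ _ ⟩) (c / d ⟨ _ ⟩) → mk≃
              (solve 4 (λ a b c d → (a :* d :+ c :* b) :* (d :* b) := (c :* b :+ a :* d) :* (b :* d))
               refl a b c d)
          }
        ; *-cong = λ {(a / b ⟨ _ ⟩)} {(a′ / b′ ⟨ _ ⟩)} {(c / d ⟨ _ ⟩)} {(c′ / d′ ⟨ _ ⟩)}
                     (mk≃ p) (mk≃ q) → mk≃ (begin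
            (a * c) * (b′ * d′)    ≈⟨ interchange a c b′ d′ ⟩
            (a * b′) * (c * d′)    ≈⟨ *-cong p q ⟩
            (a′ * b) * (c′ * d)    ≈⟨ interchange a′ b c′ d ⟩
            (a′ * c′) * (b * d)    ∎)
        ; *-assoc = λ (a / b ⟨ _ ⟩) (c / d ⟨ _ ⟩) (e / f ⟨ _ ⟩) → mk≃
            (*-cong (*-assoc a c e) (sym (*-assoc b d f)))
        ; *-identity = (λ (a / b ⟨ _ ⟩) → mk≃ (*-cong (*-identityˡ a) (sym (*-identityˡ b))))
                     , (λ (a / b ⟨ _ ⟩) → mk≃ (*-cong (*-identityʳ a) (sym (*-identityʳ b))))
        ; distrib = (λ (a / b ⟨ _ ⟩) (c / d ⟨ _ ⟩) (e / f ⟨ _ ⟩) → mk≃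
              (solve 6 (λ a b c d e f →
                 a :* (c :* f :+ e :* d) :* (b :* d :* (b :* f))
                 := (a :* c :* (b :* f) :+ a :* e :* (b :* d)) :* (b :* (d :* f)))
               refl a b c d e f))
          , (λ (a / b ⟨ _ ⟩) (c / d ⟨ _ ⟩) (e / f ⟨ _ ⟩) → mk≃
              (solve 6 (λ a b c d e f →
                 (c :* f :+ e :* d) :* a :* (d :* b :* (f :* b))
                 := (c :* a :* (f :* b) :+ e :* a :* (d :* b)) :* (d :* f :* b))
               refl a b c d e f))
        }
      ; *-comm = λ (a / b ⟨ _ ⟩) (c / d ⟨ _ ⟩) → mk≃ (*-cong (*-comm a c) (*-comm d b))
      }
    }
    where
    interchange : ∀ a b c d → (a * b) * (c * d) ≈ (a * c) * (b * d)
    interchange = solve 4 (λ a b c d → (a :* b) :* (c :* d) := (a :* c) :* (b :* d)) refl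
    *-cong′ : ∀ {a a′} b → a + a′ ≈ 0# → (a * b + a′ * b) * 1# ≈ 0# * (b * b)
    *-cong′ {a} {a′} b z = begin
      (a * b + a′ * b) * 1#   ≈⟨ *-identityʳ _ ⟩
      a * b + a′ * b          ≈⟨ distribʳ b a a′ ⟨
      (a + a′) * b            ≈⟨ *-congʳ z ⟩
      0# * b                  ≈⟨ zeroˡ b ⟩
      0#                      ≈⟨ zeroˡ _ ⟨
      0# * (b * b)            ∎

  infix 8 _⁻¹⟨_⟩
  _⁻¹⟨_⟩ : ∀ x → ¬ (x ≃ ↑ 0#) → Fraction
  x ⁻¹⟨ x≄0 ⟩ = den x / num x ⟨ (λ z → x≄0 (mk≃ (trans (*-congʳ z) (trans (zeroˡ _) (sym (zeroˡ _)))))) ⟩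

  ⁻¹-inverseʳ : ∀ x (x≄0 : ¬ (x ≃ ↑ 0#)) → x ⊠ x ⁻¹⟨ x≄0 ⟩ ≃ ↑ 1#
  ⁻¹-inverseʳ x x≄0 = mk≃ (trans (*-identityʳ _) (trans (*-comm _ _) (sym (*-identityˡ _))))

record I (k : ℕ) : Set where
  constructor tuple
  field
    entries   : Vec ℕ k
    .positive : All NonZero entries
    .distinct : Unique entries
open I public

entries-injective : ∀ {k} {σ τ : I k} → entries σ ≡ entries τ → σ ≡ τ
entries-injective ≡.refl = ≡.refl

I-decSetoid : ℕ → DecSetoid 0ℓ 0ℓ
I-decSetoid k = ≡.decSetoid {A = I k} λ σ τ →
  Dec.map′ entries-injective (≡.cong entries) (Vec.≡-dec ℕ._≟_ (entries σ) (entries τ))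

∅ : I 0
∅ = tuple [] [] []

∷ʳ-all : ∀ {P : ℕ → Set} {k} {v : Vec ℕ k} {y} → All P v → P y → All P (v ∷ʳ y)
∷ʳ-all []       q = q ∷ []
∷ʳ-all (p ∷ ps) q = p ∷ ∷ʳ-all ps q

∷ʳ-unique : ∀ {k} {v : Vec ℕ k} {y} → Unique v → y ∉ v → Unique (v ∷ʳ y)
∷ʳ-unique []        y∉v = [] ∷ []
∷ʳ-unique (px ∷ us) y∉v =
  ∷ʳ-all px (λ x≡y → y∉v (here (≡.sym x≡y))) ∷ ∷ʳ-unique us (y∉v ∘ there)

append : ∀ {k} (σ : I k) (y : ℕ) .{{_ : NonZero y}} → .(y ∉ entries σ) → I (suc k)
append (tuple v pos dist) y {{y>0}} y∉v =
  tuple (v ∷ʳ y) (∷ʳ-all pos y>0) (∷ʳ-unique dist y∉v)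

dropFirst : ∀ {k} → I (suc k) → I k
dropFirst (tuple v pos dist) = tuple (tail v) (tail-positive pos) (tail-distinct dist)
  where
  tail-positive : ∀ {k} {v : Vec ℕ (suc k)} → All NonZero v → All NonZero (tail v)
  tail-positive (_ ∷ ps) = ps
  tail-distinct : ∀ {k} {v : Vec ℕ (suc k)} → Unique v → Unique (tail v)
  tail-distinct (_ ∷ ds) = ds

ι : ℕ → ℚ
ι n = + n ℚ./ 1

ι-injective : ∀ {m n} → ι m ≡ ι n → m ≡ n
ι-injective {m} {n} eq with ℚ./-injective-≃ (mkℚᵘ (+ m) 0) (mkℚᵘ (+ n) 0) eq
... | *≡* eq′ = ℤ.+-injective (ℤ.*-cancelʳ-≡ (+ m) (+ n) (+ 1) eq′)

ι-nonZero : ∀ {n} → NonZero n → ℚ.NonZero (ι n)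
ι-nonZero n≢0 = ℚ.≢-nonZero λ eq → ℕ.≢-nonZero⁻¹ _ {{n≢0}} (ι-injective eq)

ι-difference-nonZero : ∀ {m n} → m ≢ n → ℚ.NonZero (ι m ℚ.- ι n)
ι-difference-nonZero {m} {n} m≢n =
  ℚ.≢-nonZero λ eq → m≢n (ι-injective (ℚGroup.x∙y⁻¹≈ε⇒x≈y (ι m) (ι n) eq))
  where module ℚGroup = GroupProperties ℚ.+-0-group

module ∏ = MonoidSum ℚ.*-1-commutativeMonoid

-- A(1 ∣ σ)
A-one : ∀ {k} → I k → ℚ
A-one (tuple v pos _) = ∏.sum λ r →
  let σᵣ = lookup v r in
  _÷_ (ι σᵣ ℚ.- 1ℚ) (ι σᵣ) {{ι-nonZero (AllProperties.lookup⁺ pos r)}}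

-- A(σᵣ+1 ∣ σ)
A-succ : ∀ {k} → I k → Fin k → ℚ
A-succ (tuple v pos dist) r =
  _÷_ (ι σᵣ ℚ.+ 1ℚ) (ι σᵣ) {{ι-nonZero (AllProperties.lookup⁺ pos r)}}
    ℚ.* ∏.sum (λ r′ → factor r′ (r′ Fin.≟ r))
  where
  σᵣ = lookup v r
  factor : ∀ r′ → Dec (r′ ≡ r) → ℚ
  factor r′ (yes _)    = 1ℚ
  factor r′ (no r′≢r) =
    _÷_ (ι σᵣ ℚ.- ι σᵣ′ ℚ.+ 1ℚ) (ι σᵣ ℚ.- ι σᵣ′)
      {{ι-difference-nonZero λ eq → r′≢r (≡.sym (lookup-injective dist r r′ eq))}}
    where σᵣ′ = lookup v r′

-- Exponent vectors of the monomials in x₁⋯x_k K[x₁, …, x_k].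
record Exponents (k : ℕ) : Set where
  constructor exponents
  field
    degrees         : Vec ℕ k
    .nonzeroDegrees : All NonZero degrees
open Exponents public

degrees-injective : ∀ {k} {α β : Exponents k} → degrees α ≡ degrees β → α ≡ β
degrees-injective ≡.refl = ≡.refl

exponents-≟ : ∀ {k} (α β : Exponents k) → Dec (α ≡ β)
exponents-≟ α β =
  Dec.map′ degrees-injective (≡.cong degrees) (Vec.≡-dec ℕ._≟_ (degrees α) (degrees β))

Exponents-decSetoid : ℕ → DecSetoid 0ℓ 0ℓ
Exponents-decSetoid k = ≡.decSetoid (exponents-≟ {k})

-- x^α x_{k+1}
infix 8 _⋆x
_⋆x : ∀ {k} → Exponents k → Exponents (suc k)
exponents α pos ⋆x = exponents (α ∷ʳ 1) (∷ʳ-all pos _)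

-- xⱼ^m x^α
raise : ∀ {k} → ℕ → Exponents k → Fin k → Exponents k
raise m (exponents α pos) j = exponents (updateAt α j (ℕ._+ m)) (positive′ pos j)
  where
  positive′ : ∀ {k} {v : Vec ℕ k} → All NonZero v → ∀ j → All NonZero (updateAt v j (ℕ._+ m))
  positive′ {v = suc _ ∷ _} (_ ∷ ps) Fin.zero    = _ ∷ ps
  positive′                 (q ∷ ps) (Fin.suc j) = q ∷ positive′ ps j

-- x_{i₁}^{α₁} ⋯ x_{i_k}^{α_k}
substitute : ∀ {k} → Vec ℕ k → Vec ℕ k → Monomial
substitute []      []      = []
substitute (c ∷ i) (a ∷ α) = power c a ⊕ substitute i α

at-power-same : ∀ n m → at (power (suc n) m) n ≡ m
at-power-same zero    m = ≡.refl
at-power-same (suc n) m = at-power-same n m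

at-power-other : ∀ c m n → c ≢ suc n → at (power c m) n ≡ 0
at-power-other zero          m n       c≢ = ≡.refl
at-power-other (suc zero)    m zero    c≢ = ⊥-elim (c≢ ≡.refl)
at-power-other (suc zero)    m (suc n) c≢ = ≡.refl
at-power-other (suc (suc c)) m zero    c≢ = ≡.refl
at-power-other (suc (suc c)) m (suc n) c≢ = at-power-other (suc c) m n (c≢ ∘ ≡.cong suc)

at-substitute-other : ∀ {k} (i α : Vec ℕ k) n → All (suc n ≢_) i → at (substitute i α) n ≡ 0
at-substitute-other []      []      n []       = ≡.refl
at-substitute-other (c ∷ i) (a ∷ α) n (q ∷ qs) =
  ≡.trans (at-⊕ (power c a) (substitute i α) n)
    (≡.cong₂ ℕ._+_ (at-power-other c a n (q ∘ ≡.sym)) (at-substitute-other i α n qs))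

substitute-injective : ∀ {k} (i α β : Vec ℕ k) → All NonZero i → Unique i →
                       substitute i α ≐ substitute i β → α ≡ β
substitute-injective []          []      []      _         _        _ = ≡.refl
substitute-injective (zero  ∷ i) _       _       (() ∷ _)  _        _
substitute-injective (suc n ∷ i) (a ∷ α) (a′ ∷ β) (_ ∷ pos) (q ∷ qs) eq =
  ≡.cong₂ _∷_ a≡a′ (substitute-injective i α β pos qs (⊕-cancelˡ (power (suc n) a)
    (≡.subst (λ z → power (suc n) a ⊕ substitute i α ≐ power (suc n) z ⊕ substitute i β)
      (≡.sym a≡a′) eq)))
  where
  value : ∀ a α → at (power (suc n) a ⊕ substitute i α) n ≡ a
  value a α = ≡.trans (at-⊕ (power (suc n) a) (substitute i α) n)
    (≡.trans (≡.cong₂ ℕ._+_ (at-power-same n a) (at-substitute-other i α n q)) (ℕ.+-identityʳ a))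
  a≡a′ = ≡.trans (≡.sym (value a α)) (≡.trans (at≡ eq n) (value a′ β))

-- Instantiated below at K = ℚ(e₁, e₂, …), with e⁻¹ j = 1/eⱼ.
module Maps (K : CommutativeRing 0ℓ 0ℓ)
            (fromℚ : ℚ → CommutativeRing.Carrier K)
            (e e⁻¹ : ℕ → CommutativeRing.Carrier K) where

  private
    module K = CommutativeRing K

  module KSum  = MonoidSum K.+-commutativeMonoid
  module KExp  = SemiringExp K.semiring
  module KMult = SemiringMult K.semiring

  -- The power sums pₙ, …, p₁ as polynomials in the eⱼ, by Newton's identities
  -- pₙ₊₁ = Σ_{i=1}^{n} (-1)^{i-1} eᵢ pₙ₊₁₋ᵢ + (-1)ⁿ (n+1) eₙ₊₁.
  powerSums : ∀ n → Vec K.Carrier n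
  powerSums zero    = []
  powerSums (suc n) =
    (KSum.sum (λ r → ((K.- K.1#) KExp.^ toℕ r) K.* (e (suc (toℕ r)) K.* lookup (powerSums n) r))
      K.+ ((K.- K.1#) KExp.^ n) K.* (suc n KMult.× e (suc n)))
    ∷ powerSums n

  -- p 0 is a dummy value: only p m with m ≥ 1 is ever used.
  p : ℕ → K.Carrier
  p zero    = K.0#
  p (suc n) = head (powerSums (suc n))

  module V (k : ℕ) = FreeModule K (I-decSetoid k)

  V : ℕ → Module K 0ℓ 0ℓ
  V = V.module≋

  b : ∀ {k} → I k → V.Combination k
  b {k} = V.⟦_⟧ k

  module VSum (k : ℕ) = MonoidSum (Module.+ᴹ-commutativeMonoid (V k))

  -- The summand a b_{σ,y} of M b_σ, present when y ∉ σ.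
  M-term : ∀ {k} → I k → (y : ℕ) .{{_ : NonZero y}} → ℚ → V.Combination (suc k)
  M-term {k} σ y a = go (y ∈? entries σ)
    where
    go : Dec (y ∈ entries σ) → V.Combination (suc k)
    go (yes _)  = []
    go (no y∉σ) = V._·_ (suc k) (fromℚ a) (b (append σ y y∉σ))

  -- Only y = 1 and y = σᵣ+1 contribute, as A(y ∣ σ) = 0 for all other y;
  -- these values of y are pairwise distinct since the σᵣ are distinct and positive.
  M : ∀ {k} → V.Combination k → V.Combination (suc k)
  M {k} = extend K (I-decSetoid k) (I-decSetoid (suc k)) λ σ →
    M-term σ 1 (A-one σ)
      ++ VSum.sum (suc k) (λ r → M-term σ (suc (lookup (entries σ) r)) (A-succ σ r))

  D : ∀ {k} → V.Combination (suc k) → V.Combination k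
  D {k} = extend K (I-decSetoid (suc k)) (I-decSetoid k) λ σ →
    let σ₁ = head (entries σ) in
    V._·_ k (e σ₁ K.* e⁻¹ (pred σ₁)) (b (dropFirst σ))

  -- x₁⋯x_k K[x₁, …, x_k] as the K-span of its monomials. An element F stands for the
  -- formal sum Σ_{i∈I_k} F(x_{i₁}, …, x_{i_k}) b̂_i.
  module F (k : ℕ) = FreeModule K (Exponents-decSetoid k)

  -- K[x₁, x₂, …]. Any finitely many of the color variables are algebraically
  -- independent over ℚ(e₁, e₂, …), so F(x_{i₁}, …, x_{i_k}) lives in this ring
  -- even though each eⱼ is itself a power series in the color variables.
  module K[x] = Polynomials K

  -- The coefficient F(x_{i₁}, …, x_{i_k}) of b̂_i in Σ_i F(x_{i₁}, …, x_{i_k}) b̂_i.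
  coefficient : ∀ {k} → F.Combination k → I k → K[x].Polynomial
  coefficient F i = map (λ (a , α) → a , substitute (entries i) (degrees α)) F

  -- Equality of formal sums: all coefficients agree.
  infix 4 _≋̂_
  record _≋̂_ {k} (F G : F.Combination k) : Set where
    constructor mk≋̂
    field coefficient≋ : ∀ (i : I k) → coefficient F i K[x].≋ coefficient G i
  open _≋̂_ public

  module _ {k : ℕ} where

    private
      module Fₖ = F k

    coeff-coefficient : ∀ μ F (i : I k) → K[x].coeff μ (coefficient F i)
                        ≡ Fₖ.pair (λ (α : Exponents k) → K[x].δ μ (substitute (entries i) (degrees α))) F
    coeff-coefficient μ []            i = ≡.refl
    coeff-coefficient μ ((a , α) ∷ F) i = ≡.cong (_ K.+_) (coeff-coefficient μ F i)

    -- The formal sum depends only on the polynomial F, and determines it.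
    ≋⇒≋̂ : ∀ {F G} → F Fₖ.≋ G → F ≋̂ G
    ≋⇒≋̂ {F} {G} eq = mk≋̂ λ i → K[x].mk≋ λ μ → K.trans
      (K.reflexive (coeff-coefficient μ F i)) (K.trans
      (Fₖ.pair-cong (λ { ≡.refl → K.refl }) eq)
      (K.reflexive (≡.sym (coeff-coefficient μ G i))))

    ≋̂⇒≋ : ∀ {F G} → F ≋̂ G → F Fₖ.≋ G
    ≋̂⇒≋ {F} {G} (mk≋̂ eq) = Fₖ.mk≋ λ α → K.trans (K.sym (read α F)) (K.trans
      (K[x].coeff≈ (eq i) (x^ α)) (read α G))
      where
      v = tabulate {n = k} (suc ∘ toℕ)
      v-positive : All NonZero v
      v-positive = AllProperties.tabulate⁺ (λ _ → _)
      v-distinct : Unique v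
      v-distinct = UniqueProperties.tabulate⁺ (Fin.toℕ-injective ∘ ℕ.suc-injective)
      i : I k
      i = tuple v v-positive v-distinct
      x^ : Exponents k → Monomial
      x^ α = substitute v (degrees α)
      same : ∀ α β → K[x].δ (x^ α) (x^ β) K.≈ Fₖ.δ α β
      same α β = go (exponents-≟ α β)
        where
        go : Dec (α ≡ β) → K[x].δ (x^ α) (x^ β) K.≈ Fₖ.δ α β
        go (yes α≡β) = K.trans
          (K[x].δ-yes {x^ α} {x^ β} (mk≐ λ n → ≡.cong (λ γ → at (x^ γ) n) α≡β))
          (K.sym (Fₖ.δ-yes α≡β))
        go (no α≢β) = K.trans
          (K[x].δ-no {x^ α} {x^ β} λ eq′ → α≢β (degrees-injective
            (substitute-injective v _ _ v-positive v-distinct eq′)))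
          (K.sym (Fₖ.δ-no α≢β))
      read : ∀ α F → K[x].coeff (x^ α) (coefficient F i) K.≈ Fₖ.coeff α F
      read α F = K.trans (K.reflexive (coeff-coefficient (x^ α) F i)) (Fₖ.pair-φ F (same α))

  V̂ : ℕ → Module K 0ℓ 0ℓ
  V̂ k = record
    { Carrierᴹ = F.Combination k
    ; _≈ᴹ_     = _≋̂_
    ; _+ᴹ_     = _++_
    ; 0ᴹ       = []
    ; -ᴹ_      = ≋.-ᴹ_
    ; _*ₗ_     = _·_
    ; isModule = IsModuleFromLeft.isModule {commutativeRing = K} record
      { isLeftModule = record
        { isLeftSemimodule = record
          { +ᴹ-isCommutativeMonoid = record
            { isMonoid = record
              { isSemigroup = record
                { isMagma = record
                  { isEquivalence = record
                    { refl  = ⇒ ≋.≈ᴹ-refl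
                    ; sym   = λ p → ⇒ (≋.≈ᴹ-sym (⇐ p))
                    ; trans = λ p q → ⇒ (≋.≈ᴹ-trans (⇐ p) (⇐ q))
                    }
                  ; ∙-cong = λ p q → ⇒ (≋.+ᴹ-cong (⇐ p) (⇐ q))
                  }
                ; assoc = λ u v w → ⇒ (≋.+ᴹ-assoc u v w)
                }
              ; identity = (λ v → ⇒ (≋.+ᴹ-identityˡ v)) , (λ v → ⇒ (≋.+ᴹ-identityʳ v))
              }
            ; comm = λ v w → ⇒ (≋.+ᴹ-comm v w)
            }
          ; isPreleftSemimodule = record
            { *ₗ-cong      = λ p q → ⇒ (≋.*ₗ-cong p (⇐ q))
            ; *ₗ-zeroˡ     = λ v → ⇒ (≋.*ₗ-zeroˡ v)
            ; *ₗ-distribʳ  = λ v a c → ⇒ (≋.*ₗ-distribʳ v a c)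
            ; *ₗ-identityˡ = λ v → ⇒ (≋.*ₗ-identityˡ v)
            ; *ₗ-assoc     = λ a c v → ⇒ (≋.*ₗ-assoc a c v)
            ; *ₗ-zeroʳ     = λ a → ⇒ (≋.*ₗ-zeroʳ a)
            ; *ₗ-distribˡ  = λ a v w → ⇒ (≋.*ₗ-distribˡ a v w)
            }
          }
        ; -ᴹ‿cong    = λ p → ⇒ (≋.-ᴹ‿cong (⇐ p))
        ; -ᴹ‿inverse = (λ v → ⇒ (≋.-ᴹ‿inverseˡ v)) , (λ v → ⇒ (≋.-ᴹ‿inverseʳ v))
        }
      }
    }
    where
    open F k
    ⇒ = ≋⇒≋̂
    ⇐ = ≋̂⇒≋

  -- V̂₀ is spanned by b̂_∅, whose polynomial F is 1.
  b̂∅ : F.Combination 0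
  b̂∅ = F.⟦_⟧ 0 (exponents [] [])

  -- (i, c) ranges over I_{k+1} as i ranges over I_k and c over the colors not in i,
  -- so M̂ sends F(x₁, …, x_k) to F(x₁, …, x_k) x_{k+1}.
  M̂ : ∀ {k} → F.Combination k → F.Combination (suc k)
  M̂ {k} = extend K (Exponents-decSetoid k) (Exponents-decSetoid (suc k)) λ α →
    F.⟦_⟧ (suc k) (α ⋆x)

  module FSum (k : ℕ) = MonoidSum (Module.+ᴹ-commutativeMonoid (V̂ k))

  -- For F = x₁^m x₂^{α₁} ⋯ x_{k+1}^{α_k} the coefficient of b̂_{i′} in D̂ (Σ_i F b̂_i) is
  -- Σ_{c∉i′} x_c^m x_{i′}^α = (p_m - Σⱼ x_{i′ⱼ}^m) x_{i′}^α.
  D̂ : ∀ {k} → F.Combination (suc k) → F.Combination k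
  D̂ {k} = extend K (Exponents-decSetoid (suc k)) (Exponents-decSetoid k) on-monomial
    where
    open Module (V̂ k) using (_+ᴹ_; -ᴹ_; _*ₗ_)
    on-monomial : Exponents (suc k) → F.Combination k
    on-monomial (exponents (m ∷ α) pos) =
      p m *ₗ F.⟦_⟧ k α′ +ᴹ -ᴹ FSum.sum k (λ j → F.⟦_⟧ k (raise m α′ j))
      where
      α′ : Exponents k
      α′ = exponents α (All-tail pos)

-- The field K = ℚ(e₁, e₂, …). The elementary symmetric functions in
-- infinitely many variables are algebraically independent, so they are
-- taken to be the variables of a polynomial ring.
ℚ-nonzero-* : ∀ {a b} → a ≢ 0ℚ → b ≢ 0ℚ → a ℚ.* b ≢ 0ℚ
ℚ-nonzero-* {a} {b} a≢0 b≢0 ab≡0 = b≢0 (begin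
  b                     ≡⟨ ℚ.*-identityˡ b ⟨
  1ℚ ℚ.* b              ≡⟨ ≡.cong (ℚ._* b) (ℚ.*-inverseˡ a) ⟨
  ℚ.1/ a ℚ.* a ℚ.* b    ≡⟨ ℚ.*-assoc (ℚ.1/ a) a b ⟩
  ℚ.1/ a ℚ.* (a ℚ.* b)  ≡⟨ ≡.cong (ℚ.1/ a ℚ.*_) ab≡0 ⟩
  ℚ.1/ a ℚ.* 0ℚ         ≡⟨ ℚ.*-zeroʳ (ℚ.1/ a) ⟩
  0ℚ                    ∎)
  where
  open ≡.≡-Reasoning
  instance _ = ℚ.≢-nonZero a≢0

module ℚ[e] where
  open Polynomials ℚ.+-*-commutativeRing public
  open PolynomialDomain ℚ.+-*-commutativeRing (ℚ._≟ 0ℚ) ℚ-nonzero-* public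
    using (nonzero-⊛; ≋0-stable)

  monomial≉0 : ∀ α → ¬ (⟦ α ⟧ ≋ [])
  monomial≉0 α (mk≋ z) with () ← ≡.trans (≡.sym (≡.cong (λ q → 1ℚ ℚ.* q ℚ.+ 0ℚ) (δ-yes {α} ≐-refl))) (z α)

module ℚ⟨e⟩ = FractionField ℚ[e].polynomialRing (ℚ[e].monomial≉0 [])
                ℚ[e].nonzero-⊛ ℚ[e].≋0-stable

K : CommutativeRing 0ℓ 0ℓ
K = ℚ⟨e⟩.fractionField

module K = CommutativeRing K

fromℚ : ℚ → K.Carrier
fromℚ q = ℚ⟨e⟩.↑ ((q , []) ∷ [])

-- By the convention t₀ = 1 for monomials, e 0 is 1.
e : ℕ → K.Carrier
e j = ℚ⟨e⟩.↑ ℚ[e].⟦ power j 1 ⟧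

e≉0 : ∀ j → ¬ (e j K.≈ K.0#)
e≉0 j (ℚ⟨e⟩.mk≃ z) = ℚ[e].nonzero-⊛ (ℚ[e].monomial≉0 (power j 1)) (ℚ[e].monomial≉0 []) z

e⁻¹ : ℕ → K.Carrier
e⁻¹ j = e j ℚ⟨e⟩.⁻¹⟨ e≉0 j ⟩

open Maps K fromℚ e e⁻¹ public

{-# OPTIONS --safe #-}

-- Put Θ = MD - DM and Θ̂ = M̂D̂ - D̂M̂; the latter is F ↦ x_k F(x_k, x₁, …, x_{k-1}). The symmetric
-- groups act on V_k by Young's seminormal form (S below) and on V̂_k by permuting the variables, and
-- all relations between M, D and the transpositions reduce to
--   (1 + s)MDM = MMD + DMM   and   DMD(1 + s) = MDD + DDM.
-- A(y ∣ σ) is the residue at y-1 of G(w) = ∏ (1 + 1/(w-b)), b ranging over 0 and the σᵣ. Hence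
-- M b_σ and the vectors Θ b_{s,σ} are related to the b_{σ,y} by a Cauchy matrix, which partial fractions
-- of G and 1/G invert: b_{σ,y} is a combination of M b_σ and of vectors Θ b_{s,σ} of smaller degree.
-- Replacing M and Θ by M̂ and Θ̂ in this combination defines U recursively, with UM = M̂U and UΘ = Θ̂U.
-- By induction on the degree U commutes with the symmetric groups, and then D̂U = UD follows from
-- DM = MD - Θ and DΘ = ΘDs₁, starting from Newton's identities for k = 1.
module Submission where

open import Algebra.Bundles using (AbelianGroup; CommutativeMonoid; CommutativeRing)
open import Algebra.Module.Bundles using (Module)
open import Algebra.Module.Morphism.Structures using (IsModuleHomomorphism)
import Algebra.Properties.CommutativeSemigroup as SemigroupProperties
import Algebra.Properties.Group as GroupProperties
import Algebra.Properties.Ring as RingProperties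
import Algebra.Solver.CommutativeMonoid as MonoidSolver
import Algebra.Solver.Ring as RingSolver
open import Algebra.Solver.Ring.AlmostCommutativeRing
  using (fromCommutativeRing; _-Raw-AlmostCommutative⟶_)
open import Data.Empty using (⊥-elim)
open import Data.Fin.Base using (Fin; zero; suc; fromℕ; inject₁; toℕ)
import Data.Fin.Properties as Fin
open import Data.Fin.Relation.Unary.Top using (view; ‵fromℕ; ‵inject₁)
open import Data.Integer.Base using (ℤ; +_; -[1+_]; 0ℤ; 1ℤ; -1ℤ)
import Data.Integer.Base as ℤ
import Data.Integer.Properties as ℤ
import Data.Integer.Solver as ℤSolver
open import Data.List.Base using ([]; _∷_; _++_)
open import Data.Maybe.Base using (Maybe)
import Data.Maybe.Base as Maybe
open import Data.Nat.Base using (ℕ; zero; suc; pred; NonZero; z≤n; s≤s)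
import Data.Nat.Base as ℕ
import Data.Nat.Properties as ℕ
open import Data.Product.Base using (Σ; ∃; _×_; _,_; proj₁; proj₂)
open import Data.Rational.Base using (ℚ; 0ℚ; 1ℚ; _÷_)
import Data.Rational.Base as ℚ
import Data.Rational.Properties as ℚ
import Data.Rational.Unnormalised.Base as ℚᵘ
import Data.Rational.Unnormalised.Properties as ℚᵘ
open import Data.Vec.Base using (Vec; []; _∷_; _∷ʳ_; head; init; initLast; last; lookup; updateAt)
open import Data.Vec.Membership.DecPropositional ℕ._≟_ using (_∈?_)
open import Data.Vec.Membership.Propositional using (_∈_; _∉_)
open import Data.Vec.Membership.Propositional.Properties using (∈-lookup)
import Data.Vec.Properties as Vec
open import Data.Vec.Relation.Unary.All using (All; []; _∷_)
import Data.Vec.Relation.Unary.All as All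
open import Data.Vec.Relation.Unary.AllPairs using ([]; _∷_; allPairs?)
open import Data.Vec.Relation.Unary.Any using (here; there)
open import Data.Vec.Relation.Unary.Unique.Propositional using (Unique)
open import Data.Vec.Relation.Unary.Unique.Propositional.Properties using (lookup-injective)
open import Level using (Level; 0ℓ)
open import Relation.Binary.Bundles using (DecSetoid)
open import Relation.Binary.PropositionalEquality using (_≡_; _≢_)
import Relation.Binary.PropositionalEquality as ≡
import Relation.Binary.Reasoning.Setoid as SetoidReasoning
open import Relation.Nullary using (¬_; ¬?; Dec; yes; no; recompute)
import Relation.Nullary.Decidable as Dec
open import Defs using (module FreeModule; extend; module Maps; module FractionField; IsZero; NoZeroDivisors;
  I; ∅; tuple; entries; entries-injective; I-decSetoid; dropFirst; A-one; A-succ; ι; ι-nonZero;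
  ι-difference-nonZero; ∷ʳ-all; ∷ʳ-unique; module ∏;
  Exponents; exponents; Exponents-decSetoid; degrees; degrees-injective; raise; _⋆x)

-- The required equations do not define U directly. UM = M̂U fixes one combination of the U b_{σ,y}
-- for each σ, and D̂U = UD would have to be solved for an argument of D̂. Their consequence UΘ =
-- Θ̂U is usable, because Θ̂ merely relabels monomials: each s outside σ gives one more linear
-- equation for the same unknowns. But its right side Θ̂U b_{s,σ} is on the same level k, so the
-- recursion needs a measure on tuples of equal length; `degree` is made for this. The equations are
-- dependent: M b_σ plus a combination of normalized Θ b_{p-1,σ}, with p running over 0 and the σᵣ,
-- would vanish, except that p = 0 stands for a tuple starting with -1. Adding 1/z times this
-- dependence to the Cauchy inverse for b_{σ,z} removes exactly the term p = 0 and brings in M b_σ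
-- with coefficient 1/z. The inverse is needed on both sides: that b_{σ,z} is expressed through M
-- and Θ carries the inductions on the degree, and that interpolated values return arbitrary data
-- shows that the U so defined does satisfy UM = M̂U and UΘ = Θ̂U.

-- Partial fractions

-- The inverse is made total by `r 0ℤ ≈ 0#`. A factor 1 + ε/(w - b) is then defined for all integers
-- and equals 1 at its pole, so that one formula serves for values and for residues.
record IntegerInverses (K : CommutativeRing 0ℓ 0ℓ) : Set where
  open CommutativeRing K
  field
    num    : ℤ → Carrier
    num-+  : ∀ m n → num (m ℤ.+ n) ≈ num m + num n
    num-*  : ∀ m n → num (m ℤ.* n) ≈ num m * num n
    num--  : ∀ n → num (ℤ.- n) ≈ - num n
    num-0  : num 0ℤ ≈ 0#
    num-1  : num 1ℤ ≈ 1#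
    r      : ℤ → Carrier
    num*r  : ∀ {n} → n ≢ 0ℤ → num n * r n ≈ 1#
    r-0    : r 0ℤ ≈ 0#

module Residues (K : CommutativeRing 0ℓ 0ℓ) (inverses : IntegerInverses K) where

  open CommutativeRing K
  open IntegerInverses inverses
  open RingProperties ring
  open SetoidReasoning setoid
  open ℤSolver.+-*-Solver using () renaming
    (solve to solveℤ; _:=_ to _:≡_; _:+_ to _⊹_; _:-_ to _⊖_; :-_ to ⊝_)

  private
    coefficients : CommutativeRing 0ℓ 0ℓ
    coefficients = ℤ.+-*-commutativeRing

    -- Makes the solver constants 0 and 1 stand for 0# and 1# on the nose.
    literal : ℤ → Carrier
    literal (+ 0)             = 0#
    literal (+ 1)             = 1#
    literal (+ suc (suc n))   = num (+ suc (suc n))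
    literal -[1+ n ]          = num -[1+ n ]

    literal≈num : ∀ n → literal n ≈ num n
    literal≈num (+ 0)             = sym num-0
    literal≈num (+ 1)             = sym num-1
    literal≈num (+ suc (suc n))   = refl
    literal≈num -[1+ n ]          = refl

    morphism : CommutativeRing.rawRing coefficients -Raw-AlmostCommutative⟶ fromCommutativeRing K
    morphism = record
      { ⟦_⟧    = literal
      ; +-homo = λ m n → trans (literal≈num (m ℤ.+ n)) (trans (num-+ m n)
                   (+-cong (sym (literal≈num m)) (sym (literal≈num n))))
      ; *-homo = λ m n → trans (literal≈num (m ℤ.* n)) (trans (num-* m n)
                   (*-cong (sym (literal≈num m)) (sym (literal≈num n))))
      ; -‿homo = λ n → trans (literal≈num (ℤ.- n)) (trans (num-- n) (-‿cong (sym (literal≈num n))))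
      ; 0-homo = refl
      ; 1-homo = refl
      }

    coefficient≟ : ∀ m n → Maybe (literal m ≈ literal n)
    coefficient≟ m n = Maybe.map (λ m≡n → reflexive (≡.cong literal m≡n)) (Dec.dec⇒maybe (m ℤ.≟ n))

  module Solver = RingSolver (CommutativeRing.rawRing coefficients)
    (fromCommutativeRing K) morphism coefficient≟

  open Solver using (solve; _:=_; _:*_; _:+_; _:-_; :-_; con; Polynomial)

  :0 :1 : ∀ {n} → Polynomial n
  :0 = con 0ℤ
  :1 = con 1ℤ

  r-cong : ∀ {m n} → m ≡ n → r m ≈ r n
  r-cong m≡n = reflexive (≡.cong r m≡n)

  r-unique : ∀ {n x} → n ≢ 0ℤ → num n * x ≈ 1# → x ≈ r n
  r-unique {n} {x} n≢0 nx≈1 = begin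
    x                   ≈⟨ *-identityˡ x ⟨
    1# * x              ≈⟨ *-congʳ (num*r n≢0) ⟨
    num n * r n * x     ≈⟨ solve 3 (λ n r x → n :* r :* x := r :* (n :* x)) refl (num n) (r n) x ⟩
    r n * (num n * x)   ≈⟨ *-congˡ nx≈1 ⟩
    r n * 1#            ≈⟨ *-identityʳ (r n) ⟩
    r n                 ∎

  r-1 : r 1ℤ ≈ 1#
  r-1 = sym (r-unique (λ ()) (trans (*-identityʳ _) num-1))

  r-neg : ∀ n → r (ℤ.- n) ≈ - r n
  r-neg n with n ℤ.≟ 0ℤ
  ... | yes ≡.refl = trans r-0 (trans (sym -0#≈0#) (-‿cong (sym r-0)))
  ... | no n≢0     = sym (r-unique (λ -n≡0 → n≢0 (ℤ.neg-injective -n≡0)) (begin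
    num (ℤ.- n) * - r n   ≈⟨ *-congʳ (num-- n) ⟩
    - num n * - r n       ≈⟨ solve 2 (λ n r → :- n :* :- r := n :* r) refl (num n) (r n) ⟩
    num n * r n           ≈⟨ num*r n≢0 ⟩
    1#                    ∎))

  r--1 : r -1ℤ ≈ - 1#
  r--1 = trans (r-neg 1ℤ) (-‿cong r-1)

  -- 1/(mn) = (1/m + 1/n)/(m + n). Directly or in the telescoping form `r-split`, this is what
  -- separates products of inverse differences throughout.
  r-* : ∀ {m n} → m ≢ 0ℤ → n ≢ 0ℤ → m ℤ.+ n ≢ 0ℤ → r m * r n ≈ r (m ℤ.+ n) * (r m + r n)
  r-* {m} {n} m≢0 n≢0 m+n≢0 = begin
    r m * r n
      ≈⟨ *-identityˡ _ ⟨
    1# * (r m * r n)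
      ≈⟨ *-congʳ (num*r m+n≢0) ⟨
    num (m ℤ.+ n) * r (m ℤ.+ n) * (r m * r n)
      ≈⟨ *-congʳ (*-congʳ (num-+ m n)) ⟩
    (num m + num n) * r (m ℤ.+ n) * (r m * r n)
      ≈⟨ solve 5 (λ m n s x y → (m :+ n) :* s :* (x :* y)
           := s :* ((m :* x) :* y :+ (n :* y) :* x)) refl (num m) (num n) (r (m ℤ.+ n)) (r m) (r n) ⟩
    r (m ℤ.+ n) * ((num m * r m) * r n + (num n * r n) * r m)
      ≈⟨ *-congˡ (+-cong (*-congʳ (num*r m≢0)) (*-congʳ (num*r n≢0))) ⟩
    r (m ℤ.+ n) * (1# * r n + 1# * r m)
      ≈⟨ *-congˡ (trans (+-cong (*-identityˡ _) (*-identityˡ _)) (+-comm _ _)) ⟩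
    r (m ℤ.+ n) * (r m + r n) ∎

  infix 9 _⊘_
  _⊘_ : ℕ → ℕ → Carrier
  a ⊘ b = r (+ a ℤ.- + b)

  r-split : ∀ {a b c} → a ≢ b → b ≢ c → a ≢ c →
            r (a ℤ.- b) * r (b ℤ.- c) ≈ r (a ℤ.- c) * (r (a ℤ.- b) + r (b ℤ.- c))
  r-split {a} {b} {c} a≢b b≢c a≢c =
    trans (r-* (λ z → a≢b (ℤ.i-j≡0⇒i≡j a b z)) (λ z → b≢c (ℤ.i-j≡0⇒i≡j b c z))
               (λ z → a≢c (ℤ.i-j≡0⇒i≡j a c (≡.trans (≡.sym telescope) z))))
          (*-congʳ (r-cong telescope))
    where
    telescope : (a ℤ.- b) ℤ.+ (b ℤ.- c) ≡ a ℤ.- c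
    telescope = solveℤ 3 (λ a b c → (a ⊖ b) ⊹ (b ⊖ c) :≡ a ⊖ c) ≡.refl a b c

  r-flip : ∀ a b → r (a ℤ.- b) ≈ - r (b ℤ.- a)
  r-flip a b = trans (r-cong (solveℤ 2 (λ a b → a ⊖ b :≡ ⊝ (b ⊖ a)) ≡.refl a b)) (r-neg _)

  r-self : ∀ a → r (a ℤ.- a) ≈ 0#
  r-self a = trans (r-cong (ℤ.+-inverseʳ a)) r-0

  ∑ : ∀ {n} {A : Set} → Vec A n → (A → Carrier) → Carrier
  ∑ []      f = 0#
  ∑ (a ∷ S) f = f a + ∑ S f

  ∑-cong : ∀ {n} {A : Set} (S : Vec A n) {f g : A → Carrier} →
           (∀ {a} → a ∈ S → f a ≈ g a) → ∑ S f ≈ ∑ S g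
  ∑-cong []      eq = refl
  ∑-cong (a ∷ S) eq = +-cong (eq (here ≡.refl)) (∑-cong S (λ a∈S → eq (there a∈S)))

  ∑-+ : ∀ {n} {A : Set} (S : Vec A n) (f g : A → Carrier) →
        ∑ S (λ a → f a + g a) ≈ ∑ S f + ∑ S g
  ∑-+ []      f g = sym (+-identityˡ 0#)
  ∑-+ (a ∷ S) f g = trans (+-congˡ (∑-+ S f g))
    (solve 4 (λ x y s t → (x :+ y) :+ (s :+ t) := (x :+ s) :+ (y :+ t)) refl _ _ _ _)

  ∑-*ˡ : ∀ {n} {A : Set} (S : Vec A n) x (f : A → Carrier) →
         ∑ S (λ a → x * f a) ≈ x * ∑ S f
  ∑-*ˡ []      x f = sym (zeroʳ x)
  ∑-*ˡ (a ∷ S) x f = trans (+-congˡ (∑-*ˡ S x f)) (sym (distribˡ _ _ _))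

  ∑-*ʳ : ∀ {n} {A : Set} (S : Vec A n) x (f : A → Carrier) →
         ∑ S (λ a → f a * x) ≈ ∑ S f * x
  ∑-*ʳ S x f = trans (∑-cong S (λ _ → *-comm _ _)) (trans (∑-*ˡ S x f) (*-comm _ _))

  ∑-neg : ∀ {n} {A : Set} (S : Vec A n) (f : A → Carrier) → ∑ S (λ a → - f a) ≈ - ∑ S f
  ∑-neg []      f = sym -0#≈0#
  ∑-neg (a ∷ S) f = trans (+-congˡ (∑-neg S f)) (-‿+-comm _ _)

  ∑-0 : ∀ {n} {A : Set} (S : Vec A n) → ∑ S (λ _ → 0#) ≈ 0#
  ∑-0 []      = refl
  ∑-0 (a ∷ S) = trans (+-identityˡ _) (∑-0 S)

  ∑-zero : ∀ {n} {A : Set} (S : Vec A n) {f : A → Carrier} → (∀ {a} → a ∈ S → f a ≈ 0#) → ∑ S f ≈ 0#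
  ∑-zero S f≈0 = trans (∑-cong S f≈0) (∑-0 S)

  ∑-swap : ∀ {m n} {A B : Set} (S : Vec A m) (T : Vec B n) (f : A → B → Carrier) →
           ∑ S (λ a → ∑ T (f a)) ≈ ∑ T (λ b → ∑ S (λ a → f a b))
  ∑-swap []      T f = sym (∑-0 T)
  ∑-swap (a ∷ S) T f = trans (+-congˡ (∑-swap S T f)) (sym (∑-+ T (f a) _))

  ∑-∷ʳ : ∀ {n} {A : Set} (S : Vec A n) a (f : A → Carrier) → ∑ (S ∷ʳ a) f ≈ ∑ S f + f a
  ∑-∷ʳ []      a f = +-comm _ _
  ∑-∷ʳ (b ∷ S) a f = trans (+-congˡ (∑-∷ʳ S a f)) (sym (+-assoc _ _ _))

  factor : Carrier → ℤ → ℕ → Carrier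
  factor ε w b = 1# + ε * r (w ℤ.- + b)

  -- A vanishing denominator w - b contributes the factor 1, so for w ∈ S this is the residue at w up to ε.
  G : ∀ {n} → Carrier → Vec ℕ n → ℤ → Carrier
  G ε []      w = 1#
  G ε (b ∷ S) w = factor ε w b * G ε S w

  factor-self : ∀ ε b → factor ε (+ b) b ≈ 1#
  factor-self ε b = trans (+-congˡ (trans (*-congˡ (r-self (+ b))) (zeroʳ ε))) (+-identityʳ 1#)

  G-zero : ∀ {n ε} {S : Vec ℕ n} {w b} → b ∈ S → factor ε w b ≈ 0# → G ε S w ≈ 0#
  G-zero (here ≡.refl) z = trans (*-congʳ z) (zeroˡ _)
  G-zero (there b∈S)   z = trans (*-congˡ (G-zero b∈S z)) (zeroʳ _)

  Avoids : ∀ {n} → ℤ → Vec ℕ n → Set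
  Avoids w = All (λ b → w ≢ + b)

  avoids : ∀ {n} {b : ℕ} {S : Vec ℕ n} → All (b ≢_) S → Avoids (+ b) S
  avoids = All.map (λ b≢a b≡a → b≢a (ℤ.+-injective b≡a))

  residue-sum : ∀ {n} → Carrier → Vec ℕ n → ℤ → Carrier
  residue-sum ε S w = ∑ S λ a → G ε S (+ a) * r (w ℤ.- + a)

  all-∈ : ∀ {n} {P : ℕ → Set} {S : Vec ℕ n} {a} → All P S → a ∈ S → P a
  all-∈ (p ∷ _)  (here ≡.refl) = p
  all-∈ (_ ∷ ps) (there a∈S)   = all-∈ ps a∈S

  -- Induction on the poles: the expansion for `S` is multiplied by the factor of s, and each
  -- product of two poles is separated by `r-split`.
  partial-fractions : ∀ {n} ε {S : Vec ℕ n} → Unique S → ∀ {w} → Avoids w S →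
                      G ε S w ≈ 1# + ε * residue-sum ε S w
  partial-fractions ε {[]}    []         _ =
    solve 1 (λ ε → :1 := :1 :+ ε :* :0) refl ε
  partial-fractions ε {s ∷ S} (s≢S ∷ S!) {w} (w≢s ∷ w∉S) = begin
    (1# + ε * ρ) * G ε S w
      ≈⟨ *-congˡ (partial-fractions ε S! w∉S) ⟩
    (1# + ε * ρ) * (1# + ε * W)
      ≈⟨ solve 4 (λ ε ρ W T → (:1 :+ ε :* ρ) :* (:1 :+ ε :* W)
           := :1 :+ ε :* ((:1 :+ ε :* (:- T)) :* ρ :+ (W :+ ε :* ρ :* (T :+ W))))
         refl ε ρ W T ⟩
    1# + ε * ((1# + ε * (- T)) * ρ + (W + ε * ρ * (T + W)))
      ≈⟨ +-congˡ (*-congˡ (+-cong (*-congʳ at-s) tail-sum)) ⟨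
    1# + ε * residue-sum ε (s ∷ S) w ∎
    where
    ρ = r (w ℤ.- + s)
    g : ℕ → Carrier
    g a = G ε S (+ a)
    W = ∑ S λ a → g a * r (w ℤ.- + a)
    T = ∑ S λ a → g a * (a ⊘ s)
    -- The residue at the new pole s is the value of the old product at s, so the induction
    -- hypothesis is used a second time, with w = s.
    at-s : factor ε (+ s) s * G ε S (+ s) ≈ 1# + ε * (- T)
    at-s = begin
      factor ε (+ s) s * G ε S (+ s)
        ≈⟨ trans (*-congʳ (factor-self ε s)) (*-identityˡ _) ⟩
      G ε S (+ s)
        ≈⟨ partial-fractions ε S! (avoids s≢S) ⟩
      1# + ε * (∑ S λ a → g a * (s ⊘ a))
        ≈⟨ +-congˡ (*-congˡ (trans (∑-cong S λ {a} _ → trans (*-congˡ (r-flip (+ s) (+ a)))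
             (sym (-‿distribʳ-* _ _))) (∑-neg S _))) ⟩
      1# + ε * (- T) ∎
    tail-sum : (∑ S λ a → G ε (s ∷ S) (+ a) * r (w ℤ.- + a)) ≈ W + ε * ρ * (T + W)
    tail-sum = begin
      (∑ S λ a → factor ε (+ a) s * g a * r (w ℤ.- + a))
        ≈⟨ ∑-cong S (λ {a} a∈S → begin
             (1# + ε * (a ⊘ s)) * g a * r (w ℤ.- + a)
               ≈⟨ solve 4 (λ ε x g y → (:1 :+ ε :* x) :* g :* y := g :* y :+ ε :* g :* (y :* x))
                  refl ε _ (g a) _ ⟩
             g a * r (w ℤ.- + a) + ε * g a * (r (w ℤ.- + a) * (a ⊘ s))
               ≈⟨ +-congˡ (*-congˡ (r-split (all-∈ w∉S a∈S)
                    (λ a≡s → all-∈ s≢S a∈S (≡.sym (ℤ.+-injective a≡s))) w≢s)) ⟩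
             g a * r (w ℤ.- + a) + ε * g a * (ρ * (r (w ℤ.- + a) + (a ⊘ s)))
               ≈⟨ solve 5 (λ ε ρ g x y → g :* y :+ ε :* g :* (ρ :* (y :+ x))
                    := g :* y :+ ε :* ρ :* (g :* x :+ g :* y)) refl ε ρ (g a) _ _ ⟩
             g a * r (w ℤ.- + a) + ε * ρ * (g a * (a ⊘ s) + g a * r (w ℤ.- + a)) ∎) ⟩
      (∑ S λ a → g a * r (w ℤ.- + a) + ε * ρ * (g a * (a ⊘ s) + g a * r (w ℤ.- + a)))
        ≈⟨ trans (∑-+ S _ _) (+-congˡ (trans (∑-*ˡ S _ _) (*-congˡ (∑-+ S _ _)))) ⟩
      W + ε * ρ * (T + W) ∎

  -- G and 1/G are products of the same shape, since 1 + ε/x has the inverse 1 - ε/(x + ε). The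
  -- facts on reciprocals are therefore stated for a sign ε and applied for both signs.
  record IsSign (ε : ℤ) (ε̂ : Carrier) : Set where
    field
      ε≢0  : ε ≢ 0ℤ
      r-ε  : r ε ≈ ε̂
      ε̂²≈1 : ε̂ * ε̂ ≈ 1#

  +1-isSign : IsSign 1ℤ 1#
  +1-isSign = record { ε≢0 = λ () ; r-ε = r-1 ; ε̂²≈1 = *-identityˡ 1# }

  -1-isSign : IsSign -1ℤ (- 1#)
  -1-isSign = record { ε≢0 = λ () ; r-ε = r--1
    ; ε̂²≈1 = solve 0 (:- :1 :* :- :1 := :1) refl }

  module Signed {ε : ℤ} {ε̂ : Carrier} (sign : IsSign ε ε̂) where

    open IsSign sign

    r-shift : ∀ q → r ((q ℤ.- ε) ℤ.- q) ≈ - ε̂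
    r-shift q = trans (r-cong (solveℤ 2 (λ q ε → (q ⊖ ε) ⊖ q :≡ ⊝ ε) ≡.refl q ε))
                (trans (r-neg ε) (-‿cong r-ε))

    shift-≢ : ∀ q → q ℤ.- ε ≢ q
    shift-≢ q eq = ε≢0 (≡.trans (solveℤ 2 (λ q ε → ε :≡ q ⊖ (q ⊖ ε)) ≡.refl q ε)
      (≡.trans (≡.cong (λ x → q ℤ.- x) eq) (ℤ.+-inverseʳ q)))

    factor-shift : ∀ q → factor ε̂ (+ q ℤ.- ε) q ≈ 0#
    factor-shift q = trans (+-congˡ (trans (*-congˡ (r-shift (+ q)))
      (trans (sym (-‿distribʳ-* ε̂ ε̂)) (-‿cong ε̂²≈1)))) (-‿inverseʳ 1#)

    G-shift : ∀ {n} {S : Vec ℕ n} {q} → q ∈ S → G ε̂ S (+ q ℤ.- ε) ≈ 0#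
    G-shift {q = q} q∈S = G-zero q∈S (factor-shift q)

    -- As fractions, the two factors are (q - b - ε)/(q - b) and (q - b)/(q - b - ε).
    factor-dual : ∀ {q b} → q ≢ + b → q ℤ.- ε ≢ + b → factor (- ε̂) q b * factor ε̂ (q ℤ.- ε) b ≈ 1#
    factor-dual {q} {b} q≢b u≢b = begin
      (1# + - ε̂ * x) * (1# + ε̂ * y)
        ≈⟨ solve 3 (λ ε x y → (:1 :+ (:- ε) :* x) :* (:1 :+ ε :* y)
             := :1 :+ (ε :* (y :- x) :+ (ε :* ε) :* (y :* (:- x)))) refl ε̂ x y ⟩
      1# + (ε̂ * (y - x) + (ε̂ * ε̂) * (y * - x))
        ≈⟨ +-congˡ (+-congˡ (*-cong ε̂²≈1 (trans (*-congˡ (sym (r-flip (+ b) q)))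
             (r-split u≢b (λ b≡q → q≢b (≡.sym b≡q)) (shift-≢ q))))) ⟩
      1# + (ε̂ * (y - x) + 1# * (r (q ℤ.- ε ℤ.- q) * (y + r (+ b ℤ.- q))))
        ≈⟨ +-congˡ (+-congˡ (*-congˡ (*-cong (r-shift q) (+-congˡ (r-flip (+ b) q))))) ⟩
      1# + (ε̂ * (y - x) + 1# * (- ε̂ * (y + - x)))
        ≈⟨ solve 3 (λ ε x y → :1 :+ (ε :* (y :- x) :+ :1 :* ((:- ε) :* (y :+ :- x))) := :1)
             refl ε̂ x y ⟩
      1# ∎
      where
      x = r (q ℤ.- + b)
      y = r (q ℤ.- ε ℤ.- + b)

    G-dual : ∀ {n} {S : Vec ℕ n} {q} → Avoids q S → Avoids (q ℤ.- ε) S → G (- ε̂) S q * G ε̂ S (q ℤ.- ε) ≈ 1#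
    G-dual {S = []}    []          []          = *-identityˡ 1#
    G-dual {S = b ∷ S} (q≢b ∷ q∉S) (u≢b ∷ u∉S) = trans
      (solve 4 (λ a b c d → (a :* b) :* (c :* d) := (a :* c) :* (b :* d)) refl _ _ _ _)
      (trans (*-cong (factor-dual q≢b u≢b) (G-dual q∉S u∉S)) (*-identityˡ 1#))

    -- Up to the factor -ε this is the derivative at u of `G ε̂ S`, taken term by term in its
    -- partial fraction expansion.
    double-sum : ∀ {n} → Vec ℕ n → ℤ → Carrier
    double-sum S u = ∑ S λ a → G ε̂ S (+ a) * (r (u ℤ.- + a) * r (u ℤ.- + a))

    -- The product rule for the derivative encoded by `double-sum`, when the factor 1 + ε/(u - s) is
    -- added.
    double-sum-∷ : ∀ {n s u} {S : Vec ℕ n} → All (s ≢_) S → Unique S → u ≢ + s → Avoids u S →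
                   double-sum (s ∷ S) u ≈ factor ε̂ u s * double-sum S u + r (u ℤ.- + s) * r (u ℤ.- + s) * G ε̂ S u
    double-sum-∷ {s = s} {u} {S} s≢S S! u≢s u∉S = begin
      factor ε̂ (+ s) s * g s * (ρ * ρ)
        + (∑ S λ a → G ε̂ (s ∷ S) (+ a) * (r (u ℤ.- + a) * r (u ℤ.- + a)))
        ≈⟨ +-cong (*-congʳ (trans (*-congʳ (factor-self ε̂ s)) (trans (*-identityˡ _)
             (partial-fractions ε̂ S! (avoids s≢S))))) tail-sum ⟩
      (1# + ε̂ * T) * (ρ * ρ) + ((1# + ε̂ * ρ) * D + ε̂ * (ρ * ρ) * (W + - T))
        ≈⟨ solve 5 (λ ε ρ T W D → (:1 :+ ε :* T) :* (ρ :* ρ)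
             :+ ((:1 :+ ε :* ρ) :* D :+ ε :* (ρ :* ρ) :* (W :+ :- T))
             := (:1 :+ ε :* ρ) :* D :+ ρ :* ρ :* (:1 :+ ε :* W)) refl ε̂ ρ T W D ⟩
      (1# + ε̂ * ρ) * D + ρ * ρ * (1# + ε̂ * W)
        ≈⟨ +-congˡ (*-congˡ (partial-fractions ε̂ S! u∉S)) ⟨
      (1# + ε̂ * ρ) * D + ρ * ρ * G ε̂ S u ∎
      where
      ρ = r (u ℤ.- + s)
      g : ℕ → Carrier
      g a = G ε̂ S (+ a)
      D = double-sum S u
      T = ∑ S λ a → g a * (s ⊘ a)
      W = ∑ S λ a → g a * r (u ℤ.- + a)
      tail-sum : (∑ S λ a → G ε̂ (s ∷ S) (+ a) * (r (u ℤ.- + a) * r (u ℤ.- + a)))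
                 ≈ (1# + ε̂ * ρ) * D + ε̂ * (ρ * ρ) * (W + - T)
      tail-sum = begin
        (∑ S λ a → factor ε̂ (+ a) s * g a * (r (u ℤ.- + a) * r (u ℤ.- + a)))
          ≈⟨ ∑-cong S (λ {a} a∈S →
               let x = (a ⊘ s); y = r (u ℤ.- + a)
                   yx : y * x ≈ ρ * (y + x)
                   yx = r-split (all-∈ u∉S a∈S) (λ a≡s → all-∈ s≢S a∈S (≡.sym (ℤ.+-injective a≡s))) u≢s
               in begin
               (1# + ε̂ * x) * g a * (y * y)
                 ≈⟨ solve 4 (λ ε x y g → (:1 :+ ε :* x) :* g :* (y :* y)
                      := g :* (y :* y :+ ε :* (y :* (y :* x)))) refl ε̂ x y (g a) ⟩
               g a * (y * y + ε̂ * (y * (y * x)))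
                 ≈⟨ *-congˡ (+-congˡ (*-congˡ (*-congˡ yx))) ⟩
               g a * (y * y + ε̂ * (y * (ρ * (y + x))))
                 ≈⟨ solve 5 (λ ε ρ x y g → g :* (y :* y :+ ε :* (y :* (ρ :* (y :+ x))))
                      := g :* (y :* y :+ ε :* ρ :* (y :* y :+ y :* x))) refl ε̂ ρ x y (g a) ⟩
               g a * (y * y + ε̂ * ρ * (y * y + y * x))
                 ≈⟨ *-congˡ (+-congˡ (*-congˡ (+-congˡ yx))) ⟩
               g a * (y * y + ε̂ * ρ * (y * y + ρ * (y + x)))
                 ≈⟨ solve 5 (λ ε ρ x y g → g :* (y :* y :+ ε :* ρ :* (y :* y :+ ρ :* (y :+ x)))
                      := (:1 :+ ε :* ρ) :* (g :* (y :* y))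
                         :+ ε :* (ρ :* ρ) :* (g :* y :+ :- (g :* :- x))) refl ε̂ ρ x y (g a) ⟩
               (1# + ε̂ * ρ) * (g a * (y * y)) + ε̂ * (ρ * ρ) * (g a * y + - (g a * - x))
                 ≈⟨ +-congˡ (*-congˡ (+-congˡ (-‿cong (*-congˡ (sym (r-flip (+ s) (+ a))))))) ⟩
               (1# + ε̂ * ρ) * (g a * (y * y)) + ε̂ * (ρ * ρ) * (g a * y + - (g a * (s ⊘ a))) ∎) ⟩
        (∑ S λ a → (1# + ε̂ * ρ) * (g a * (r (u ℤ.- + a) * r (u ℤ.- + a)))
                   + ε̂ * (ρ * ρ) * (g a * r (u ℤ.- + a) + - (g a * (s ⊘ a))))
          ≈⟨ trans (∑-+ S _ _) (+-cong (∑-*ˡ S _ _) (trans (∑-*ˡ S _ _)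
               (*-congˡ (trans (∑-+ S _ _) (+-congˡ (∑-neg S _)))))) ⟩
        (1# + ε̂ * ρ) * D + ε̂ * (ρ * ρ) * (W + - T) ∎

    -- The residue of 1/G at a zero of G times the derivative of G there.
    residue-of-inverse : ∀ {n} {S : Vec ℕ n} → Unique S → ∀ {q} → q ∈ S → Avoids (+ q ℤ.- ε) S →
                         G (- ε̂) S (+ q) * double-sum S (+ q ℤ.- ε) ≈ 1#
    -- Of the product rule only the term survives in which the vanishing factor is differentiated;
    -- what remains is `G-dual`.
    residue-of-inverse {S = q ∷ S} (q≢S ∷ S!) (here ≡.refl) (u≢q ∷ u∉S) = begin
      factor (- ε̂) (+ q) q * G (- ε̂) S (+ q) * double-sum (q ∷ S) (+ q ℤ.- ε)
        ≈⟨ *-cong (trans (*-congʳ (factor-self (- ε̂) q)) (*-identityˡ _)) (double-sum-∷ q≢S S! u≢q u∉S) ⟩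
      G (- ε̂) S (+ q) * (factor ε̂ (+ q ℤ.- ε) q * D + ρ * ρ * G ε̂ S (+ q ℤ.- ε))
        ≈⟨ *-congˡ (+-cong (*-congʳ (factor-shift q)) (*-congʳ (*-cong (r-shift (+ q)) (r-shift (+ q))))) ⟩
      G (- ε̂) S (+ q) * (0# * D + - ε̂ * - ε̂ * G ε̂ S (+ q ℤ.- ε))
        ≈⟨ solve 4 (λ x D ε y → x :* (:0 :* D :+ (:- ε) :* (:- ε) :* y) := ε :* ε :* (x :* y)) refl _ D ε̂ _ ⟩
      ε̂ * ε̂ * (G (- ε̂) S (+ q) * G ε̂ S (+ q ℤ.- ε))
        ≈⟨ *-cong ε̂²≈1 (G-dual (avoids q≢S) u∉S) ⟩
      1# * 1#
        ≈⟨ *-identityˡ 1# ⟩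
      1# ∎
      where
      ρ = r (+ q ℤ.- ε ℤ.- + q)
      D = double-sum S (+ q ℤ.- ε)
    -- The vanishing factor now lies in the tail, and the factor of s cancels against its dual.
    residue-of-inverse {S = s ∷ S} (s≢S ∷ S!) {q} (there q∈S) (u≢s ∷ u∉S) = begin
      factor (- ε̂) (+ q) s * G (- ε̂) S (+ q) * double-sum (s ∷ S) (+ q ℤ.- ε)
        ≈⟨ *-congˡ (trans (double-sum-∷ s≢S S! u≢s u∉S)
             (trans (+-congˡ (trans (*-congˡ (G-shift q∈S)) (zeroʳ _))) (+-identityʳ _))) ⟩
      factor (- ε̂) (+ q) s * G (- ε̂) S (+ q) * (factor ε̂ (+ q ℤ.- ε) s * double-sum S (+ q ℤ.- ε))
        ≈⟨ solve 4 (λ a b c d → (a :* b) :* (c :* d) := (a :* c) :* (b :* d)) refl _ _ _ _ ⟩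
      factor (- ε̂) (+ q) s * factor ε̂ (+ q ℤ.- ε) s * (G (- ε̂) S (+ q) * double-sum S (+ q ℤ.- ε))
        ≈⟨ *-cong (factor-dual (λ q≡s → all-∈ s≢S q∈S (≡.sym (ℤ.+-injective q≡s))) u≢s)
                  (residue-of-inverse S! q∈S u∉S) ⟩
      1# * 1#
        ≈⟨ *-identityˡ 1# ⟩
      1# ∎

-- Inverting the Cauchy matrix

module Interpolation (K : CommutativeRing 0ℓ 0ℓ) (inverses : IntegerInverses K) where

  open CommutativeRing K hiding (zero)
  open IntegerInverses inverses
  open Residues K inverses
  open RingProperties ring
  open SetoidReasoning setoid
  open Solver using (solve; _:=_; _:*_; _:+_; _:-_; :-_)
  open ℤSolver.+-*-Solver using () renaming
    (solve to solveℤ; _:=_ to _:≡_; _:+_ to _⊹_; _:-_ to _⊖_; :-_ to ⊝_; con to con′)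

  module S⁺ = Signed +1-isSign
  module S⁻ = Signed -1-isSign

  ∑-single : ∀ {n} {S : Vec ℕ n} → Unique S → ∀ {a₀} → a₀ ∈ S → (f : ℕ → Carrier) →
             (∀ {a} → a ∈ S → a ≢ a₀ → f a ≈ 0#) → ∑ S f ≈ f a₀
  ∑-single (a₀≢S ∷ _) (here ≡.refl) f zeros = trans
    (+-congˡ (∑-zero _ λ a∈S → zeros (there a∈S) λ a≡a₀ → all-∈ a₀≢S a∈S (≡.sym a≡a₀))) (+-identityʳ _)
  ∑-single (a≢S ∷ S!) (there a₀∈S)  f zeros = trans
    (+-cong (zeros (here ≡.refl) (all-∈ a≢S a₀∈S)) (∑-single S! a₀∈S f λ a∈S → zeros (there a∈S))) (+-identityˡ _)

  G-cong : ∀ {n} {ε ε′} → ε ≈ ε′ → (S : Vec ℕ n) → ∀ w → G ε S w ≈ G ε′ S w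
  G-cong ε≈ε′ []      w = refl
  G-cong ε≈ε′ (b ∷ S) w = *-cong (+-congˡ (*-congʳ ε≈ε′)) (G-cong ε≈ε′ S w)

  +-≢ : ∀ {a b} → a ≢ b → + a ≢ + b
  +-≢ a≢b eq = a≢b (ℤ.+-injective eq)

  ∉-avoids : ∀ {n} {S : Vec ℕ n} {a} → a ∉ S → Avoids (+ a) S
  ∉-avoids {S = []}    a∉S = []
  ∉-avoids {S = b ∷ S} a∉S = (λ a≡b → a∉S (here (ℤ.+-injective a≡b))) ∷ ∉-avoids (λ a∈S → a∉S (there a∈S))

  negative-avoids : ∀ {n} {S : Vec ℕ n} {m} → Avoids -[1+ m ] S
  negative-avoids {S = []}    = []
  negative-avoids {S = b ∷ S} = (λ ()) ∷ negative-avoids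

  below : ∀ a → + suc a ℤ.- 1ℤ ≡ + a
  below a = ℤ.[1+m]⊖[1+n]≡m⊖n a 0

  above : ∀ a → + a ℤ.- -1ℤ ≡ + suc a
  above a = ≡.cong +_ (ℕ.+-comm a 1)

  -- Where both are regular, `h S w` is the reciprocal of `g S (w - 1)`. At points of `S` the values
  -- are the residues of G and, up to sign, those of the shifted 1/G.
  g h : ∀ {n} → Vec ℕ n → ℤ → Carrier
  g = G 1#
  h = G (- 1#)

  -- The factor of `suc a` is 1 + 1/(a - (a + 1)) = 0. For tuples this is the vanishing of A(y ∣ σ)
  -- at y already in σ.
  g-taken : ∀ {n} {S : Vec ℕ n} {a} → suc a ∈ S → g S (+ a) ≈ 0#
  g-taken {S = S} {a} a∈S = trans (reflexive (≡.cong (g S) (≡.sym (below a)))) (S⁺.G-shift a∈S)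

  h-taken : ∀ {n} {S : Vec ℕ n} {a} → a ∈ S → h S (+ suc a) ≈ 0#
  h-taken {S = S} {a} a∈S = trans (reflexive (≡.cong (h S) (≡.sym (above a)))) (S⁻.G-shift a∈S)

  module _ {n : ℕ} (S : Vec ℕ n) (S! : Unique S) where

    -- For p in `S`, G has a zero at p - 1 unless p - 1 is also a pole. In the case `present` zero
    -- and pole cancel, and `h-taken` makes the coefficient of p vanish; in the case `absent` the
    -- expansion of G may be evaluated at p - 1, which is -1 for p = 0.
    data Predecessor : ℕ → Set where
      present : ∀ {a} → a ∈ S → Predecessor (suc a)
      absent  : ∀ {p} → Avoids (+ p ℤ.- 1ℤ) S → Predecessor p

    predecessor : ∀ p → Predecessor p
    predecessor zero    = absent negative-avoids
    predecessor (suc a) with a ∈? S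
    ... | yes a∈S = present a∈S
    ... | no  a∉S = absent (≡.subst (λ w → Avoids w S) (≡.sym (below a)) (∉-avoids a∉S))

    V W : ℤ → Carrier
    V = residue-sum 1# S
    W = residue-sum (- 1#) S

    g-expand : ∀ {w} → Avoids w S → g S w ≈ 1# + V w
    g-expand w∉S = trans (partial-fractions 1# S! w∉S) (+-congˡ (*-identityˡ _))

    h-expand : ∀ {w} → Avoids w S → h S w ≈ 1# - W w
    h-expand w∉S = trans (partial-fractions (- 1#) S! w∉S) (+-congˡ (-1*x≈-x _))

    V-root : ∀ {w} → Avoids w S → g S w ≈ 0# → V w ≈ - 1#
    V-root {w} w∉S z = begin
      V w                ≈⟨ solve 1 (λ v → v := :- :1 :+ (:1 :+ v)) refl (V w) ⟩
      - 1# + (1# + V w)  ≈⟨ +-congˡ (trans (sym (g-expand w∉S)) z) ⟩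
      - 1# + 0#          ≈⟨ +-identityʳ _ ⟩
      - 1#               ∎

    W-value : ∀ {w} → Avoids w S → W w ≈ 1# - h S w
    W-value {w} w∉S = trans (solve 1 (λ x → x := :1 :- (:1 :- x)) refl (W w))
      (+-congˡ (-‿cong (sym (h-expand w∉S))))

    g*h : ∀ {q} → q ∉ S → Avoids (+ q ℤ.- 1ℤ) S → h S (+ q) * g S (+ q ℤ.- 1ℤ) ≈ 1#
    g*h q∉S q-1∉S = S⁺.G-dual (∉-avoids q∉S) q-1∉S

    module _ {z : ℕ} (z∉S : z ∉ S) (ρ : Carrier) (χ : ℕ → Carrier) where

      -- Let χ y be the value of a functional at the tuple (σ, y), and let `S` consist of 0 and the
      -- σᵣ. Then this is its value on Θ b_{s,σ} with s = q - 1, divided by e_s/e_{s-1}, while Σ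
      -- g(a) χ(a + 1) is its value on M b_σ.
      shifted : ℕ → Carrier
      shifted q = (∑ S λ a → g S (+ a) * (r (+ q ℤ.- 1ℤ ℤ.- + a) * χ (suc a))) - g S (+ q ℤ.- 1ℤ) * χ q

      private
        weight : ℕ → Carrier
        weight p = h S (+ p) * ((z ⊘ p) - ρ)

        -- The total factor of g(a) χ(a + 1) in the decomposition below. It has to vanish unless a +
        -- 1 = z or g(a) = 0.
        bracket : ℕ → Carrier
        bracket a = ρ - (∑ S λ p → weight p * (p ⊘ suc a)) - h S (+ z) * (z ⊘ suc a)

        shift-r : ∀ p a → r (+ p ℤ.- 1ℤ ℤ.- + a) ≈ (p ⊘ suc a)
        shift-r p a = r-cong (solveℤ 2 (λ p a → p ⊖ con′ 1ℤ ⊖ a :≡ p ⊖ (con′ 1ℤ ⊹ a)) ≡.refl (+ p) (+ a))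

        inner-sum : ∀ a → (∑ S λ p → weight p * (p ⊘ suc a))
                    ≈ (∑ S λ p → h S (+ p) * ((z ⊘ p) * (p ⊘ suc a))) - ρ * - W (+ suc a)
        inner-sum a = begin
          (∑ S λ p → weight p * (p ⊘ suc a))
            ≈⟨ ∑-cong S (λ {p} _ → trans
                 (solve 4 (λ h x ρ y → h :* (x :- ρ) :* y := h :* (x :* y) :+ (:- ρ) :* (h :* y)) refl _ _ _ _)
                 (+-congˡ (*-congˡ (*-congˡ (r-flip (+ p) (+ suc a)))))) ⟩
          (∑ S λ p → h S (+ p) * ((z ⊘ p) * (p ⊘ suc a))
                     + - ρ * (h S (+ p) * - (suc a ⊘ p)))
            ≈⟨ trans (∑-+ S _ _) (+-congˡ (trans (∑-*ˡ S _ _) (*-congˡ (trans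
                 (∑-cong S λ _ → sym (-‿distribʳ-* _ _)) (∑-neg S _))))) ⟩
          _ + - ρ * - W (+ suc a)
            ≈⟨ +-congˡ (sym (-‿distribˡ-* ρ _)) ⟩
          _ - ρ * - W (+ suc a) ∎

        W-root : ∀ {a} → a ∈ S → suc a ∉ S → W (+ suc a) ≈ 1#
        W-root a∈S suca∉S = trans (W-value (∉-avoids suca∉S)) (trans (+-congˡ (-‿cong (h-taken a∈S)))
          (solve 0 (:1 :- :0 := :1) refl))

        -- With y = a + 1, splitting 1/((z - p)(p - y)) turns the sum over p into values of `W` at z
        -- and at y. Since y is a zero of `h`, `W` is 1 there and everything cancels.
        bracket-zero : ∀ {a} → a ∈ S → suc a ∉ S → suc a ≢ z → bracket a ≈ 0#
        bracket-zero {a} a∈S y∉S y≢z = begin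
          ρ - (∑ S λ p → weight p * (p ⊘ suc a)) - h S (+ z) * R
            ≈⟨ +-congʳ (+-congˡ (-‿cong (trans (inner-sum a) (+-cong products
                 (-‿cong (*-congˡ (-‿cong (W-root a∈S y∉S)))))))) ⟩
          ρ - (R * (W (+ z) - W (+ suc a)) - ρ * - 1#) - h S (+ z) * R
            ≈⟨ +-congʳ (+-congˡ (-‿cong (+-congʳ (*-congˡ (+-cong (W-value (∉-avoids z∉S))
                 (-‿cong (W-root a∈S y∉S))))))) ⟩
          ρ - (R * (1# - h S (+ z) - 1#) - ρ * - 1#) - h S (+ z) * R
            ≈⟨ solve 3 (λ ρ R h → ρ :- (R :* (:1 :- h :- :1) :- ρ :* :- :1) :- h :* R := :0)
                 refl ρ R (h S (+ z)) ⟩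
          0# ∎
          where
          R = (z ⊘ suc a)
          products : (∑ S λ p → h S (+ p) * ((z ⊘ p) * (p ⊘ suc a))) ≈ R * (W (+ z) - W (+ suc a))
          products = begin
            (∑ S λ p → h S (+ p) * ((z ⊘ p) * (p ⊘ suc a)))
              ≈⟨ ∑-cong S (λ {p} p∈S → trans (*-congˡ (trans
                   (r-split (+-≢ λ z≡p → z∉S (≡.subst (_∈ S) (≡.sym z≡p) p∈S))
                     (+-≢ λ p≡y → y∉S (≡.subst (_∈ S) p≡y p∈S)) (+-≢ λ z≡y → y≢z (≡.sym z≡y)))
                   (*-congˡ (+-congˡ (r-flip (+ p) (+ suc a))))))
                   (solve 4 (λ h R x y → h :* (R :* (x :+ :- y)) := R :* (h :* x :+ :- (h :* y))) refl _ _ _ _)) ⟩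
            (∑ S λ p → R * (h S (+ p) * (z ⊘ p) + - (h S (+ p) * (suc a ⊘ p))))
              ≈⟨ trans (∑-*ˡ S _ _) (*-congˡ (trans (∑-+ S _ _) (+-congˡ (∑-neg S _)))) ⟩
            R * (W (+ z) - W (+ suc a)) ∎

        -- The confluent case: for z = a + 1 the kernel becomes -1/(z - p)², the sum over p is up to
        -- sign the derivative of `h` at its zero z, and the product of that derivative with the
        -- residue g(a) is 1.
        bracket-one : ∀ {a} → a ∈ S → suc a ≡ z → g S (+ a) * bracket a ≈ 1#
        bracket-one {a} a∈S ≡.refl = begin
          g S (+ a) * bracket a
            ≈⟨ *-congˡ (+-cong (+-congˡ (-‿cong (trans (inner-sum a) (+-cong products
                 (-‿cong (*-congˡ (-‿cong (W-root a∈S z∉S)))))))) (-‿cong (*-congʳ (h-taken a∈S)))) ⟩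
          g S (+ a) * (ρ - (- Q - ρ * - 1#) - 0# * (z ⊘ suc a))
            ≈⟨ solve 4 (λ g ρ Q x → g :* (ρ :- (:- Q :- ρ :* :- :1) :- :0 :* x) := g :* Q) refl _ ρ Q _ ⟩
          g S (+ a) * Q
            ≈⟨ *-cong (G-cong (sym (-‿involutive 1#)) S (+ a)) (reflexive (≡.cong (S⁻.double-sum S) (≡.sym (above a)))) ⟩
          G (- - 1#) S (+ a) * S⁻.double-sum S (+ a ℤ.- -1ℤ)
            ≈⟨ S⁻.residue-of-inverse S! a∈S (≡.subst (λ w → Avoids w S) (≡.sym (above a)) (∉-avoids z∉S)) ⟩
          1# ∎
          where
          Q = S⁻.double-sum S (+ suc a)
          products : (∑ S λ p → h S (+ p) * ((suc a ⊘ p) * (p ⊘ suc a))) ≈ - Q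
          products = trans (∑-cong S λ {p} _ → trans (*-congˡ (*-congˡ (r-flip (+ p) (+ suc a))))
            (solve 2 (λ h x → h :* (x :* :- x) := :- (h :* (x :* x))) refl _ _)) (∑-neg S _)

        -- If z lies directly below a row a₀ of `S`, then χ z comes from the term a₀, and h(z) = 0
        -- removes the isolated term. Otherwise the whole sum vanishes and χ z comes from the
        -- isolated term, because h(z) g(z - 1) = 1.
        total : Predecessor z → (∑ S λ a → g S (+ a) * bracket a * χ (suc a)) + h S (+ z) * (g S (+ z ℤ.- 1ℤ) * χ z) ≈ χ z
        total pre = go pre {≡.refl}
          where
          off : ∀ {a} → a ∈ S → suc a ≢ z → g S (+ a) * bracket a * χ (suc a) ≈ 0#
          off {a} a∈S y≢z with suc a ∈? S
          ... | yes y∈S = trans (*-congʳ (trans (*-congʳ (g-taken y∈S)) (zeroˡ _))) (zeroˡ _)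
          ... | no  y∉S = trans (*-congʳ (trans (*-congˡ (bracket-zero a∈S y∉S y≢z)) (zeroʳ _))) (zeroˡ _)
          go : ∀ {w} → Predecessor w → {w≡z : w ≡ z} →
               (∑ S λ a → g S (+ a) * bracket a * χ (suc a)) + h S (+ z) * (g S (+ z ℤ.- 1ℤ) * χ z) ≈ χ z
          go (present {a₀} a₀∈S) {≡.refl} = trans (+-cong
            (trans (∑-single S! a₀∈S _ λ a∈S a≢a₀ → off a∈S λ eq → a≢a₀ (ℕ.suc-injective eq))
              (trans (*-congʳ (bracket-one a₀∈S ≡.refl)) (*-identityˡ _)))
            (trans (*-congʳ (h-taken a₀∈S)) (zeroˡ _))) (+-identityʳ _)
          go (absent z-1∉S) {≡.refl} = trans (+-cong
            (∑-zero S λ {a} a∈S → off a∈S λ y≡z → all-∈ z-1∉S a∈S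
              (≡.trans (≡.cong (λ x → + x ℤ.- 1ℤ) (≡.sym y≡z)) (below a)))
            (trans (sym (*-assoc _ _ _)) (trans (*-congʳ (g*h z∉S z-1∉S)) (*-identityˡ _)))) (+-identityˡ _)

      -- The inverse of the Cauchy matrix with entries 1/(p-y), completed by a row of ones.
      decomposition : ρ * (∑ S λ a → g S (+ a) * χ (suc a))
                      - (∑ S λ p → h S (+ p) * ((z ⊘ p) - ρ) * shifted p) - h S (+ z) * shifted z ≈ χ z
      decomposition = begin
        ρ * (∑ S λ a → g S (+ a) * χ (suc a)) - (∑ S λ p → weight p * shifted p) - h S (+ z) * shifted z
          ≈⟨ +-cong (+-cong (sym (∑-*ˡ S ρ _)) (-‿cong (∑-cong S λ {p} p∈S → shifted-root p p∈S)))
               (-‿cong (trans (solve 3 (λ h A B → h :* (A :- B) := h :* A :+ :- (h :* B)) refl _ _ _)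
                 (+-congʳ (trans (sym (∑-*ˡ S _ _)) (∑-cong S λ {a} _ → trans (*-congˡ (*-congˡ (*-congʳ (shift-r z a))))
                   (solve 4 (λ h g R x → h :* (g :* (R :* x)) := g :* (h :* R) :* x) refl _ _ _ _)))))) ⟩
        (∑ S λ a → ρ * (g S (+ a) * χ (suc a)))
          - (∑ S λ p → ∑ S λ a → g S (+ a) * (weight p * (p ⊘ suc a)) * χ (suc a))
          - ((∑ S λ a → g S (+ a) * (h S (+ z) * (z ⊘ suc a)) * χ (suc a)) + - (h S (+ z) * (g S (+ z ℤ.- 1ℤ) * χ z)))
          -- Exchanging the sums over p and a collects everything that multiplies χ(a + 1).
          ≈⟨ +-congʳ (+-congˡ (-‿cong (trans (∑-swap S S _) (∑-cong S λ {a} _ →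
               trans (∑-*ʳ S (χ (suc a)) _) (*-congʳ (∑-*ˡ S (g S (+ a)) _)))))) ⟩
        (∑ S λ a → ρ * (g S (+ a) * χ (suc a)))
          - (∑ S λ a → g S (+ a) * (∑ S λ p → weight p * (p ⊘ suc a)) * χ (suc a))
          - ((∑ S λ a → g S (+ a) * (h S (+ z) * (z ⊘ suc a)) * χ (suc a)) + - (h S (+ z) * (g S (+ z ℤ.- 1ℤ) * χ z)))
          ≈⟨ solve 4 (λ A B C D → A :- B :- (C :+ :- D) := (A :+ (:- B :+ :- C)) :+ D) refl _ _ _ _ ⟩
        ((∑ S λ a → ρ * (g S (+ a) * χ (suc a)))
          + (- (∑ S λ a → g S (+ a) * (∑ S λ p → weight p * (p ⊘ suc a)) * χ (suc a))
          + - (∑ S λ a → g S (+ a) * (h S (+ z) * (z ⊘ suc a)) * χ (suc a)))) + h S (+ z) * (g S (+ z ℤ.- 1ℤ) * χ z)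
          ≈⟨ +-congʳ (trans (+-congˡ (trans (+-cong (sym (∑-neg S _)) (sym (∑-neg S _))) (sym (∑-+ S _ _))))
               (trans (sym (∑-+ S _ _)) (∑-cong S λ {a} _ →
                 solve 5 (λ ρ g x s t → ρ :* (g :* x) :+ (:- (g :* s :* x) :+ :- (g :* t :* x))
                   := g :* (ρ :- s :- t) :* x) refl ρ (g S (+ a)) (χ (suc a)) _ _))) ⟩
        (∑ S λ a → g S (+ a) * bracket a * χ (suc a)) + h S (+ z) * (g S (+ z ℤ.- 1ℤ) * χ z)
          ≈⟨ total (predecessor z) ⟩
        χ z ∎
        where
        shifted-root : ∀ p → p ∈ S → weight p * shifted p
                       ≈ ∑ S λ a → g S (+ a) * (weight p * (p ⊘ suc a)) * χ (suc a)
        shifted-root p p∈S = trans (*-congˡ (trans (+-congˡ (trans (-‿cong (trans (*-congʳ (S⁺.G-shift p∈S)) (zeroˡ _)))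
            -0#≈0#)) (+-identityʳ _)))
          (trans (sym (∑-*ˡ S _ _)) (∑-cong S λ {a} _ → trans (*-congˡ (*-congˡ (*-congʳ (shift-r p a))))
            (solve 4 (λ w g R x → w :* (g :* (R :* x)) := g :* (w :* R) :* x) refl _ _ _ _)))

    module _ (0∈S : 0 ∈ S) (X : Carrier) (Y : ℕ → Carrier) where

      -- The other half of the inversion. By `decomposition` the values at the tuples (σ, y) are
      -- determined by their data X on M b_σ and Y q on the normalized Θ b_{q-1,σ}. This is the same
      -- formula, with ρ = 1/y, applied to arbitrary data; `sum-of-values` and
      -- `weighted-sum-of-values` show that its values return the data.
      interpolant : ℕ → Carrier
      interpolant y = r (+ y) * X - (∑ S λ p → h S (+ p) * ((y ⊘ p) - r (+ y)) * Y p) - h S (+ y) * Y y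

      private
        flipped-sum : ∀ p → (∑ S λ a → g S (+ a) * (suc a ⊘ p)) ≈ - V (+ p ℤ.- 1ℤ)
        flipped-sum p = trans (∑-cong S λ {a} _ → trans (*-congˡ (trans
            (r-cong (solveℤ 2 (λ a p → (con′ 1ℤ ⊹ a) ⊖ p :≡ a ⊖ (p ⊖ con′ 1ℤ)) ≡.refl (+ a) (+ p)))
            (r-flip (+ a) (+ p ℤ.- 1ℤ)))) (sym (-‿distribʳ-* _ _))) (∑-neg S _)

        -- Here p - 1 is a zero of G, so the sum over the poles is -1 there. The instance p = 0 is
        -- `at-zero`, which is what `0 ∈ S` provides.
        at-root : ∀ {p} → p ∈ S → Avoids (+ p ℤ.- 1ℤ) S → (∑ S λ a → g S (+ a) * (suc a ⊘ p)) ≈ 1#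
        at-root {p} p∈S p-1∉S = trans (flipped-sum p) (trans
          (-‿cong (V-root p-1∉S (S⁺.G-shift p∈S))) (-‿involutive 1#))

        r-suc : ∀ a → (suc a ⊘ 0) ≈ r (+ suc a)
        r-suc a = r-cong (ℤ.+-identityʳ (+ suc a))

        at-zero : (∑ S λ a → g S (+ a) * r (+ suc a)) ≈ 1#
        at-zero = trans (∑-cong S λ {a} _ → *-congˡ (sym (r-suc a))) (at-root 0∈S negative-avoids)

        -- The weight w is 1 for the equation of M and 1/(s - a) for that of Θ. The isolated term of
        -- `interpolant` drops out because `h` vanishes at a + 1.
        collect : (w : ℕ → Carrier) → (∑ S λ a → w a * g S (+ a) * interpolant (suc a)) ≈
                  (∑ S λ a → w a * g S (+ a) * r (+ suc a)) * X
                  - (∑ S λ p → h S (+ p) * (∑ S λ a → w a * g S (+ a) * ((suc a ⊘ p) - r (+ suc a))) * Y p)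
        collect w = begin
          (∑ S λ a → w a * g S (+ a) * interpolant (suc a))
            ≈⟨ ∑-cong S (λ {a} a∈S → trans (*-congˡ (trans (+-congˡ (trans (-‿cong (trans
                 (*-congʳ (h-taken a∈S)) (zeroˡ _))) -0#≈0#)) (+-identityʳ _)))
                 (trans (solve 4 (λ w r X T → w :* (r :* X :- T) := w :* r :* X :+ :- (w :* T)) refl _ _ _ _)
                 (+-congˡ (-‿cong (trans (sym (∑-*ˡ S _ _)) (∑-cong S λ _ →
                   solve 4 (λ w h x Y → w :* (h :* x :* Y) := h :* (w :* x) :* Y) refl _ _ _ _)))))) ⟩
          (∑ S λ a → w a * g S (+ a) * r (+ suc a) * X
            + - (∑ S λ p → h S (+ p) * (w a * g S (+ a) * ((suc a ⊘ p) - r (+ suc a))) * Y p))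
            ≈⟨ trans (∑-+ S _ _) (+-cong (∑-*ʳ S X _) (trans (∑-neg S _) (-‿cong (trans (∑-swap S S _)
                 (∑-cong S λ {p} _ → trans (∑-*ʳ S (Y p) _) (*-congʳ (∑-*ˡ S (h S (+ p)) _))))))) ⟩
          _ ∎

      sum-of-values : (∑ S λ a → g S (+ a) * interpolant (suc a)) ≈ X
      sum-of-values = begin
        (∑ S λ a → g S (+ a) * interpolant (suc a))
          ≈⟨ ∑-cong S (λ _ → *-congʳ (sym (*-identityˡ _))) ⟩
        (∑ S λ a → 1# * g S (+ a) * interpolant (suc a))
          ≈⟨ collect (λ _ → 1#) ⟩
        (∑ S λ a → 1# * g S (+ a) * r (+ suc a)) * X
          - (∑ S λ p → h S (+ p) * (∑ S λ a → 1# * g S (+ a) * ((suc a ⊘ p) - r (+ suc a))) * Y p)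
          ≈⟨ +-cong (trans (*-congʳ (trans (∑-cong S λ _ → *-congʳ (*-identityˡ _)) at-zero)) (*-identityˡ X))
               (trans (-‿cong (∑-zero S λ {p} p∈S → trans (*-congʳ (vanishes p p∈S (predecessor p))) (zeroˡ _))) -0#≈0#) ⟩
        X + 0#
          ≈⟨ +-identityʳ X ⟩
        X ∎
        where
        vanishes : ∀ p → p ∈ S → Predecessor p →
                   h S (+ p) * (∑ S λ a → 1# * g S (+ a) * ((suc a ⊘ p) - r (+ suc a))) ≈ 0#
        vanishes _ p∈S (present a∈S)  = trans (*-congʳ (h-taken a∈S)) (zeroˡ _)
        -- The two sums in question, with kernels 1/(a + 1 - p) and 1/(a + 1), are both 1 and
        -- cancel.
        vanishes p p∈S (absent p-1∉S) = trans (*-congˡ (trans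
          (∑-cong S λ _ → solve 3 (λ g x y → :1 :* g :* (x :- y) := g :* x :+ :- (g :* y)) refl _ _ _)
          (trans (∑-+ S _ _) (trans (+-cong (at-root p∈S p-1∉S) (trans (∑-neg S _) (-‿cong at-zero)))
            (-‿inverseʳ 1#))))) (zeroʳ _)

      weighted-sum-of-values : ∀ {s} → s ∉ S →
        (∑ S λ a → g S (+ a) * (s ⊘ a) * interpolant (suc a)) - g S (+ s) * interpolant (suc s) ≈ Y (suc s)
      weighted-sum-of-values {s} s∉S = begin
        (∑ S λ a → g S (+ a) * (s ⊘ a) * interpolant (suc a)) - g S (+ s) * interpolant q
          ≈⟨ +-cong (trans (∑-cong S λ _ → *-congʳ (*-comm _ _)) (collect (λ a → (s ⊘ a))))
               (-‿cong (trans (solve 6 (λ g r X T h Y → g :* (r :* X :- T :- h :* Y)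
                  := g :* r :* X :+ :- (g :* T) :+ :- (g :* (h :* Y))) refl _ _ _ _ _ _)
                 (+-congʳ (+-congˡ (-‿cong (trans (sym (∑-*ˡ S _ _)) (∑-cong S λ _ →
                   solve 4 (λ g h x Y → g :* (h :* x :* Y) := h :* (g :* x) :* Y) refl _ _ _ _))))))) ⟩
        A * X - (∑ S λ p → h S (+ p) * B p * Y p)
          - (g S (+ s) * r (+ q) * X + - (∑ S λ p → h S (+ p) * (g S (+ s) * C p) * Y p) + - (g S (+ s) * (h S (+ q) * Y q)))
          ≈⟨ solve 6 (λ A X B c D E → A :* X :- B :- (c :* X :+ :- D :+ :- E)
               := (A :- c) :* X :+ (D :+ :- B) :+ E) refl _ X _ _ _ _ ⟩
        (A - g S (+ s) * r (+ q)) * X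
          + ((∑ S λ p → h S (+ p) * (g S (+ s) * C p) * Y p) + - (∑ S λ p → h S (+ p) * B p * Y p))
          + g S (+ s) * (h S (+ q) * Y q)
          ≈⟨ +-congʳ (+-cong (trans (*-congʳ (trans (+-congʳ A-value) (-‿inverseʳ _))) (zeroˡ X))
               (trans (+-congˡ (sym (∑-neg S _))) (trans (sym (∑-+ S _ _)) (∑-cong S λ _ →
                 solve 4 (λ h c b Y → h :* c :* Y :+ :- (h :* b :* Y) := h :* (c :- b) :* Y) refl _ _ _ _)))) ⟩
        0# + (∑ S λ p → h S (+ p) * (g S (+ s) * C p - B p) * Y p) + g S (+ s) * (h S (+ q) * Y q)
          ≈⟨ +-congʳ (+-identityˡ _) ⟩
        (∑ S λ p → h S (+ p) * (g S (+ s) * C p - B p) * Y p) + g S (+ s) * (h S (+ q) * Y q)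
          ≈⟨ finish (q ∈? S) ⟩
        Y q ∎
        where
        q = suc s
        A = ∑ S λ a → (s ⊘ a) * g S (+ a) * r (+ suc a)
        B C : ℕ → Carrier
        B p = ∑ S λ a → (s ⊘ a) * g S (+ a) * ((suc a ⊘ p) - r (+ suc a))
        C p = (q ⊘ p) - r (+ q)
        s∉ = ∉-avoids s∉S
        V-s : V (+ s) + 1# ≈ g S (+ s)
        V-s = trans (+-comm _ _) (sym (g-expand s∉))

        s≢ : ∀ {a} → a ∈ S → + s ≢ + a
        s≢ a∈S = all-∈ s∉ a∈S

        -- Splitting 1/((s - a)(a + 1 - p)) yields V(s) = G(s) - 1 and the sum that is assumed to be
        -- 1, together G(s). A term with a + 1 = p cannot be split, but there the residue g(a) is
        -- zero.
        product-sum : ∀ p → + q ℤ.- + p ≢ 0ℤ → (∑ S λ a → g S (+ a) * (suc a ⊘ p)) ≈ 1# →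
                      (∀ {a} → a ∈ S → + suc a ≡ + p → g S (+ a) ≈ 0#) →
                      (∑ S λ a → (s ⊘ a) * g S (+ a) * (suc a ⊘ p)) ≈ g S (+ s) * (q ⊘ p)
        product-sum p q≢p one zeros = begin
          (∑ S λ a → (s ⊘ a) * g S (+ a) * (suc a ⊘ p))
            ≈⟨ ∑-cong S term ⟩
          (∑ S λ a → R * (g S (+ a) * (s ⊘ a) + g S (+ a) * (suc a ⊘ p)))
            ≈⟨ trans (∑-*ˡ S R _) (*-congˡ (∑-+ S _ _)) ⟩
          R * (V (+ s) + (∑ S λ a → g S (+ a) * (suc a ⊘ p)))
            ≈⟨ trans (*-congˡ (trans (+-congˡ one) V-s)) (*-comm _ _) ⟩
          g S (+ s) * R ∎
          where
          R = (q ⊘ p)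
          term : ∀ {a} → a ∈ S → (s ⊘ a) * g S (+ a) * (suc a ⊘ p)
                 ≈ R * (g S (+ a) * (s ⊘ a) + g S (+ a) * (suc a ⊘ p))
          term {a} a∈S with + suc a ℤ.≟ + p
          ... | yes eq = trans (*-congʳ (*-congˡ (zeros a∈S eq))) (trans
            (solve 3 (λ x y R → x :* :0 :* y := R :* (:0 :* x :+ :0 :* y)) refl _ _ R)
            (*-congˡ (sym (+-cong (*-congʳ (zeros a∈S eq)) (*-congʳ (zeros a∈S eq))))))
          ... | no suca≢p = trans (solve 3 (λ x g y → x :* g :* y := g :* (x :* y)) refl _ _ _)
            (trans (*-congˡ split) (solve 4 (λ g R x y → g :* (R :* (x :+ y)) := R :* (g :* x :+ g :* y)) refl _ R _ _))
            where
            split : (s ⊘ a) * (suc a ⊘ p) ≈ R * ((s ⊘ a) + (suc a ⊘ p))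
            split = trans (r-* (λ z → s≢ a∈S (ℤ.i-j≡0⇒i≡j _ _ z)) (λ z → suca≢p (ℤ.i-j≡0⇒i≡j _ _ z))
              (λ z → q≢p (≡.trans (≡.sym telescope) z))) (*-congʳ (r-cong telescope))
              where
              telescope : (+ s ℤ.- + a) ℤ.+ (+ suc a ℤ.- + p) ≡ + q ℤ.- + p
              telescope = solveℤ 3 (λ s a p → (s ⊖ a) ⊹ ((con′ 1ℤ ⊹ a) ⊖ p) :≡ (con′ 1ℤ ⊹ s) ⊖ p)
                ≡.refl (+ s) (+ a) (+ p)

        A-value : A ≈ g S (+ s) * r (+ q)
        A-value = trans (∑-cong S λ {a} _ → *-congˡ (sym (r-suc a)))
          (trans (product-sum 0 (λ ()) (at-root 0∈S negative-avoids) (λ _ ())) (*-congˡ (r-suc s)))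

        B-split : ∀ p → B p ≈ (∑ S λ a → (s ⊘ a) * g S (+ a) * (suc a ⊘ p)) - g S (+ s) * r (+ q)
        B-split p = trans (∑-cong S λ _ → solve 4 (λ x g y z → x :* g :* (y :- z) := x :* g :* y :+ :- (x :* g :* z))
            refl _ _ _ _)
          (trans (∑-+ S _ _) (+-congˡ (trans (∑-neg S _) (-‿cong A-value))))

        off : ∀ {p} → p ∈ S → p ≢ q → h S (+ p) * (g S (+ s) * C p - B p) * Y p ≈ 0#
        off {p} p∈S p≢q = trans (*-congʳ (go (predecessor p) p∈S p≢q)) (zeroˡ _)
          where
          go : ∀ {p} → Predecessor p → p ∈ S → p ≢ q → h S (+ p) * (g S (+ s) * C p - B p) ≈ 0#
          go     (present a∈S)  _   _   = trans (*-congʳ (h-taken a∈S)) (zeroˡ _)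
          go {p} (absent p-1∉S) p∈S p≢q = trans (*-congˡ (trans (+-congˡ (-‿cong (trans (B-split p)
            (+-congʳ (product-sum p (λ z → p≢q (≡.sym (ℤ.+-injective (ℤ.i-j≡0⇒i≡j _ _ z)))) (at-root p∈S p-1∉S)
              λ {a} a∈S eq → g-taken (≡.subst (_∈ S) (≡.sym (ℤ.+-injective eq)) p∈S))))))
            (solve 3 (λ g x y → g :* (x :- y) :- (g :* x :- g :* y) := :0) refl _ _ _))) (zeroʳ _)

        -- If q is not in `S`, Y q comes from the isolated term, as g(s) h(q) = 1. If q is in `S`,
        -- then g(s) = 0, and Y q comes from the term p = q, whose coefficient is a residue of 1/G
        -- times a derivative of G.
        finish : Dec (q ∈ S) → (∑ S λ p → h S (+ p) * (g S (+ s) * C p - B p) * Y p) + g S (+ s) * (h S (+ q) * Y q) ≈ Y q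
        finish (no q∉S)  = trans (+-cong (∑-zero S λ p∈S → off p∈S λ p≡q → q∉S (≡.subst (_∈ S) p≡q p∈S))
          (trans (solve 3 (λ g h Y → g :* (h :* Y) := h :* g :* Y) refl _ _ _) (trans (*-congʳ
            (trans (*-congˡ (reflexive (≡.cong (g S) (≡.sym (below s))))) (g*h q∉S
              (≡.subst (λ w → Avoids w S) (≡.sym (below s)) s∉)))) (*-identityˡ _)))) (+-identityˡ _)
        finish (yes q∈S) = trans (+-cong
          (trans (∑-single S! q∈S _ off) (trans (*-congʳ diagonal) (*-identityˡ _)))
          (trans (*-congʳ (g-taken q∈S)) (zeroˡ _))) (+-identityʳ _)
          where
          squares : (∑ S λ a → (s ⊘ a) * g S (+ a) * (suc a ⊘ q)) ≈ - S⁺.double-sum S (+ s)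
          squares = trans (∑-cong S λ {a} _ → trans (*-congˡ (trans
              (r-cong (solveℤ 2 (λ a s → (con′ 1ℤ ⊹ a) ⊖ (con′ 1ℤ ⊹ s) :≡ a ⊖ s) ≡.refl (+ a) (+ s)))
              (r-flip (+ a) (+ s))))
            (solve 2 (λ x g → x :* g :* :- x := :- (g :* (x :* x))) refl _ _)) (∑-neg S _)
          diagonal : h S (+ q) * (g S (+ s) * C q - B q) ≈ 1#
          diagonal = begin
            h S (+ q) * (g S (+ s) * C q - B q)
              ≈⟨ *-congˡ (+-cong (trans (*-congʳ (g-taken q∈S)) (zeroˡ _)) (-‿cong (trans (B-split q)
                   (+-cong squares (-‿cong (trans (*-congʳ (g-taken q∈S)) (zeroˡ _))))))) ⟩
            h S (+ q) * (0# - (- S⁺.double-sum S (+ s) - 0#))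
              ≈⟨ *-congˡ (solve 1 (λ D → :0 :- (:- D :- :0) := D) refl _) ⟩
            h S (+ q) * S⁺.double-sum S (+ s)
              ≈⟨ *-congˡ (reflexive (≡.cong (S⁺.double-sum S) (≡.sym (below s)))) ⟩
            h S (+ q) * S⁺.double-sum S (+ q ℤ.- 1ℤ)
              ≈⟨ S⁺.residue-of-inverse S! q∈S (≡.subst (λ w → Avoids w S) (≡.sym (below s)) s∉) ⟩
            1# ∎

-- Rational scalars

ratio : ℤ → ℚ
ratio n = n ℚ./ 1

-- Unnormalised fractions involve no reduction by a greatest common divisor, so the laws for `ratio`
-- become integer identities there.
ratio-toℚᵘ : ∀ n → ℚ.toℚᵘ (ratio n) ℚᵘ.≃ ℚᵘ.mkℚᵘ n 0
ratio-toℚᵘ n = ℚ.toℚᵘ-fromℚᵘ (ℚᵘ.mkℚᵘ n 0)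

ratio-+ : ∀ m n → ratio (m ℤ.+ n) ≡ ratio m ℚ.+ ratio n
ratio-+ m n = ℚ.toℚᵘ-injective (begin
  ℚ.toℚᵘ (ratio (m ℤ.+ n))                  ≈⟨ ratio-toℚᵘ (m ℤ.+ n) ⟩
  ℚᵘ.mkℚᵘ (m ℤ.+ n) 0                       ≈⟨ ℚᵘ.*≡* (solve 2 (λ m n → (m :+ n) :* con (+ 1)
                                                 := (m :* con (+ 1) :+ n :* con (+ 1)) :* con (+ 1)) ≡.refl m n) ⟩
  ℚᵘ.mkℚᵘ m 0 ℚᵘ.+ ℚᵘ.mkℚᵘ n 0              ≈⟨ ℚᵘ.+-cong (ratio-toℚᵘ m) (ratio-toℚᵘ n) ⟨
  ℚ.toℚᵘ (ratio m) ℚᵘ.+ ℚ.toℚᵘ (ratio n)    ≈⟨ ℚ.toℚᵘ-homo-+ (ratio m) (ratio n) ⟨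
  ℚ.toℚᵘ (ratio m ℚ.+ ratio n)              ∎)
  where
  open SetoidReasoning ℚᵘ.≃-setoid
  open ℤSolver.+-*-Solver

ratio-* : ∀ m n → ratio (m ℤ.* n) ≡ ratio m ℚ.* ratio n
ratio-* m n = ℚ.toℚᵘ-injective (begin
  ℚ.toℚᵘ (ratio (m ℤ.* n))                  ≈⟨ ratio-toℚᵘ (m ℤ.* n) ⟩
  ℚᵘ.mkℚᵘ m 0 ℚᵘ.* ℚᵘ.mkℚᵘ n 0              ≈⟨ ℚᵘ.*-cong (ratio-toℚᵘ m) (ratio-toℚᵘ n) ⟨
  ℚ.toℚᵘ (ratio m) ℚᵘ.* ℚ.toℚᵘ (ratio n)    ≈⟨ ℚ.toℚᵘ-homo-* (ratio m) (ratio n) ⟨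
  ℚ.toℚᵘ (ratio m ℚ.* ratio n)              ∎)
  where open SetoidReasoning ℚᵘ.≃-setoid

ratio-- : ∀ n → ratio (ℤ.- n) ≡ ℚ.- ratio n
ratio-- n = ℚ.toℚᵘ-injective (begin
  ℚ.toℚᵘ (ratio (ℤ.- n))    ≈⟨ ratio-toℚᵘ (ℤ.- n) ⟩
  ℚᵘ.- ℚᵘ.mkℚᵘ n 0          ≈⟨ ℚᵘ.-‿cong (ratio-toℚᵘ n) ⟨
  ℚᵘ.- ℚ.toℚᵘ (ratio n)     ≈⟨ ℚ.toℚᵘ-homo‿- (ratio n) ⟨
  ℚ.toℚᵘ (ℚ.- ratio n)      ∎)
  where open SetoidReasoning ℚᵘ.≃-setoid

ratio-nonZero : ∀ {n} → n ≢ 0ℤ → ℚ.NonZero (ratio n)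
ratio-nonZero {n} n≢0 = ℚ.≢-nonZero λ eq → n≢0 (numerator (ℚᵘ.≃-trans
  (ℚᵘ.≃-sym (ratio-toℚᵘ n)) (ℚᵘ.≃-reflexive (≡.cong ℚ.toℚᵘ eq))))
  where
  numerator : ∀ {n} → ℚᵘ.mkℚᵘ n 0 ℚᵘ.≃ ℚ.toℚᵘ 0ℚ → n ≡ 0ℤ
  numerator {n} (ℚᵘ.*≡* eq) = ≡.trans (≡.sym (ℤ.*-identityʳ n)) eq

record RationalAlgebra (K : CommutativeRing 0ℓ 0ℓ) (fromℚ : ℚ → CommutativeRing.Carrier K) : Set where
  open CommutativeRing K
  field
    fromℚ-+ : ∀ p q → fromℚ (p ℚ.+ q) ≈ fromℚ p + fromℚ q
    fromℚ-* : ∀ p q → fromℚ (p ℚ.* q) ≈ fromℚ p * fromℚ q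
    fromℚ-- : ∀ q → fromℚ (ℚ.- q) ≈ - fromℚ q
    fromℚ-0 : fromℚ 0ℚ ≈ 0#
    fromℚ-1 : fromℚ 1ℚ ≈ 1#

module RationalInverses {K : CommutativeRing 0ℓ 0ℓ} {fromℚ : ℚ → CommutativeRing.Carrier K}
                        (algebra : RationalAlgebra K fromℚ) where

  open CommutativeRing K
  open RationalAlgebra algebra

  inverse : ∀ n → Dec (n ≡ 0ℤ) → ℚ
  inverse n (yes _)   = 0ℚ
  inverse n (no n≢0)  = ℚ.1/_ (ratio n) {{ratio-nonZero n≢0}}

  integerInverses : IntegerInverses K
  integerInverses = record
    { num   = λ n → fromℚ (ratio n)
    ; num-+ = λ m n → trans (reflexive (≡.cong fromℚ (ratio-+ m n))) (fromℚ-+ _ _)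
    ; num-* = λ m n → trans (reflexive (≡.cong fromℚ (ratio-* m n))) (fromℚ-* _ _)
    ; num-- = λ n → trans (reflexive (≡.cong fromℚ (ratio-- n))) (fromℚ-- _)
    ; num-0 = fromℚ-0
    ; num-1 = fromℚ-1
    ; r     = λ n → fromℚ (inverse n (n ℤ.≟ 0ℤ))
    ; num*r = λ {n} n≢0 → num*inverse n≢0 (n ℤ.≟ 0ℤ)
    ; r-0   = fromℚ-0
    }
    where
    num*inverse : ∀ {n} → n ≢ 0ℤ → (d : Dec (n ≡ 0ℤ)) → fromℚ (ratio n) * fromℚ (inverse n d) ≈ 1#
    num*inverse     n≢0 (yes n≡0) = ⊥-elim (n≢0 n≡0)
    num*inverse {n} _   (no n≢0)  = trans (sym (fromℚ-* _ _)) (trans (reflexive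
      (≡.cong fromℚ (ℚ.*-inverseʳ (ratio n) {{ratio-nonZero n≢0}}))) fromℚ-1)

-- Linear maps and intertwiners

record IsLinear {K : CommutativeRing 0ℓ 0ℓ} (A B : Module K 0ℓ 0ℓ)
  (T : Module.Carrierᴹ A → Module.Carrierᴹ B) : Set where
  private
    module A = Module A
    module B = Module B
  field
    cong  : ∀ {v w} → v A.≈ᴹ w → T v B.≈ᴹ T w
    +-hom : ∀ v w → T (v A.+ᴹ w) B.≈ᴹ T v B.+ᴹ T w
    0-hom : T A.0ᴹ B.≈ᴹ B.0ᴹ
    *-hom : ∀ a v → T (a A.*ₗ v) B.≈ᴹ a B.*ₗ T v

module Linear (K : CommutativeRing 0ℓ 0ℓ) where

  open CommutativeRing K hiding (zero)

  ∘-linear : ∀ {A B C : Module K 0ℓ 0ℓ} {S T} → IsLinear B C S → IsLinear A B T → IsLinear A C (λ v → S (T v))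
  ∘-linear {C = C} S-linear T-linear = record
    { cong  = λ e → S.cong (T.cong e)
    ; +-hom = λ v w → ≈ᴹ-trans (S.cong (T.+-hom v w)) (S.+-hom _ _)
    ; 0-hom = ≈ᴹ-trans (S.cong T.0-hom) S.0-hom
    ; *-hom = λ a v → ≈ᴹ-trans (S.cong (T.*-hom a v)) (S.*-hom a _)
    }
    where
    module S = IsLinear S-linear
    module T = IsLinear T-linear
    open Module C

  +-linear : ∀ {A B : Module K 0ℓ 0ℓ} {S T} → IsLinear A B S → IsLinear A B T →
             IsLinear A B (λ v → Module._+ᴹ_ B (S v) (T v))
  +-linear {B = B} S-linear T-linear = record
    { cong  = λ e → +ᴹ-cong (S.cong e) (T.cong e)
    ; +-hom = λ v w → ≈ᴹ-trans (+ᴹ-cong (S.+-hom v w) (T.+-hom v w)) (interchange _ _ _ _)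
    ; 0-hom = ≈ᴹ-trans (+ᴹ-cong S.0-hom T.0-hom) (+ᴹ-identityˡ 0ᴹ)
    ; *-hom = λ a v → ≈ᴹ-trans (+ᴹ-cong (S.*-hom a v) (T.*-hom a v)) (≈ᴹ-sym (*ₗ-distribˡ a _ _))
    }
    where
    module S = IsLinear S-linear
    module T = IsLinear T-linear
    open Module B
    open SemigroupProperties (CommutativeMonoid.commutativeSemigroup +ᴹ-commutativeMonoid) using (interchange)

  *-linear : ∀ {A B : Module K 0ℓ 0ℓ} {T} a → IsLinear A B T → IsLinear A B (λ v → Module._*ₗ_ B a (T v))
  *-linear {B = B} {T} a T-linear = record
    { cong  = λ e → *ₗ-cong refl (T.cong e)
    ; +-hom = λ v w → ≈ᴹ-trans (*ₗ-cong refl (T.+-hom v w)) (*ₗ-distribˡ a _ _)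
    ; 0-hom = ≈ᴹ-trans (*ₗ-cong refl T.0-hom) (*ₗ-zeroʳ a)
    ; *-hom = λ c v → ≈ᴹ-trans (*ₗ-cong refl (T.*-hom c v)) (≈ᴹ-trans (≈ᴹ-sym (*ₗ-assoc a c _))
        (≈ᴹ-trans (*ₗ-cong (*-comm a c) ≈ᴹ-refl) (*ₗ-assoc c a _)))
    }
    where
    module T = IsLinear T-linear
    open Module B

  -- Equality of two linear maps is such a property (`equalizer`), so it suffices to check it on
  -- vectors that span, or on vectors that generate by way of M and Θ.
  record IsSubmodule (A : Module K 0ℓ 0ℓ) (P : Module.Carrierᴹ A → Set) : Set where
    open Module A
    field
      resp : ∀ {v w} → v ≈ᴹ w → P v → P w
      0∈   : P 0ᴹ
      +∈   : ∀ {v w} → P v → P w → P (v +ᴹ w)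
      *∈   : ∀ a {v} → P v → P (a *ₗ v)

  equalizer : ∀ {A B : Module K 0ℓ 0ℓ} {S T} → IsLinear A B S → IsLinear A B T →
              IsSubmodule A (λ v → Module._≈ᴹ_ B (S v) (T v))
  equalizer {A} {B} S-linear T-linear = record
    { resp = λ e p → ≈ᴹ-trans (S.cong (A.≈ᴹ-sym e)) (≈ᴹ-trans p (T.cong e))
    ; 0∈   = ≈ᴹ-trans S.0-hom (≈ᴹ-sym T.0-hom)
    ; +∈   = λ p q → ≈ᴹ-trans (S.+-hom _ _) (≈ᴹ-trans (+ᴹ-cong p q) (≈ᴹ-sym (T.+-hom _ _)))
    ; *∈   = λ a p → ≈ᴹ-trans (S.*-hom a _) (≈ᴹ-trans (*ₗ-cong refl p) (≈ᴹ-sym (T.*-hom a _)))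
    }
    where
    module S = IsLinear S-linear
    module T = IsLinear T-linear
    module A = Module A
    open Module B

  module _ (B : DecSetoid 0ℓ 0ℓ) where
    open FreeModule K B

    spanned : ∀ {P} → IsSubmodule module≋ P → (∀ x → P ⟦ x ⟧) → ∀ v → P v
    spanned P-sub basis []            = IsSubmodule.0∈ P-sub
    spanned P-sub basis ((a , x) ∷ v) = resp (mk≋ λ y → +-congʳ (*-congʳ (*-identityʳ a)))
      (+∈ (*∈ a (basis x)) (spanned P-sub basis v))
      where open IsSubmodule P-sub

  module _ (B C : DecSetoid 0ℓ 0ℓ) where
    private
      module B = FreeModule K B
      module C = FreeModule K C

    pair-extend : ∀ φ f v → C.pair φ (extend K B C f v) ≈ B.pair (λ x → C.pair φ (f x)) v
    pair-extend φ f []            = refl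
    pair-extend φ f ((a , x) ∷ v) = trans (C.pair-++ φ (a C.· f x) (extend K B C f v))
      (+-cong (C.pair-· φ a (f x)) (pair-extend φ f v))

    extend-linear : ∀ {f} → (∀ {x y} → DecSetoid._≈_ B x y → f x C.≋ f y) →
                    IsLinear B.module≋ C.module≋ (extend K B C f)
    extend-linear {f} f-cong = record
      { cong  = λ {v} {w} v≋w → C.mk≋ λ y → trans (pair-extend (C.δ y) f v)
          (trans (B.pair-cong (λ x∼x′ → C.coeff≈ (f-cong x∼x′) y) v≋w) (sym (pair-extend (C.δ y) f w)))
      ; +-hom = λ v w → C.mk≋ λ y → trans (pair-extend (C.δ y) f (v ++ w))
          (trans (B.pair-++ _ v w) (trans (sym (+-cong (pair-extend (C.δ y) f v) (pair-extend (C.δ y) f w)))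
            (sym (C.pair-++ (C.δ y) (extend K B C f v) (extend K B C f w)))))
      ; 0-hom = C.mk≋ λ y → refl
      ; *-hom = λ a v → C.mk≋ λ y → trans (pair-extend (C.δ y) f (a B.· v))
          (trans (B.pair-· _ a v) (trans (*-congˡ (sym (pair-extend (C.δ y) f v)))
            (sym (C.pair-· (C.δ y) a (extend K B C f v)))))
      }

    extend-⟦⟧ : ∀ f x → extend K B C f B.⟦ x ⟧ C.≋ f x
    extend-⟦⟧ f x = C.mk≋ λ y → trans (pair-extend (C.δ y) f B.⟦ x ⟧)
      (trans (+-identityʳ _) (*-identityˡ _))

  -- The common pattern of (M, D) and (M̂, D̂): Θ = MD - DM, and the operators S i form the
  -- symmetric group action permuting the entries of a tuple.
  record ShiftAlgebra (V : ℕ → Module K 0ℓ 0ℓ) : Set where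
    private
      module V k = Module (V k)
    field
      M        : ∀ {k} → V.Carrierᴹ k → V.Carrierᴹ (suc k)
      D        : ∀ {k} → V.Carrierᴹ (suc k) → V.Carrierᴹ k
      Θ        : ∀ {k} → V.Carrierᴹ (suc k) → V.Carrierᴹ (suc k)
      S        : ∀ {k} → Fin (suc k) → V.Carrierᴹ (suc (suc k)) → V.Carrierᴹ (suc (suc k))
      M-linear : ∀ {k} → IsLinear (V k) (V (suc k)) M
      D-linear : ∀ {k} → IsLinear (V (suc k)) (V k) D
      Θ-linear : ∀ {k} → IsLinear (V (suc k)) (V (suc k)) Θ
      S-linear : ∀ {k} (i : Fin (suc k)) → IsLinear (V (suc (suc k))) (V (suc (suc k))) (S i)
      D-M      : ∀ {k} (v : V.Carrierᴹ (suc k)) → V._≈ᴹ_ (suc k) (V._+ᴹ_ (suc k) (D (M v)) (Θ v)) (M (D v))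
      D-Θ      : ∀ {k} (v : V.Carrierᴹ (suc (suc k))) → V._≈ᴹ_ (suc k) (D (Θ v)) (Θ (D (S zero v)))
      S-M      : ∀ {k} i (v : V.Carrierᴹ (suc (suc k))) →
                 V._≈ᴹ_ (suc (suc (suc k))) (S (inject₁ i) (M v)) (M (S i v))
      S-Θ      : ∀ {k} i (v : V.Carrierᴹ (suc (suc (suc k)))) →
                 V._≈ᴹ_ (suc (suc (suc k))) (S (inject₁ i) (Θ v)) (Θ (S (suc i) v))
      S-M-M    : ∀ {k} (v : V.Carrierᴹ k) → V._≈ᴹ_ (suc (suc k)) (S (fromℕ k) (M (M v))) (M (M v))
      S-M-Θ    : ∀ {k} (v : V.Carrierᴹ (suc k)) → V._≈ᴹ_ (suc (suc k)) (S (fromℕ k) (M (Θ v))) (Θ (M v))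
      S-Θ-M    : ∀ {k} (v : V.Carrierᴹ (suc k)) → V._≈ᴹ_ (suc (suc k)) (S (fromℕ k) (Θ (M v))) (M (Θ v))
      S-Θ-Θ    : ∀ {k} (v : V.Carrierᴹ (suc (suc k))) →
                 V._≈ᴹ_ (suc (suc k)) (S (fromℕ k) (Θ (Θ v))) (Θ (Θ (S zero v)))

  -- What is verified directly for tableaux. Nothing here mentions Θ: the relations of Θ = MD - DM
  -- with M, D and the transpositions are consequences, derived in `shiftAlgebra`.
  record CommutationRelations (V : ℕ → Module K 0ℓ 0ℓ) : Set where
    private
      module V k = Module (V k)
    field
      M             : ∀ {k} → V.Carrierᴹ k → V.Carrierᴹ (suc k)
      D             : ∀ {k} → V.Carrierᴹ (suc k) → V.Carrierᴹ k
      S             : ∀ {k} → Fin (suc k) → V.Carrierᴹ (suc (suc k)) → V.Carrierᴹ (suc (suc k))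
      M-linear      : ∀ {k} → IsLinear (V k) (V (suc k)) M
      D-linear      : ∀ {k} → IsLinear (V (suc k)) (V k) D
      S-linear      : ∀ {k} (i : Fin (suc k)) → IsLinear (V (suc (suc k))) (V (suc (suc k))) (S i)
      S-involutive  : ∀ {k} i (v : V.Carrierᴹ (suc (suc k))) → V._≈ᴹ_ (suc (suc k)) (S i (S i v)) v
      S-M           : ∀ {k} i (v : V.Carrierᴹ (suc (suc k))) →
                      V._≈ᴹ_ (suc (suc (suc k))) (S (inject₁ i) (M v)) (M (S i v))
      S-D           : ∀ {k} i (v : V.Carrierᴹ (suc (suc (suc k)))) →
                      V._≈ᴹ_ (suc (suc k)) (S i (D v)) (D (S (suc i) v))
      S-M-M         : ∀ {k} (v : V.Carrierᴹ k) → V._≈ᴹ_ (suc (suc k)) (S (fromℕ k) (M (M v))) (M (M v))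
      D-D-S         : ∀ {k} (v : V.Carrierᴹ (suc (suc k))) → V._≈ᴹ_ k (D (D (S zero v))) (D (D v))
      M-D-M         : ∀ {k} (v : V.Carrierᴹ (suc k)) → V._≈ᴹ_ (suc (suc k))
                      (V._+ᴹ_ (suc (suc k)) (M (D (M v))) (S (fromℕ k) (M (D (M v)))))
                      (V._+ᴹ_ (suc (suc k)) (M (M (D v))) (D (M (M v))))
      D-M-D         : ∀ {k} (v : V.Carrierᴹ (suc (suc k))) → V._≈ᴹ_ (suc k)
                      (V._+ᴹ_ (suc k) (D (M (D v))) (D (M (D (S zero v)))))
                      (V._+ᴹ_ (suc k) (M (D (D v))) (D (D (M v))))

  module Subtraction (A : Module K 0ℓ 0ℓ) where
    open Module A
    open SetoidReasoning ≈ᴹ-setoid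
    open MonoidSolver +ᴹ-commutativeMonoid using (solve; _⊕_; _⊜_)

    infixl 6 _⊝_
    _⊝_ : Carrierᴹ → Carrierᴹ → Carrierᴹ
    v ⊝ w = v +ᴹ (- 1#) *ₗ w

    ⊝-cong : ∀ {v v′ w w′} → v ≈ᴹ v′ → w ≈ᴹ w′ → v ⊝ w ≈ᴹ v′ ⊝ w′
    ⊝-cong e f = +ᴹ-cong e (*ₗ-cong refl f)

    cancels : ∀ v → v ⊝ v ≈ᴹ 0ᴹ
    cancels v = begin
      v +ᴹ (- 1#) *ₗ v          ≈⟨ +ᴹ-cong (≈ᴹ-sym (*ₗ-identityˡ v)) ≈ᴹ-refl ⟩
      1# *ₗ v +ᴹ (- 1#) *ₗ v    ≈⟨ *ₗ-distribʳ v 1# (- 1#) ⟨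
      (1# + - 1#) *ₗ v          ≈⟨ *ₗ-cong (-‿inverseʳ 1#) ≈ᴹ-refl ⟩
      0# *ₗ v                   ≈⟨ *ₗ-zeroˡ v ⟩
      0ᴹ                        ∎

    exchange : ∀ {v w x y} → v +ᴹ w ≈ᴹ x +ᴹ y → x ⊝ w ≈ᴹ v ⊝ y
    exchange {v} {w} {x} {y} e = begin
      x +ᴹ w⁻                        ≈⟨ +ᴹ-identityʳ _ ⟨
      x +ᴹ w⁻ +ᴹ 0ᴹ                  ≈⟨ +ᴹ-cong ≈ᴹ-refl (cancels y) ⟨
      x +ᴹ w⁻ +ᴹ (y +ᴹ y⁻)           ≈⟨ solve 4 (λ x w y z → (x ⊕ w) ⊕ (y ⊕ z) ⊜ ((x ⊕ y) ⊕ w) ⊕ z) ≈ᴹ-refl x w⁻ y y⁻ ⟩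
      x +ᴹ y +ᴹ w⁻ +ᴹ y⁻             ≈⟨ +ᴹ-cong (+ᴹ-cong e ≈ᴹ-refl) ≈ᴹ-refl ⟨
      v +ᴹ w +ᴹ w⁻ +ᴹ y⁻             ≈⟨ solve 4 (λ v w x y → ((v ⊕ w) ⊕ x) ⊕ y ⊜ (v ⊕ y) ⊕ (w ⊕ x)) ≈ᴹ-refl v w w⁻ y⁻ ⟩
      v +ᴹ y⁻ +ᴹ (w +ᴹ w⁻)           ≈⟨ +ᴹ-cong ≈ᴹ-refl (cancels w) ⟩
      v +ᴹ y⁻ +ᴹ 0ᴹ                  ≈⟨ +ᴹ-identityʳ _ ⟩
      v +ᴹ y⁻                        ∎
      where
      w⁻ = (- 1#) *ₗ w
      y⁻ = (- 1#) *ₗ y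

    add-back : ∀ v w → v +ᴹ (w ⊝ v) ≈ᴹ w
    add-back v w = ≈ᴹ-trans (solve 3 (λ v w x → v ⊕ (w ⊕ x) ⊜ w ⊕ (v ⊕ x)) ≈ᴹ-refl v w _)
      (≈ᴹ-trans (+ᴹ-cong ≈ᴹ-refl (cancels v)) (+ᴹ-identityʳ w))

  ⊝-hom : ∀ {A B : Module K 0ℓ 0ℓ} {T} → IsLinear A B T → ∀ v w →
          Module._≈ᴹ_ B (T (Subtraction._⊝_ A v w)) (Subtraction._⊝_ B (T v) (T w))
  ⊝-hom {B = B} {T} T-linear v w = ≈ᴹ-trans (T.+-hom v _) (+ᴹ-cong ≈ᴹ-refl (T.*-hom (- 1#) w))
    where
    module T = IsLinear T-linear
    open Module B

  module _ {V : ℕ → Module K 0ℓ 0ℓ} (relations : CommutationRelations V) where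

    open CommutationRelations relations
    private
      module V k = Module (V k)
      module M {k} = IsLinear (M-linear {k})
      module D {k} = IsLinear (D-linear {k})
      module S {k} (i : Fin (suc k)) = IsLinear (S-linear i)
      module V⊝ (k : ℕ) = Subtraction (V k)

    shiftAlgebra : ShiftAlgebra V
    shiftAlgebra = record
      { M = M ; D = D ; Θ = Θ ; S = S
      ; M-linear = M-linear ; D-linear = D-linear ; Θ-linear = Θ-linear ; S-linear = S-linear
      ; D-M = λ {k} v → V⊝.add-back (suc k) (D (M v)) (M (D v))
      ; D-Θ = D-Θ ; S-M = S-M ; S-Θ = S-Θ
      ; S-M-M = S-M-M ; S-M-Θ = S-M-Θ ; S-Θ-M = S-Θ-M ; S-Θ-Θ = S-Θ-Θ
      }
      where
      Θ : ∀ {k} → V.Carrierᴹ (suc k) → V.Carrierᴹ (suc k)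
      Θ {k} v = V⊝._⊝_ (suc k) (M (D v)) (D (M v))

      Θ-linear : ∀ {k} → IsLinear (V (suc k)) (V (suc k)) (Θ {k})
      Θ-linear = +-linear (∘-linear M-linear D-linear) (*-linear (- 1#) (∘-linear D-linear M-linear))

      module Θ {k} = IsLinear (Θ-linear {k})

      -- With s the last transposition, sMΘ = sMMD - sMDM = MMD - sMDM, and `M-D-M` turns this into
      -- MDM - DMM = ΘM.
      S-M-Θ : ∀ {k} (v : V.Carrierᴹ (suc k)) → V._≈ᴹ_ (suc (suc k)) (S (fromℕ k) (M (Θ v))) (Θ (M v))
      S-M-Θ {k} v = ≈ᴹ-trans (S.cong (fromℕ k) (⊝-hom M-linear (M (D v)) (D (M v))))
        (≈ᴹ-trans (⊝-hom (S-linear (fromℕ k)) (M (M (D v))) (M (D (M v))))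
        (≈ᴹ-trans (⊝-cong (S-M-M (D v)) ≈ᴹ-refl) (exchange (M-D-M v))))
        where
        open V⊝ (suc (suc k))
        open V (suc (suc k))

      -- Likewise ΘDs = MDDs - DMDs = MDD - DMDs for the first transposition s, and `D-M-D` turns
      -- this into DMD - DDM = DΘ.
      D-Θ : ∀ {k} (v : V.Carrierᴹ (suc (suc k))) → V._≈ᴹ_ (suc k) (D (Θ v)) (Θ (D (S zero v)))
      D-Θ {k} v = ≈ᴹ-sym (≈ᴹ-trans (⊝-cong (M.cong (D-D-S v)) ≈ᴹ-refl)
        (≈ᴹ-trans (exchange (D-M-D v)) (≈ᴹ-sym (⊝-hom D-linear (M (D v)) (D (M v))))))
        where
        open V⊝ (suc k)
        open V (suc k)

      S-Θ : ∀ {k} i (v : V.Carrierᴹ (suc (suc (suc k)))) →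
            V._≈ᴹ_ (suc (suc (suc k))) (S (inject₁ i) (Θ v)) (Θ (S (suc i) v))
      S-Θ {k} i v = ≈ᴹ-trans (⊝-hom (S-linear (inject₁ i)) (M (D v)) (D (M v))) (⊝-cong
        (≈ᴹ-trans (S-M i (D v)) (M.cong (S-D i v)))
        (≈ᴹ-trans (S-D (inject₁ i) (M v)) (D.cong (S-M (suc i) v))))
        where
        open V⊝ (suc (suc (suc k)))
        open V (suc (suc (suc k)))

      S-Θ-M : ∀ {k} (v : V.Carrierᴹ (suc k)) → V._≈ᴹ_ (suc (suc k)) (S (fromℕ k) (Θ (M v))) (M (Θ v))
      S-Θ-M {k} v = ≈ᴹ-trans (S.cong (fromℕ k) (≈ᴹ-sym (S-M-Θ v))) (S-involutive (fromℕ k) (M (Θ v)))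
        where open V (suc (suc k))

      Θ-D : ∀ {k} (v : V.Carrierᴹ (suc (suc k))) → V._≈ᴹ_ (suc k) (Θ (D v)) (D (Θ (S zero v)))
      Θ-D {k} v = ≈ᴹ-sym (≈ᴹ-trans (D-Θ (S zero v)) (Θ.cong (D.cong (S-involutive zero v))))
        where open V (suc k)

      -- Only the inner Θ is expanded. Moving s through ΘMD and ΘDM gives MDΘs₁ and DMΘs₁, with s₁
      -- the first transposition; their difference is ΘΘs₁.
      S-Θ-Θ : ∀ {k} (v : V.Carrierᴹ (suc (suc k))) →
              V._≈ᴹ_ (suc (suc k)) (S (fromℕ k) (Θ (Θ v))) (Θ (Θ (S zero v)))
      S-Θ-Θ {k} v = ≈ᴹ-trans (S.cong (fromℕ k) (⊝-hom Θ-linear (M (D v)) (D (M v))))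
        (≈ᴹ-trans (⊝-hom (S-linear (fromℕ k)) (Θ (M (D v))) (Θ (D (M v))))
        (⊝-cong
          (≈ᴹ-trans (S-Θ-M (D v)) (M.cong (Θ-D v)))
          (≈ᴹ-trans (S.cong (fromℕ k) (Θ-D (M v)))
          (≈ᴹ-trans (S-D (fromℕ k) (Θ (S zero (M v))))
          (D.cong (V.≈ᴹ-trans (suc (suc (suc k))) (S.cong (fromℕ (suc k)) (Θ.cong (S-M zero v)))
            (S-Θ-M (S zero v))))))))
        where
        open V⊝ (suc (suc k))
        open V (suc (suc k))

  -- Membership in a span is expressed through all submodules P, so that inductions on the degree
  -- never mention coefficients. `generated` is the expansion of b_{σ,y} through M and Θ; `filtered`
  -- says that the first transposition does not raise the degree.
  record FilteredBasis {V : ℕ → Module K 0ℓ 0ℓ} (algebra : ShiftAlgebra V) : Set₁ where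
    private
      module V k = Module (V k)
    open ShiftAlgebra algebra
    field
      Basis     : ℕ → Set
      b         : ∀ {k} → Basis k → V.Carrierᴹ k
      deg       : ∀ {k} → Basis k → ℕ
      spans     : ∀ {k} {P : V.Carrierᴹ k → Set} → IsSubmodule (V k) P → (∀ σ → P (b σ)) → ∀ v → P v
      generated : ∀ {k} (σ : Basis (suc k)) {P : V.Carrierᴹ (suc k) → Set} → IsSubmodule (V (suc k)) P →
                  (∀ v → P (M v)) → (∀ τ → deg τ ℕ.< deg σ → P (Θ (b τ))) → P (b σ)
      filtered  : ∀ {k} (σ : Basis (suc (suc k))) {P : V.Carrierᴹ (suc (suc k)) → Set} →
                  IsSubmodule (V (suc (suc k))) P → (∀ τ → deg τ ℕ.≤ deg σ → P (b τ)) → P (S zero (b σ))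

  -- Of D̂U = UD only the bottom level is demanded; `U-D` derives the higher levels from it.
  record IntertwinesShifts {V V̂ : ℕ → Module K 0ℓ 0ℓ} (algebra : ShiftAlgebra V) (hat : ShiftAlgebra V̂)
    (U : ∀ k → Module.Carrierᴹ (V k) → Module.Carrierᴹ (V̂ k)) : Set where
    private
      module V̂ k = Module (V̂ k)
      module A = ShiftAlgebra algebra
      module Â = ShiftAlgebra hat
    field
      U-linear : ∀ k → IsLinear (V k) (V̂ k) (U k)
      U-M      : ∀ k v → V̂._≈ᴹ_ (suc k) (U (suc k) (A.M v)) (Â.M (U k v))
      U-Θ      : ∀ k v → V̂._≈ᴹ_ (suc k) (U (suc k) (A.Θ v)) (Â.Θ (U (suc k) v))
      U-D₀     : ∀ v → V̂._≈ᴹ_ 0 (Â.D (U 1 v)) (U 0 (A.D v))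

  -- Commutation of U with the symmetric groups and with D

  module Intertwining {V V̂ : ℕ → Module K 0ℓ 0ℓ} {algebra : ShiftAlgebra V} {hat : ShiftAlgebra V̂}
    (basis : FilteredBasis algebra) {U′ : ∀ k → Module.Carrierᴹ (V k) → Module.Carrierᴹ (V̂ k)}
    (intertwines : IntertwinesShifts algebra hat U′) where

    open ShiftAlgebra algebra
    open ShiftAlgebra hat using () renaming (M to M̂; D to D̂; Θ to Θ̂; S to Ŝ)
    open FilteredBasis basis

    private
      module V k = Module (V k)
      module V̂ k = Module (V̂ k)
      open IntertwinesShifts intertwines renaming (U-linear to U′-linear; U-M to U′-M; U-Θ to U′-Θ)

      U : ∀ {k} → V.Carrierᴹ k → V̂.Carrierᴹ k
      U {k} = U′ k

      U-linear : ∀ {k} → IsLinear (V k) (V̂ k) U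
      U-linear {k} = U′-linear k

      U-M : ∀ {k} (v : V.Carrierᴹ k) → V̂._≈ᴹ_ (suc k) (U (M v)) (M̂ (U v))
      U-M {k} = U′-M k

      U-Θ : ∀ {k} (v : V.Carrierᴹ (suc k)) → V̂._≈ᴹ_ (suc k) (U (Θ v)) (Θ̂ (U v))
      U-Θ {k} = U′-Θ k

      module Â = ShiftAlgebra hat
      module U {k} = IsLinear (U-linear {k})
      module M̂ {k} = IsLinear (Â.M-linear {k})
      module D̂ {k} = IsLinear (Â.D-linear {k})
      module Θ̂ {k} = IsLinear (Â.Θ-linear {k})
      module Ŝ {k} (i : Fin (suc k)) = IsLinear (Â.S-linear i)

      Commutes : ∀ {k} → Fin (suc k) → V.Carrierᴹ (suc (suc k)) → Set
      Commutes {k} i v = V̂._≈ᴹ_ (suc (suc k)) (U (S i v)) (Ŝ i (U v))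

      commutes-submodule : ∀ {k} (i : Fin (suc k)) → IsSubmodule (V (suc (suc k))) (Commutes i)
      commutes-submodule i = equalizer (∘-linear U-linear (S-linear i)) (∘-linear (Â.S-linear i) U-linear)

      preimage : ∀ {A B : Module K 0ℓ 0ℓ} {T P} → IsLinear A B T → IsSubmodule B P →
                 IsSubmodule A (λ v → P (T v))
      preimage {B = B} T-linear P-sub = record
        { resp = λ e → resp (T.cong e)
        ; 0∈   = resp (≈ᴹ-sym T.0-hom) 0∈
        ; +∈   = λ p q → resp (≈ᴹ-sym (T.+-hom _ _)) (+∈ p q)
        ; *∈   = λ a p → resp (≈ᴹ-sym (T.*-hom a _)) (*∈ a p)
        }
        where
        module T = IsLinear T-linear
        open IsSubmodule P-sub
        open Module B

      -- The vector v may be taken of the form M w or Θ b_τ. The last transposition fixes MM and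
      -- exchanges MΘ with ΘM, on both sides of U, so no induction hypothesis enters.
      last-M : ∀ {k} (v : V.Carrierᴹ (suc k)) → Commutes (fromℕ k) (M v)
      last-M {k} = spans submodule λ σ → generated σ submodule
        (λ v → ≈ᴹ-trans (U.cong (S-M-M v)) (≈ᴹ-trans (U-MM v)
          (≈ᴹ-trans (≈ᴹ-sym (Â.S-M-M (U v))) (Ŝ.cong (fromℕ k) (≈ᴹ-sym (U-MM v))))))
        (λ τ _ → let v = b τ in
          ≈ᴹ-trans (U.cong (S-M-Θ v)) (≈ᴹ-trans (≈ᴹ-trans (U-Θ (M v)) (Θ̂.cong (U-M v)))
          (≈ᴹ-trans (≈ᴹ-sym (Â.S-M-Θ (U v))) (Ŝ.cong (fromℕ k) (≈ᴹ-sym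
            (≈ᴹ-trans (U-M (Θ v)) (M̂.cong (U-Θ v))))))))
        where
        open Module (V̂ (suc (suc k)))
        submodule = preimage M-linear (commutes-submodule (fromℕ k))
        U-MM : ∀ v → U (M (M v)) ≈ᴹ M̂ (M̂ (U v))
        U-MM v = ≈ᴹ-trans (U-M (M v)) (M̂.cong (U-M v))

      -- In contrast to `last-M`, the relation for ΘΘ leaves the first transposition inside. It acts
      -- on basis vectors of smaller degree only, which is what the hypothesis covers.
      last-Θ : ∀ {k} (σ : Basis (suc (suc k))) → (∀ (τ : Basis (suc (suc k))) → deg τ ℕ.< deg σ → Commutes {k} zero (b τ)) →
               Commutes (fromℕ k) (Θ (b σ))
      last-Θ {k} σ ih = generated σ (preimage Θ-linear (commutes-submodule (fromℕ k)))
        (λ v → ≈ᴹ-trans (U.cong (S-Θ-M v)) (≈ᴹ-trans (≈ᴹ-trans (U-M (Θ v)) (M̂.cong (U-Θ v)))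
          (≈ᴹ-trans (≈ᴹ-sym (Â.S-Θ-M (U v))) (Ŝ.cong (fromℕ k) (≈ᴹ-sym
            (≈ᴹ-trans (U-Θ (M v)) (Θ̂.cong (U-M v))))))))
        (λ τ τ<σ → ≈ᴹ-trans (U.cong (S-Θ-Θ (b τ))) (≈ᴹ-trans (U-ΘΘ (S zero (b τ)))
          (≈ᴹ-trans (Θ̂.cong (Θ̂.cong (ih τ τ<σ))) (≈ᴹ-trans (≈ᴹ-sym (Â.S-Θ-Θ (U (b τ))))
          (Ŝ.cong (fromℕ k) (≈ᴹ-sym (U-ΘΘ (b τ))))))))
        where
        open Module (V̂ (suc (suc k)))
        U-ΘΘ : ∀ v → U (Θ (Θ v)) ≈ᴹ Θ̂ (Θ̂ (U v))
        U-ΘΘ v = ≈ᴹ-trans (U-Θ (Θ v)) (Θ̂.cong (U-Θ v))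

      inner-Θ : ∀ {k} (i : Fin (suc k)) v → Commutes (suc i) v → Commutes (inject₁ i) (Θ v)
      inner-Θ {k} i v ih = ≈ᴹ-trans (U.cong (S-Θ i v)) (≈ᴹ-trans (U-Θ _) (≈ᴹ-trans (Θ̂.cong ih)
        (≈ᴹ-trans (≈ᴹ-sym (Â.S-Θ i (U v))) (Ŝ.cong (inject₁ i) (≈ᴹ-sym (U-Θ v))))))
        where open Module (V̂ (suc (suc (suc k))))

      on-Θ : ∀ k (i : Fin (suc k)) (σ : Basis (suc (suc k))) → (∀ (j : Fin (suc k)) → Commutes j (b σ)) →
             (∀ (τ : Basis (suc (suc k))) → deg τ ℕ.< deg σ → ∀ (j : Fin (suc k)) → Commutes j (b τ)) → Commutes i (Θ (b σ))
      on-Θ zero    zero σ at-σ below = last-Θ {zero} σ (λ τ τ<σ → below τ τ<σ zero)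
      on-Θ (suc k) i    σ at-σ below with view i
      ... | ‵fromℕ     = last-Θ {suc k} σ (λ τ τ<σ → below τ τ<σ zero)
      ... | ‵inject₁ j = inner-Θ {k} j (b σ) (at-σ (suc j))

    mutual

      -- Lexicographic induction on k and the degree: `on-M` descends to a smaller k, and Θ occurs
      -- only on basis vectors of smaller degree.
      U-S : ∀ k (i : Fin (suc k)) v → Commutes i v
      U-S k i = spans (commutes-submodule i) λ σ → on-basis k (suc (deg σ)) σ ℕ.≤-refl i

      on-basis : ∀ k n (σ : Basis (suc (suc k))) → deg σ ℕ.< n → ∀ (i : Fin (suc k)) → Commutes i (b σ)
      on-basis k (suc n) σ (s≤s σ≤n) i = generated σ (commutes-submodule i) (on-M k i) λ τ τ<σ →
        on-Θ k i τ (on-basis k n τ (ℕ.<-≤-trans τ<σ σ≤n))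
          λ υ υ<τ → on-basis k n υ (ℕ.<-≤-trans (ℕ.<-trans υ<τ τ<σ) σ≤n)

      on-M : ∀ k (i : Fin (suc k)) v → Commutes i (M v)
      on-M zero    zero v = last-M {zero} v
      on-M (suc k) i    v with view i
      ... | ‵fromℕ     = last-M {suc k} v
      ... | ‵inject₁ j = ≈ᴹ-trans (U.cong (S-M j v)) (≈ᴹ-trans (U-M _) (≈ᴹ-trans (M̂.cong (U-S k j v))
        (≈ᴹ-trans (≈ᴹ-sym (Â.S-M j (U v))) (Ŝ.cong (inject₁ j) (≈ᴹ-sym (U-M v))))))
        where open Module (V̂ (suc (suc (suc k))))

    private
      Lowers : ∀ {k} → V.Carrierᴹ (suc k) → Set
      Lowers {k} v = V̂._≈ᴹ_ k (D̂ (U v)) (U (D v))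

      lowers-submodule : ∀ {k} → IsSubmodule (V (suc k)) (Lowers {k})
      lowers-submodule = equalizer (∘-linear Â.D-linear U-linear) (∘-linear U-linear D-linear)

      -- Writing DM = MD - Θ on both sides reduces M v to v, one level below; the terms with Θ agree
      -- by `U-Θ` and are cancelled.
      lowers-M : ∀ {k} (v : V.Carrierᴹ (suc k)) → Lowers v → Lowers (M v)
      lowers-M {k} v ih = ∙-cancelʳ (Θ̂ (U v)) _ _ (begin
        D̂ (U (M v)) +ᴹ Θ̂ (U v)     ≈⟨ +ᴹ-cong (D̂.cong (U-M v)) ≈ᴹ-refl ⟩
        D̂ (M̂ (U v)) +ᴹ Θ̂ (U v)     ≈⟨ Â.D-M (U v) ⟩
        M̂ (D̂ (U v))                ≈⟨ M̂.cong ih ⟩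
        M̂ (U (D v))                ≈⟨ U-M (D v) ⟨
        U (M (D v))                ≈⟨ U.cong (D-M v) ⟨
        U (V._+ᴹ_ (suc k) (D (M v)) (Θ v))
                                   ≈⟨ U.+-hom (D (M v)) (Θ v) ⟩
        U (D (M v)) +ᴹ U (Θ v)     ≈⟨ +ᴹ-cong ≈ᴹ-refl (U-Θ v) ⟩
        U (D (M v)) +ᴹ Θ̂ (U v)     ∎)
        where
        open Module (V̂ (suc k))
        open SetoidReasoning ≈ᴹ-setoid
        open GroupProperties (AbelianGroup.group +ᴹ-abelianGroup) using (∙-cancelʳ)

      -- Since DΘ = ΘDs₁, the vector Θ v is reduced to s₁v rather than to v. This is the reason for
      -- proving that U commutes with transpositions, and for `filtered`, which bounds the degree of
      -- s₁v.
      lowers-Θ : ∀ {k} (v : V.Carrierᴹ (suc (suc k))) → Lowers (S zero v) → Lowers (Θ v)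
      lowers-Θ {k} v ih = begin
        D̂ (U (Θ v))            ≈⟨ D̂.cong (U-Θ v) ⟩
        D̂ (Θ̂ (U v))            ≈⟨ Â.D-Θ (U v) ⟩
        Θ̂ (D̂ (Ŝ zero (U v)))   ≈⟨ Θ̂.cong (D̂.cong (U-S k zero v)) ⟨
        Θ̂ (D̂ (U (S zero v)))   ≈⟨ Θ̂.cong ih ⟩
        Θ̂ (U (D (S zero v)))   ≈⟨ U-Θ (D (S zero v)) ⟨
        U (Θ (D (S zero v)))   ≈⟨ U.cong (D-Θ v) ⟨
        U (D (Θ v))            ∎
        where
        open Module (V̂ (suc k))
        open SetoidReasoning ≈ᴹ-setoid

      lowers-basis : ∀ k → (∀ v → Lowers {k} v) → ∀ n (σ : Basis (suc (suc k))) → deg σ ℕ.< n → Lowers (b σ)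
      lowers-basis k lower (suc n) σ (s≤s σ≤n) = generated σ (lowers-submodule {suc k})
        (λ v → lowers-M {k} v (lower v))
        (λ τ τ<σ → lowers-Θ {k} (b τ) (filtered τ (lowers-submodule {suc k}) λ υ υ≤τ →
          lowers-basis k lower n υ (ℕ.<-≤-trans (ℕ.≤-<-trans υ≤τ τ<σ) σ≤n)))

    U-D : ∀ k (v : V.Carrierᴹ (suc k)) → V̂._≈ᴹ_ k (D̂ (U v)) (U (D v))
    U-D zero    = U-D₀
    U-D (suc k) = spans (lowers-submodule {suc k}) λ σ → lowers-basis k (U-D k) (suc (deg σ)) σ ℕ.≤-refl

-- Tuples and their degree

swap : ∀ {A : Set} {k} → Fin (suc k) → Vec A (suc (suc k)) → Vec A (suc (suc k))
swap             zero    (a ∷ b ∷ v) = b ∷ a ∷ v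
swap {k = suc k} (suc i) (a ∷ v)     = a ∷ swap i v

swap-All : ∀ {A : Set} {P : A → Set} {k} (i : Fin (suc k)) {v : Vec A (suc (suc k))} →
           All P v → All P (swap i v)
swap-All             zero    (p ∷ q ∷ ps) = q ∷ p ∷ ps
swap-All {k = suc k} (suc i) (p ∷ ps)     = p ∷ swap-All i ps

swap-Unique : ∀ {A : Set} {k} (i : Fin (suc k)) {v : Vec A (suc (suc k))} → Unique v → Unique (swap i v)
swap-Unique             zero    ((a≢b ∷ a≢v) ∷ b≢v ∷ v!) =
  ((λ b≡a → a≢b (≡.sym b≡a)) ∷ b≢v) ∷ a≢v ∷ v!
swap-Unique {k = suc k} (suc i) (a≢v ∷ v!)               = swap-All i a≢v ∷ swap-Unique i v!

swap-∷ʳ : ∀ {A : Set} {k} (i : Fin (suc k)) (v : Vec A (suc (suc k))) y →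
          swap (inject₁ i) (v ∷ʳ y) ≡ swap i v ∷ʳ y
swap-∷ʳ             zero    (a ∷ b ∷ v) y = ≡.refl
swap-∷ʳ {k = suc k} (suc i) (a ∷ v)     y = ≡.cong (a ∷_) (swap-∷ʳ i v y)

swap-last : ∀ {A : Set} {k} (v : Vec A k) y z → swap (fromℕ k) (v ∷ʳ y ∷ʳ z) ≡ v ∷ʳ z ∷ʳ y
swap-last []      y z = ≡.refl
swap-last (a ∷ v) y z = ≡.cong (a ∷_) (swap-last v y z)

swap-involutive : ∀ {A : Set} {k} (i : Fin (suc k)) (v : Vec A (suc (suc k))) → swap i (swap i v) ≡ v
swap-involutive             zero    (a ∷ b ∷ v) = ≡.refl
swap-involutive {k = suc k} (suc i) (a ∷ v)     = ≡.cong (a ∷_) (swap-involutive i v)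

-- Plays the part of the axial distance in Young's seminormal form.
gap : ∀ {k} → Fin (suc k) → Vec ℕ (suc (suc k)) → ℤ
gap             zero    (a ∷ b ∷ v) = + b ℤ.- + a
gap {k = suc k} (suc i) (a ∷ v)     = gap i v

gap-swap : ∀ {k} (i : Fin (suc k)) v → gap i (swap i v) ≡ ℤ.- gap i v
gap-swap             zero    (a ∷ b ∷ v) = solve 2 (λ a b → a :- b := :- (b :- a)) ≡.refl (+ a) (+ b)
  where open ℤSolver.+-*-Solver
gap-swap {k = suc k} (suc i) (a ∷ v)     = gap-swap i v

gap-∷ʳ : ∀ {k} (i : Fin (suc k)) v y → gap (inject₁ i) (v ∷ʳ y) ≡ gap i v
gap-∷ʳ             zero    (a ∷ b ∷ v) y = ≡.refl
gap-∷ʳ {k = suc k} (suc i) (a ∷ v)     y = gap-∷ʳ i v y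

gap-last : ∀ {k} (v : Vec ℕ k) y z → gap (fromℕ k) (v ∷ʳ y ∷ʳ z) ≡ + z ℤ.- + y
gap-last []      y z = ≡.refl
gap-last (a ∷ v) y z = gap-last v y z

record Good {k} (v : Vec ℕ k) : Set where
  constructor good
  field
    positive : All NonZero v
    distinct : Unique v

good? : ∀ {k} (v : Vec ℕ k) → Dec (Good v)
good? v with All.all? ℕ.nonZero? v | allPairs? (λ a b → ¬? (a ℕ.≟ b)) v
... | yes p | yes q = yes (good p q)
... | no ¬p | _     = no λ g → ¬p (Good.positive g)
... | yes _ | no ¬q = no λ g → ¬q (Good.distinct g)

-- The proofs stored in `I` are irrelevant; decidability of `Good` makes them available again.
entries-good : ∀ {k} (σ : I k) → Good (entries σ)
entries-good (tuple v pos dist) = recompute (good? v) (good pos dist)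

toI : ∀ {k} {v : Vec ℕ k} → .(Good v) → I k
toI {v = v} g = tuple v (Good.positive g) (Good.distinct g)

swapI : ∀ {k} → Fin (suc k) → I (suc (suc k)) → I (suc (suc k))
swapI i (tuple v p d) = tuple (swap i v) (swap-All i p) (swap-Unique i d)

∷ʳ-good : ∀ {k} {v : Vec ℕ k} {y} → NonZero y → y ∉ v → Good v → Good (v ∷ʳ y)
∷ʳ-good y≢0 y∉v (good p d) = good (∷ʳ-all p y≢0) (∷ʳ-unique d y∉v)

tail-good : ∀ {k a} {v : Vec ℕ k} → Good (a ∷ v) → Good v
tail-good (good (_ ∷ p) (_ ∷ d)) = good p d

head-nonZero : ∀ {k a} {v : Vec ℕ k} → Good (a ∷ v) → NonZero a
head-nonZero (good (a≢0 ∷ _) _) = a≢0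

head-∉ : ∀ {k a} {v : Vec ℕ k} → Good (a ∷ v) → a ∉ v
head-∉ {a = a} (good _ (a≢v ∷ _)) = go a≢v
  where
  go : ∀ {n} {S : Vec ℕ n} → All (a ≢_) S → a ∉ S
  go (a≢b ∷ _)  (here a≡b)  = a≢b a≡b
  go (_ ∷ a≢S)  (there a∈S) = go a≢S a∈S

∉⇒All≢ : ∀ {n} {S : Vec ℕ n} {a} → a ∉ S → All (a ≢_) S
∉⇒All≢ {S = []}    a∉S = []
∉⇒All≢ {S = b ∷ S} a∉S = (λ a≡b → a∉S (here a≡b)) ∷ ∉⇒All≢ (λ a∈S → a∉S (there a∈S))

anchors-unique : ∀ {k} {v : Vec ℕ k} → Good v → Unique (0 ∷ v)
anchors-unique (good p d) = All.map (λ a≢0 0≡a → ℕ.≢-nonZero⁻¹ _ {{a≢0}} (≡.sym 0≡a)) p ∷ d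

∷-good : ∀ {k s} {v : Vec ℕ k} → s ∉ 0 ∷ v → Good v → Good (s ∷ v)
∷-good s∉ (good p d) = good (ℕ.≢-nonZero (λ s≡0 → s∉ (here s≡0)) ∷ p) (∉⇒All≢ (λ s∈v → s∉ (there s∈v)) ∷ d)

good-∉ : ∀ {k s} {v : Vec ℕ k} → Good (s ∷ v) → s ∉ 0 ∷ v
good-∉ g (here s≡0)  = ℕ.≢-nonZero⁻¹ _ {{head-nonZero g}} s≡0
good-∉ g (there s∈v) = head-∉ g s∈v

∷ʳ-All⁻ : ∀ {P : ℕ → Set} {k} (v : Vec ℕ k) {y} → All P (v ∷ʳ y) → All P v × P y
∷ʳ-All⁻ []      (q ∷ [])  = [] , q
∷ʳ-All⁻ (a ∷ v) (p ∷ ps)  = p ∷ proj₁ (∷ʳ-All⁻ v ps) , proj₂ (∷ʳ-All⁻ v ps)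

∷ʳ-Unique⁻ : ∀ {k} (v : Vec ℕ k) {y} → Unique (v ∷ʳ y) → Unique v × y ∉ v
∷ʳ-Unique⁻ []      _              = [] , λ ()
∷ʳ-Unique⁻ (a ∷ v) (a≢vy ∷ vy!) with ∷ʳ-All⁻ v a≢vy | ∷ʳ-Unique⁻ v vy!
... | a≢v , a≢y | v! , y∉v = a≢v ∷ v! , λ { (here y≡a) → a≢y (≡.sym y≡a) ; (there y∈v) → y∉v y∈v }

init-good : ∀ {k} {v : Vec ℕ k} {y} → Good (v ∷ʳ y) → Good v
init-good {v = v} (good p d) = good (proj₁ (∷ʳ-All⁻ v p)) (proj₁ (∷ʳ-Unique⁻ v d))

last-nonZero : ∀ {k} {v : Vec ℕ k} {y} → Good (v ∷ʳ y) → NonZero y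
last-nonZero {v = v} (good p d) = proj₂ (∷ʳ-All⁻ v p)

last-∉ : ∀ {k} {v : Vec ℕ k} {y} → Good (v ∷ʳ y) → y ∉ v
last-∉ {v = v} (good p d) = proj₂ (∷ʳ-Unique⁻ v d)

-- The total height of the columns ending in the boxes of a tuple: a box directly below an earlier one
-- only lengthens a column already counted.
column : ∀ {m} → Vec ℕ m → ℕ → ℕ
column seen a = contribution (pred a ∈? seen)
  where
  contribution : Dec (pred a ∈ seen) → ℕ
  contribution (yes _) = 1
  contribution (no _)  = a

size : ∀ {m k} → Vec ℕ m → Vec ℕ k → ℕ
size seen []      = 0
size seen (a ∷ v) = column seen a ℕ.+ size (a ∷ seen) v

degree : ∀ {k} → Vec ℕ k → ℕ
degree = size []

Sees : ∀ {m n} → Vec ℕ m → Vec ℕ n → Set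
Sees s t = ∀ {x} → x ∈ s → x ∈ t

sees-∷ : ∀ {m n} {s : Vec ℕ m} {t : Vec ℕ n} a → Sees s t → Sees (a ∷ s) (a ∷ t)
sees-∷ a s⊆t (here x≡a)  = here x≡a
sees-∷ a s⊆t (there x∈s) = there (s⊆t x∈s)

column-≤ : ∀ {m} (s : Vec ℕ m) {a} → NonZero a → column s a ℕ.≤ a
column-≤ s {a} a≢0 with pred a ∈? s
... | yes _ = ℕ.>-nonZero⁻¹ a {{a≢0}}
... | no  _ = ℕ.≤-refl

column-≥1 : ∀ {m} (s : Vec ℕ m) {a} → NonZero a → 1 ℕ.≤ column s a
column-≥1 s {a} a≢0 with pred a ∈? s
... | yes _ = ℕ.≤-refl
... | no  _ = ℕ.>-nonZero⁻¹ a {{a≢0}}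

column-new : ∀ {m} (s : Vec ℕ m) {a} → pred a ∉ s → column s a ≡ a
column-new s {a} a∉ with pred a ∈? s
... | yes a∈ = ⊥-elim (a∉ a∈)
... | no  _  = ≡.refl

column-below : ∀ {m} (s : Vec ℕ m) {a} → pred a ∈ s → column s a ≡ 1
column-below s {a} a∈ with pred a ∈? s
... | yes _  = ≡.refl
... | no  a∉ = ⊥-elim (a∉ a∈)

column-antitone : ∀ {m n} {s : Vec ℕ m} {t : Vec ℕ n} {a} → NonZero a → Sees s t → column t a ℕ.≤ column s a
column-antitone {s = s} {t} {a} a≢0 s⊆t with pred a ∈? s
... | yes a∈s = ℕ.≤-reflexive (column-below t (s⊆t a∈s))
... | no  _   = column-≤ t a≢0

size-antitone : ∀ {m n k} {s : Vec ℕ m} {t : Vec ℕ n} {v : Vec ℕ k} → All NonZero v → Sees s t →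
                size t v ℕ.≤ size s v
size-antitone []              s⊆t = z≤n
size-antitone {v = a ∷ v} (a≢0 ∷ v≢0) s⊆t =
  ℕ.+-mono-≤ (column-antitone a≢0 s⊆t) (size-antitone v≢0 (sees-∷ a s⊆t))

size-∷ʳ : ∀ {m k} (s : Vec ℕ m) (v : Vec ℕ k) {z} → NonZero z → suc (size s v) ℕ.≤ size s (v ∷ʳ z)
size-∷ʳ s []      z≢0 = ℕ.≤-trans (column-≥1 s z≢0) (ℕ.m≤m+n _ 0)
size-∷ʳ s (a ∷ v) z≢0 = ℕ.≤-trans (ℕ.≤-reflexive (≡.sym (ℕ.+-suc (column s a) _)))
  (ℕ.+-monoʳ-≤ (column s a) (size-∷ʳ (a ∷ s) v z≢0))

size-∷ʳ-new : ∀ {m k} (s : Vec ℕ m) (v : Vec ℕ k) {z} → pred z ∉ s → pred z ∉ v →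
              z ℕ.+ size s v ℕ.≤ size s (v ∷ʳ z)
size-∷ʳ-new s []      {z} z∉s z∉v = ℕ.≤-reflexive (≡.cong (ℕ._+ 0) (≡.sym (column-new s z∉s)))
size-∷ʳ-new s (a ∷ v) {z} z∉s z∉v = ℕ.≤-trans
  (ℕ.≤-reflexive (≡.trans (≡.sym (ℕ.+-assoc z (column s a) _)) (≡.trans
    (≡.cong (ℕ._+ size (a ∷ s) v) (ℕ.+-comm z (column s a))) (ℕ.+-assoc (column s a) z _))))
  (ℕ.+-monoʳ-≤ (column s a) (size-∷ʳ-new (a ∷ s) v
    (λ { (here z≡a) → z∉v (here z≡a) ; (there z∈s) → z∉s z∈s }) (λ z∈v → z∉v (there z∈v))))

-- Putting the box above p in front costs pred p, but p then extends a column already counted and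
-- contributes 1 instead of p. By `size-antitone` the other entries contribute no more than before.
size-pred : ∀ {m k} (s : Vec ℕ m) {v : Vec ℕ k} {p} → All NonZero v → p ∈ v → pred p ∉ s → pred p ∉ v →
            pred p ℕ.+ size (pred p ∷ s) v ℕ.≤ size s v
size-pred s {a ∷ v} {p} (a≢0 ∷ v≢0) (here ≡.refl) p∉s p∉v = ℕ.≤-trans
  (ℕ.≤-reflexive (≡.trans (≡.cong (λ c → pred p ℕ.+ (c ℕ.+ size (p ∷ pred p ∷ s) v))
      (column-below (pred p ∷ s) {p} (here ≡.refl)))
    (≡.trans (ℕ.+-suc (pred p) _) (≡.cong (ℕ._+ size (p ∷ pred p ∷ s) v) (ℕ.suc-pred p {{a≢0}})))))
  (ℕ.+-mono-≤ (ℕ.≤-reflexive (≡.sym (column-new s p∉s)))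
    (size-antitone v≢0 (sees-∷ p there)))
size-pred s {a ∷ v} {p} (a≢0 ∷ v≢0) (there p∈v) p∉s p∉v = ℕ.≤-trans
  (ℕ.≤-trans (ℕ.+-monoʳ-≤ (pred p) (ℕ.+-mono-≤ (column-antitone {s = s} a≢0 there)
      (size-antitone {s = pred p ∷ a ∷ s} v≢0 exchange)))
    (ℕ.≤-reflexive (≡.trans (≡.sym (ℕ.+-assoc (pred p) (column s a) _)) (≡.trans
      (≡.cong (ℕ._+ size (pred p ∷ a ∷ s) v) (ℕ.+-comm (pred p) (column s a))) (ℕ.+-assoc (column s a) (pred p) _)))))
  (ℕ.+-monoʳ-≤ (column s a) (size-pred (a ∷ s) v≢0 p∈v
    (λ { (here p≡a) → p∉v (here p≡a) ; (there p∈s) → p∉s p∈s }) (λ p∈v → p∉v (there p∈v))))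
  where
  exchange : Sees (pred p ∷ a ∷ s) (a ∷ pred p ∷ s)
  exchange (here x≡p)          = there (here x≡p)
  exchange (there (here x≡a))  = here x≡a
  exchange (there (there x∈s)) = there (there x∈s)

-- The two rotations that the recursion for U descends along.
degree-pred-< : ∀ {k} {v : Vec ℕ k} {p z} → All NonZero v → NonZero z → p ∈ v → pred p ∉ v →
                degree (pred p ∷ v) ℕ.< degree (v ∷ʳ z)
degree-pred-< {v = v} {p} v≢0 z≢0 p∈v p∉v = ℕ.≤-trans (s≤s (ℕ.≤-trans
  (ℕ.≤-reflexive (≡.cong (ℕ._+ size (pred p ∷ []) v) (column-new [] {pred p} λ ())))
  (size-pred [] v≢0 p∈v (λ ()) p∉v))) (size-∷ʳ [] v z≢0)

degree-rotate-< : ∀ {k} {v : Vec ℕ k} {z} → All NonZero v → NonZero z → pred z ∉ v →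
                  degree (pred z ∷ v) ℕ.< degree (v ∷ʳ z)
degree-rotate-< {v = v} {z} v≢0 z≢0 z∉v = ℕ.≤-trans (ℕ.≤-trans (s≤s
    (ℕ.≤-trans (ℕ.≤-reflexive (≡.cong (ℕ._+ size (pred z ∷ []) v) (column-new [] {pred z} λ ())))
      (ℕ.+-monoʳ-≤ (pred z) (size-antitone {s = []} v≢0 (λ ())))))
    (ℕ.≤-reflexive (≡.cong (ℕ._+ size [] v) (ℕ.suc-pred z {{z≢0}}))))
  (size-∷ʳ-new [] v (λ ()) z∉v)

-- In the excluded case, b directly below a, the swap would raise the degree. There the gap is 1,
-- and the seminormal form gives the swapped tuple the coefficient 1 - 1 = 0.
degree-swap-≤ : ∀ {k} {v : Vec ℕ k} {a b} → NonZero a → All NonZero v → pred b ≢ a →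
                degree (b ∷ a ∷ v) ℕ.≤ degree (a ∷ b ∷ v)
degree-swap-≤ {v = v} {a} {b} a≢0 v≢0 b≢suca = ℕ.≤-trans
  (ℕ.≤-reflexive (≡.cong (ℕ._+ (column (b ∷ []) a ℕ.+ size (a ∷ b ∷ []) v)) (column-new [] {b} λ ())))
  (ℕ.≤-trans (ℕ.+-monoʳ-≤ b (ℕ.+-mono-≤ (column-≤ (b ∷ []) a≢0) (size-antitone {s = b ∷ a ∷ []} v≢0 exchange)))
  (ℕ.≤-trans (ℕ.≤-reflexive (≡.trans (≡.sym (ℕ.+-assoc b a _)) (≡.trans
      (≡.cong (ℕ._+ size (b ∷ a ∷ []) v) (ℕ.+-comm b a)) (ℕ.+-assoc a b _))))
  (ℕ.≤-reflexive (≡.cong₂ (λ x y → x ℕ.+ (y ℕ.+ size (b ∷ a ∷ []) v)) (≡.sym (column-new [] {a} λ ()))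
    (≡.sym (column-new (a ∷ []) {b} λ { (here b≡suca) → b≢suca b≡suca }))))))
  where
  exchange : Sees (b ∷ a ∷ []) (a ∷ b ∷ [])
  exchange (here x≡b)         = there (here x≡b)
  exchange (there (here x≡a)) = here x≡a

-- The tableau side, the color side and U

module Tableaux (K : CommutativeRing 0ℓ 0ℓ) (fromℚ : ℚ → CommutativeRing.Carrier K)
                (algebra : RationalAlgebra K fromℚ) (inverses : IntegerInverses K)
                (fromℚ-ratio : ∀ n → CommutativeRing._≈_ K (fromℚ (ratio n)) (IntegerInverses.num inverses n))
                (e e⁻¹ : ℕ → CommutativeRing.Carrier K)
                (e*e⁻¹ : ∀ j → CommutativeRing._≈_ K (CommutativeRing._*_ K (e j) (e⁻¹ j)) (CommutativeRing.1# K))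
                (e-0 : CommutativeRing._≈_ K (e 0) (CommutativeRing.1# K)) where

  open CommutativeRing K hiding (zero)
  open RingProperties ring
  open SetoidReasoning setoid
  open RationalAlgebra algebra
  open IntegerInverses inverses
  open Residues K inverses
  open Interpolation K inverses hiding (V; W; module S⁺; module S⁻)
  open Linear K
  open Maps K fromℚ e e⁻¹
  open Solver using (solve; _:=_; _:*_; _:+_; _:-_; :-_)
  open ℤSolver.+-*-Solver using () renaming
    (solve to solveℤ; _:=_ to _:≡_; _:+_ to _⊹_; _:-_ to _⊖_; con to con′)

  infix 4 _≋ⱽ_ _≋ᶠ_
  _≋ⱽ_ : ∀ {k} → V.Combination k → V.Combination k → Set
  _≋ⱽ_ {k} = V._≋_ k

  _≋ᶠ_ : ∀ {k} → F.Combination k → F.Combination k → Set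
  _≋ᶠ_ {k} = F._≋_ k

  infixr 7 _·ⱽ_ _·ᶠ_
  _·ⱽ_ : ∀ {k} → Carrier → V.Combination k → V.Combination k
  _·ⱽ_ {k} = V._·_ k

  _·ᶠ_ : ∀ {k} → Carrier → F.Combination k → F.Combination k
  _·ᶠ_ {k} = F._·_ k

  -- The rows below which a box can be added, row 0 standing for the top of a new column.
  infix 9 _⁺
  _⁺ : ∀ {k} → Vec ℕ k → Vec ℕ (suc k)
  v ⁺ = 0 ∷ v

  difference-nonzero : ∀ {a b} → a ≢ b → + a ℤ.- + b ≢ 0ℤ
  difference-nonzero a≢b z = a≢b (ℤ.+-injective (ℤ.i-j≡0⇒i≡j _ _ z))

  -- The numbers A as values of G

  fromℚ-∏ : ∀ {n} (v : Vec ℕ n) w (f : Fin n → ℚ) →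
            (∀ i → fromℚ (f i) ≈ factor 1# w (lookup v i)) → fromℚ (∏.sum f) ≈ g v w
  fromℚ-∏ []      w f eq = fromℚ-1
  fromℚ-∏ (b ∷ v) w f eq = trans (fromℚ-* _ _)
    (*-cong (eq zero) (fromℚ-∏ v w (λ i → f (suc i)) (λ i → eq (suc i))))

  nonZero⇒≢0 : ∀ {n} → NonZero n → + n ≢ 0ℤ
  nonZero⇒≢0 {n} n≢0 n≡0 = ℕ.≢-nonZero⁻¹ n {{n≢0}} (ℤ.+-injective n≡0)

  fromℚ-÷ : ∀ p q n .{{_ : ℚ.NonZero q}} → n ≢ 0ℤ → q ≡ ratio n → fromℚ (p ÷ q) ≈ fromℚ p * r n
  fromℚ-÷ p q n n≢0 ≡.refl = trans (fromℚ-* p _) (*-congˡ (r-unique n≢0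
    (trans (*-congʳ (sym (fromℚ-ratio n))) (trans (sym (fromℚ-* q _))
      (trans (reflexive (≡.cong fromℚ (ℚ.*-inverseʳ q))) fromℚ-1)))))

  shift-quotient : ∀ q {n} p → p ≡ q ℚ.+ ratio n → n ≢ 0ℤ → fromℚ p * r n ≈ 1# + fromℚ q * r n
  shift-quotient q {n} p eq n≢0 = begin
    fromℚ p * r n                       ≈⟨ *-congʳ (trans (reflexive (≡.cong fromℚ eq))
                                             (trans (fromℚ-+ q _) (+-congˡ (fromℚ-ratio n)))) ⟩
    (fromℚ q + num n) * r n             ≈⟨ trans (distribʳ _ _ _) (+-comm _ _) ⟩
    num n * r n + fromℚ q * r n         ≈⟨ +-congʳ (num*r n≢0) ⟩
    1# + fromℚ q * r n                  ∎

  factor-value : ∀ q p n (x : Carrier) .{{_ : ℚ.NonZero q}} → n ≢ 0ℤ → q ≡ ratio n →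
                 p ≡ 1ℚ ℚ.+ q → r n ≈ x → fromℚ (p ÷ q) ≈ 1# + 1# * x
  factor-value q p n x n≢0 ≡.refl p≡ r≈x = trans (fromℚ-÷ p q n n≢0 ≡.refl)
    (trans (shift-quotient 1ℚ p p≡ n≢0) (+-congˡ (*-cong fromℚ-1 r≈x)))

  module _ {k : ℕ} (σ : I k) where

    private
      v = entries σ

    entry-positive : ∀ i → NonZero (lookup v i)
    entry-positive i = All.lookup (Good.positive (entries-good σ)) (∈-lookup i v)

    -- Gives a name to the factors inside the body of `A-one`; unification reads them off from
    -- reflexivity.
    A-one-factors : ∃ λ f → A-one σ ≡ ∏.sum {k} f
    A-one-factors = _ , ≡.refl

    A-one-factor : ∀ i → fromℚ (proj₁ A-one-factors i) ≈ factor 1# 0ℤ (lookup v i)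
    A-one-factor i = trans (fromℚ-÷ _ _ (+ s) {{ι-nonZero (entry-positive i)}} s≢0 ≡.refl) (begin
      fromℚ (ι s ℚ.- 1ℚ) * r (+ s)
        ≈⟨ shift-quotient (ℚ.- 1ℚ) _ (ℚ.+-comm (ι s) (ℚ.- 1ℚ)) s≢0 ⟩
      1# + fromℚ (ℚ.- 1ℚ) * r (+ s)
        ≈⟨ +-congˡ (*-congʳ (trans (fromℚ-- 1ℚ) (-‿cong fromℚ-1))) ⟩
      1# + - 1# * r (+ s)
        ≈⟨ +-congˡ (trans (sym (-‿distribˡ-* _ _)) (-‿distribʳ-* _ _)) ⟩
      1# + 1# * - r (+ s)
        ≈⟨ +-congˡ (*-congˡ (trans (sym (r-neg (+ s))) (r-cong (≡.sym (ℤ.+-identityˡ _))))) ⟩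
      1# + 1# * r (0ℤ ℤ.- + s) ∎)
      where
      s = lookup v i
      s≢0 = nonZero⇒≢0 (entry-positive i)

    -- Once row 0 is counted as a pole, y = 1 is the case a = 0 of y = a + 1, and both formulas for
    -- A become residues of the same G.
    A-one≈g : fromℚ (A-one σ) ≈ g (v ⁺) 0ℤ
    A-one≈g = trans (fromℚ-∏ v 0ℤ _ A-one-factor)
      (sym (trans (*-congʳ (factor-self 1# 0)) (*-identityˡ _)))

    module _ (i : Fin k) where

      private
        s = lookup v i
        s≢0 = nonZero⇒≢0 (entry-positive i)

        head-factor : ℚ
        head-factor = _÷_ (ι s ℚ.+ 1ℚ) (ι s) {{ι-nonZero (entry-positive i)}}

      A-succ-factors : ∃ λ f → A-succ σ i ≡ head-factor ℚ.* ∏.sum {k} f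
      A-succ-factors = _ , ≡.refl

      A-succ-head : fromℚ head-factor ≈ factor 1# (+ s) 0
      A-succ-head = factor-value (ι s) (ι s ℚ.+ 1ℚ) (+ s) (s ⊘ 0)
        {{ι-nonZero (entry-positive i)}} s≢0 ≡.refl
        (ℚ.+-comm (ι s) 1ℚ) (r-cong (≡.sym (ℤ.+-identityʳ (+ s))))

      A-succ-factor : ∀ j → fromℚ (proj₁ A-succ-factors j) ≈ factor 1# (+ s) (lookup v j)
      A-succ-factor j with j Fin.≟ i
      ... | yes ≡.refl = trans fromℚ-1 (sym (factor-self 1# s))
      ... | no j≢i     = factor-value (ι s ℚ.- ι t) (ι s ℚ.- ι t ℚ.+ 1ℚ) (+ s ℤ.- + t) (s ⊘ t)
        {{ι-difference-nonZero s≢t}} (difference-nonzero s≢t)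
        (≡.sym (≡.trans (ratio-+ (+ s) (ℤ.- + t)) (≡.cong (ι s ℚ.+_) (ratio-- (+ t)))))
        (ℚ.+-comm (ι s ℚ.- ι t) 1ℚ) refl
        where
        t = lookup v j
        s≢t : s ≢ t
        s≢t s≡t = j≢i (≡.sym (lookup-injective (Good.distinct (entries-good σ)) i j s≡t))

      A-succ≈g : fromℚ (A-succ σ i) ≈ g (v ⁺) (+ s)
      A-succ≈g = trans (fromℚ-* _ _) (*-cong A-succ-head (fromℚ-∏ v (+ s) _ A-succ-factor))

  -- Operators on tableaux through their transposes

  module _ {l : ℕ} where

    pair-sum : ∀ φ {n} (v : Vec ℕ n) (f : Fin n → V.Combination l) (χ : ℕ → Carrier) →
               (∀ i → V.pair l φ (f i) ≈ χ (lookup v i)) → V.pair l φ (VSum.sum l f) ≈ ∑ v χ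
    pair-sum φ []      f χ eq = refl
    pair-sum φ (a ∷ v) f χ eq = trans (V.pair-++ l φ (f zero) _)
      (+-cong (eq zero) (pair-sum φ v (λ i → f (suc i)) χ (λ i → eq (suc i))))

  -- Relations between operators are verified for their transposes. Functionals live on all vectors
  -- of naturals, valid or not, so that `M*` is a plain sum over all rows a; where `suc a` is
  -- already an entry, the coefficient is zero by `g-taken`.
  Functional : ℕ → Set
  Functional k = Vec ℕ k → Carrier

  restrict : ∀ {k} → Functional k → I k → Carrier
  restrict φ σ = φ (entries σ)

  M* : ∀ {k} → Functional (suc k) → Functional k
  M* φ v = ∑ (v ⁺) λ a → g (v ⁺) (+ a) * φ (v ∷ʳ suc a)

  ε : ℕ → Carrier
  ε s = e s * e⁻¹ (pred s)

  D* : ∀ {k} → Functional k → Functional (suc k)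
  D* φ (s ∷ v) = ε s * φ v

  -- For gap 1 the coefficients are 1 and 0: a box directly below the preceding one cannot change
  -- places with it.
  S* : ∀ {k} → Fin (suc k) → Functional (suc (suc k)) → Functional (suc (suc k))
  S* i φ v = r (gap i v) * φ v + (1# - r (gap i v)) * φ (swap i v)

  M-basis : ∀ {k} → I k → V.Combination (suc k)
  M-basis {k} σ = M-term σ 1 (A-one σ)
    ++ VSum.sum (suc k) (λ i → M-term σ (suc (lookup (entries σ) i)) (A-succ σ i))

  D-basis : ∀ {k} → I (suc k) → V.Combination k
  D-basis {k} σ = ε (head (entries σ)) ·ⱽ b (dropFirst σ)

  S-basis : ∀ {k} → Fin (suc k) → I (suc (suc k)) → V.Combination (suc (suc k))
  S-basis {k} i σ = r (gap i (entries σ)) ·ⱽ b σ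
    ++ (1# - r (gap i (entries σ))) ·ⱽ b (swapI i σ)

  S : ∀ {k} → Fin (suc k) → V.Combination (suc (suc k)) → V.Combination (suc (suc k))
  S {k} i = extend K (I-decSetoid (suc (suc k))) (I-decSetoid (suc (suc k))) (S-basis i)

  record Adjoint {k l} (T : V.Combination k → V.Combination l) (T* : Functional l → Functional k) : Set where
    constructor mkAdjoint
    field adjoint : ∀ φ v → V.pair l (restrict φ) (T v) ≈ V.pair k (restrict (T* φ)) v
  open Adjoint

  pair-M-term : ∀ {k} φ (σ : I k) y .{{_ : NonZero y}} a x → fromℚ a ≈ x → (y ∈ entries σ → x ≈ 0#) →
                V.pair (suc k) (restrict φ) (M-term σ y a) ≈ x * φ (entries σ ∷ʳ y)
  pair-M-term {k} φ σ y a x a≈x x≈0 with y ∈? entries σ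
  ... | yes y∈σ = sym (trans (*-congʳ (x≈0 y∈σ)) (zeroˡ _))
  ... | no  _   = trans (+-identityʳ _) (*-congʳ (trans (*-identityʳ _) a≈x))

  M-adjoint : ∀ {k} → Adjoint (M {k}) M*
  M-adjoint {k} = mkAdjoint λ φ v → trans (pair-extend (I-decSetoid k) (I-decSetoid (suc k)) (restrict φ) M-basis v)
    (V.pair-φ k v λ σ → trans (V.pair-++ (suc k) (restrict φ) (M-term σ 1 (A-one σ)) _) (+-cong
      (pair-M-term φ σ 1 (A-one σ) _ (A-one≈g σ) (λ 1∈σ → g-taken {S = (entries σ) ⁺} {0} (there 1∈σ)))
      (pair-sum (restrict φ) (entries σ) _ (λ a → g ((entries σ) ⁺) (+ a) * φ (entries σ ∷ʳ suc a)) λ i →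
        pair-M-term φ σ (suc (lookup (entries σ) i)) (A-succ σ i) _ (A-succ≈g σ i)
          (λ s∈σ → g-taken {S = (entries σ) ⁺} {lookup (entries σ) i} (there s∈σ)))))

  D-adjoint : ∀ {k} → Adjoint (D {k}) D*
  D-adjoint {k} = mkAdjoint λ φ v → trans (pair-extend (I-decSetoid (suc k)) (I-decSetoid k) (restrict φ) D-basis v)
    (V.pair-φ (suc k) v λ { (tuple (s ∷ σ) _ _) →
      trans (+-identityʳ _) (*-congʳ (*-identityʳ _)) })

  S-adjoint : ∀ {k} (i : Fin (suc k)) → Adjoint (S i) (S* i)
  S-adjoint {k} i = mkAdjoint λ φ v → trans (pair-extend (I-decSetoid (suc (suc k))) (I-decSetoid (suc (suc k))) (restrict φ) (S-basis i) v)
    (V.pair-φ (suc (suc k)) v λ σ → +-cong (*-congʳ (*-identityʳ _))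
      (trans (+-identityʳ _) (*-congʳ (*-identityʳ _))))

  ++-adjoint : ∀ {k l} {T U : V.Combination k → V.Combination l} {T* U*} → Adjoint T T* → Adjoint U U* →
               Adjoint (λ v → T v ++ U v) (λ φ w → T* φ w + U* φ w)
  ++-adjoint {k} {l} {T} {U} T-adjoint U-adjoint = mkAdjoint λ φ v → trans (V.pair-++ l (restrict φ) (T v) (U v))
    (trans (+-cong (adjoint T-adjoint φ v) (adjoint U-adjoint φ v)) (sym (V.pair-+ k _ _ v)))

  ·-adjoint : ∀ {k l} {T : V.Combination k → V.Combination l} {T*} a → Adjoint T T* →
              Adjoint (λ v → a ·ⱽ T v) (λ φ w → a * T* φ w)
  ·-adjoint {k} {l} {T} a T-adjoint = mkAdjoint λ φ v → trans (V.pair-· l (restrict φ) a (T v))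
    (trans (*-congˡ (adjoint T-adjoint φ v)) (sym (V.pair-* k a _ v)))

  ∘-adjoint : ∀ {k l m} {T : V.Combination l → V.Combination m} {U : V.Combination k → V.Combination l} {T* U*} →
              Adjoint T T* → Adjoint U U* → Adjoint (λ v → T (U v)) (λ φ → U* (T* φ))
  ∘-adjoint {T* = T*} T-adjoint U-adjoint = mkAdjoint λ φ v →
    trans (adjoint T-adjoint φ _) (adjoint U-adjoint (T* φ) v)

  id-adjoint : ∀ {k} → Adjoint {k} (λ v → v) (λ φ → φ)
  id-adjoint = mkAdjoint λ φ v → refl

  module _ {k : ℕ} (σ : I k) where

    indicator : Functional k
    indicator w = value (Vec.≡-dec ℕ._≟_ (entries σ) w)
      where
      value : ∀ {w} → Dec (entries σ ≡ w) → Carrier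
      value (yes _) = 1#
      value (no _)  = 0#

    indicator≈δ : ∀ τ → restrict indicator τ ≈ V.δ k σ τ
    indicator≈δ τ with Vec.≡-dec ℕ._≟_ (entries σ) (entries τ)
    ... | yes _ = refl
    ... | no  _ = refl

  ≋-from-functionals : ∀ {k} {v w : V.Combination k} →
                       (∀ φ → V.pair k (restrict φ) v ≈ V.pair k (restrict φ) w) → v ≋ⱽ w
  ≋-from-functionals {k} {v} {w} eq = V.mk≋ λ σ → trans (sym (V.pair-φ k v (indicator≈δ σ)))
    (trans (eq (indicator σ)) (V.pair-φ k w (indicator≈δ σ)))

  ≋-from-adjoints : ∀ {k l} {T U : V.Combination k → V.Combination l} {T* U*} → Adjoint T T* → Adjoint U U* →
                    (∀ φ v → Good v → T* φ v ≈ U* φ v) → ∀ v → T v ≋ⱽ U v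
  ≋-from-adjoints {k} T-adjoint U-adjoint eq v = ≋-from-functionals λ φ → trans (adjoint T-adjoint φ v)
    (trans (V.pair-φ k v λ σ → eq φ (entries σ) (entries-good σ)) (sym (adjoint U-adjoint φ v)))

  M-linear : ∀ {k} → IsLinear (V k) (V (suc k)) M
  M-linear {k} = extend-linear (I-decSetoid k) (I-decSetoid (suc k)) {M-basis} λ { ≡.refl → V.≋.≈ᴹ-refl (suc k) }

  D-linear : ∀ {k} → IsLinear (V (suc k)) (V k) D
  D-linear {k} = extend-linear (I-decSetoid (suc k)) (I-decSetoid k) {D-basis} λ { ≡.refl → V.≋.≈ᴹ-refl k }

  S-linear : ∀ {k} (i : Fin (suc k)) → IsLinear (V (suc (suc k))) (V (suc (suc k))) (S i)
  S-linear {k} i = extend-linear (I-decSetoid (suc (suc k))) (I-decSetoid (suc (suc k))) {S-basis i}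
    λ { ≡.refl → V.≋.≈ᴹ-refl (suc (suc k)) }

  -- Relations between M, D and the transpositions

  ∑-permute : ∀ {k} (i : Fin (suc k)) v (f : ℕ → Carrier) → ∑ (swap i v) f ≈ ∑ v f
  ∑-permute             zero    (a ∷ b ∷ v) f =
    solve 3 (λ a b c → b :+ (a :+ c) := a :+ (b :+ c)) refl (f a) (f b) (∑ v f)
  ∑-permute {k = suc k} (suc i) (a ∷ v)     f = +-congˡ (∑-permute i v f)

  G-permute : ∀ {k} (i : Fin (suc k)) v x w → G x (swap i v) w ≈ G x v w
  G-permute             zero    (a ∷ b ∷ v) x w =
    solve 3 (λ a b c → b :* (a :* c) := a :* (b :* c)) refl (factor x w a) (factor x w b) (G x v w)
  G-permute {k = suc k} (suc i) (a ∷ v)     x w = *-congˡ (G-permute i v x w)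

  G-∷ʳ : ∀ {k} (v : Vec ℕ k) y x w → G x (v ∷ʳ y) w ≈ G x v w * factor x w y
  G-∷ʳ []      y x w = *-comm _ _
  G-∷ʳ (a ∷ v) y x w = trans (*-congˡ (G-∷ʳ v y x w)) (sym (*-assoc _ _ _))

  S-M-commute : ∀ {k} (i : Fin (suc k)) (v : V.Combination (suc (suc k))) →
                S (inject₁ i) (M v) ≋ⱽ M (S i v)
  S-M-commute i = ≋-from-adjoints
    (∘-adjoint (S-adjoint (inject₁ i)) M-adjoint)
    (∘-adjoint M-adjoint (S-adjoint i)) λ φ v _ →
    let γ = r (gap i v)
        c = λ a → g (v ⁺) (+ a)
        term : ∀ a → c a * S* (inject₁ i) φ (v ∷ʳ suc a)
                     ≈ γ * (c a * φ (v ∷ʳ suc a)) + (1# - γ) * (c a * φ (swap i v ∷ʳ suc a))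
        term a = trans (*-congˡ (+-cong (*-congʳ (r-cong (gap-∷ʳ i v (suc a))))
            (*-cong (+-congˡ (-‿cong (r-cong (gap-∷ʳ i v (suc a)))))
              (reflexive (≡.cong φ (swap-∷ʳ i v (suc a)))))))
          (solve 4 (λ c γ x y → c :* (γ :* x :+ (:1 :- γ) :* y)
            := γ :* (c :* x) :+ (:1 :- γ) :* (c :* y)) refl (c a) γ _ _)
    in begin
    M* (S* (inject₁ i) φ) v
      ≈⟨ ∑-cong (v ⁺) (λ {a} _ → term a) ⟩
    (∑ (v ⁺) λ a → γ * (c a * φ (v ∷ʳ suc a)) + (1# - γ) * (c a * φ (swap i v ∷ʳ suc a)))
      ≈⟨ trans (∑-+ (v ⁺) _ _) (+-cong (∑-*ˡ (v ⁺) _ _) (∑-*ˡ (v ⁺) _ _)) ⟩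
    γ * M* φ v + (1# - γ) * (∑ (v ⁺) λ a → c a * φ (swap i v ∷ʳ suc a))
      ≈⟨ +-congˡ (*-congˡ (sym (trans
           (∑-cong ((swap i v) ⁺) (λ {a} _ → *-congʳ (*-congˡ (G-permute i v 1# (+ a)))))
           (+-congˡ (∑-permute i v _))))) ⟩
    S* i (M* φ) v ∎

  S-D-commute : ∀ {k} (i : Fin (suc k)) (v : V.Combination (suc (suc (suc k)))) →
                S i (D v) ≋ⱽ D (S (suc i) v)
  S-D-commute i = ≋-from-adjoints
    (∘-adjoint (S-adjoint i) D-adjoint)
    (∘-adjoint D-adjoint (S-adjoint (suc i))) λ { φ (s ∷ v) _ →
    solve 4 (λ c γ x y → c :* (γ :* x :+ (:1 :- γ) :* y)
      := γ :* (c :* x) :+ (:1 :- γ) :* (c :* y)) refl _ _ _ _ }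

  S-involutive : ∀ {k} (i : Fin (suc k)) (v : V.Combination (suc (suc k))) →
                 S i (S i v) ≋ⱽ v
  S-involutive i = ≋-from-adjoints
    (∘-adjoint (S-adjoint i) (S-adjoint i)) id-adjoint λ φ v _ →
    let γ = r (gap i v)
        γ′≈ = trans (r-cong (gap-swap i v)) (r-neg (gap i v))
    in begin
    γ * S* i φ v + (1# - γ) * S* i φ (swap i v)
      ≈⟨ +-congˡ (*-congˡ (+-cong (*-congʳ γ′≈) (*-cong (+-congˡ (-‿cong γ′≈))
           (reflexive (≡.cong φ (swap-involutive i v)))))) ⟩
    γ * (γ * φ v + (1# - γ) * φ (swap i v)) + (1# - γ) * (- γ * φ (swap i v) + (1# - - γ) * φ v)
      ≈⟨ solve 3 (λ γ x y → γ :* (γ :* x :+ (:1 :- γ) :* y)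
           :+ (:1 :- γ) :* ((:- γ) :* y :+ (:1 :- (:- γ)) :* x) := x) refl γ _ _ ⟩
    φ v ∎

  D-D-symmetric : ∀ {k} (v : V.Combination (suc (suc k))) → D (D (S zero v)) ≋ⱽ D (D v)
  D-D-symmetric = ≋-from-adjoints
    (∘-adjoint (∘-adjoint D-adjoint D-adjoint) (S-adjoint zero))
    (∘-adjoint D-adjoint D-adjoint) λ { φ (s ∷ t ∷ v) _ →
    solve 4 (λ γ s t x → γ :* (s :* (t :* x)) :+ (:1 :- γ) :* (t :* (s :* x)) := s :* (t :* x))
      refl _ _ _ _ }

  -- The factor by which the residue of G at a changes when b joins the tuple.
  κ : ℕ → ℕ → Carrier
  κ a b = factor 1# (+ a) b

  κ-value : ∀ a b → κ a b ≈ 1# + (a ⊘ b)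
  κ-value a b = +-congˡ (*-identityˡ _)

  κ-flip : ∀ a b → κ a b ≈ 1# - (b ⊘ a)
  κ-flip a b = trans (κ-value a b) (+-congˡ (r-flip (+ a) (+ b)))

  module _ {k : ℕ} where

    ∑-insert : ∀ t (v : Vec ℕ k) (x : ℕ → Carrier) →
               (∑ ((t ∷ v) ⁺) λ a → g ((t ∷ v) ⁺) (+ a) * x a)
               ≈ g (v ⁺) (+ t) * x t + ∑ (v ⁺) λ a → κ a t * g (v ⁺) (+ a) * x a
    ∑-insert t v x = begin
      term 0 + (term t + ∑ v term)
        ≈⟨ solve 3 (λ x y z → x :+ (y :+ z) := y :+ (x :+ z)) refl (term 0) (term t) (∑ v term) ⟩
      term t + (term 0 + ∑ v term)
        ≈⟨ +-cong (*-congʳ (trans (*-congˡ (trans (*-congʳ (factor-self 1# t)) (*-identityˡ _))) refl))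
                  (∑-cong (v ⁺) λ {a} _ → *-congʳ (solve 3 (λ x y z → x :* (y :* z) := y :* (x :* z))
                    refl (κ a 0) (κ a t) (g v (+ a)))) ⟩
      g (v ⁺) (+ t) * x t + (∑ (v ⁺) λ a → κ a t * g (v ⁺) (+ a) * x a) ∎
      where
      term : ℕ → Carrier
      term a = g ((t ∷ v) ⁺) (+ a) * x a

    g-insert : ∀ t (v : Vec ℕ k) s → g ((t ∷ v) ⁺) (+ s) ≈ κ s t * g (v ⁺) (+ s)
    g-insert t v s = solve 3 (λ x y z → x :* (y :* z) := y :* (x :* z)) refl _ _ _

    M*-∷ʳ : ∀ φ (v : Vec ℕ k) y → M* φ (v ∷ʳ y)
            ≈ (∑ (v ⁺) λ b → g (v ⁺) (+ b) * κ b y * φ (v ∷ʳ y ∷ʳ suc b))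
              + g (v ⁺) (+ y) * φ (v ∷ʳ y ∷ʳ suc y)
    M*-∷ʳ φ v y = trans (∑-∷ʳ (v ⁺) y _) (+-cong
      (∑-cong (v ⁺) λ {b} _ → *-congʳ (G-∷ʳ (v ⁺) y 1# (+ b)))
      (*-congʳ (trans (G-∷ʳ (v ⁺) y 1# (+ y)) (trans (*-congˡ (factor-self 1# y)) (*-identityʳ _)))))

  -- Coefficients of φ(v, a + 1) are compared after removing the common factor ε s ε t. For a = s
  -- and a = t they agree because 1 - γ = κ s t and 1 + γ = κ t s, where γ = 1/(t - s). For the
  -- other rows the claim is (1 + γ) κ a t + (1 - γ) κ a s = 1 + κ a t κ a s, which follows from
  -- splitting 1/((s - a)(a - t)).
  D-M-D : ∀ {k} (v : V.Combination (suc (suc k))) →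
          D (M (D v)) ++ D (M (D (S zero v))) ≋ⱽ M (D (D v)) ++ D (D (M v))
  D-M-D {k} = ≋-from-adjoints
    (++-adjoint DMD (∘-adjoint DMD (S-adjoint zero)))
    (++-adjoint (∘-adjoint M-adjoint (∘-adjoint D-adjoint D-adjoint))
                (∘-adjoint (∘-adjoint D-adjoint D-adjoint) M-adjoint))
    λ { φ (s ∷ t ∷ v) stv → identity φ s t v stv }
    where
    DMD : Adjoint (λ v → D (M (D v))) (λ φ → D* (M* (D* φ)))
    DMD = ∘-adjoint D-adjoint (∘-adjoint M-adjoint D-adjoint)
    identity : ∀ φ s t (v : Vec ℕ k) → Good (s ∷ t ∷ v) →
               D* (M* (D* φ)) (s ∷ t ∷ v) + S* zero (D* (M* (D* φ))) (s ∷ t ∷ v)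
               ≈ D* (D* (M* φ)) (s ∷ t ∷ v) + M* (D* (D* φ)) (s ∷ t ∷ v)
    identity φ s t v st-good = begin
      ε s * M* (D* φ) (t ∷ v) + (γ * (ε s * M* (D* φ) (t ∷ v)) + (1# - γ) * (ε t * M* (D* φ) (s ∷ v)))
        ≈⟨ +-cong (*-congˡ (row t)) (+-cong (*-congˡ (*-congˡ (row t))) (*-congˡ (*-congˡ (row s)))) ⟩
      ε s * (ε t * (c t * x t + ∑₁ t)) + (γ * (ε s * (ε t * (c t * x t + ∑₁ t))) + (1# - γ) * (ε t * (ε s * (c s * x s + ∑₁ s))))
        ≈⟨ solve 9 (λ p q γ a b A c d B → p :* (q :* (a :* b :+ A)) :+ (γ :* (p :* (q :* (a :* b :+ A)))
             :+ (:1 :- γ) :* (q :* (p :* (c :* d :+ B))))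
             := p :* q :* ((:1 :+ γ) :* (a :* b) :+ (:1 :- γ) :* (c :* d)
                :+ ((:1 :+ γ) :* A :+ (:1 :- γ) :* B)))
             refl (ε s) (ε t) γ (c t) (x t) (∑₁ t) (c s) (x s) (∑₁ s) ⟩
      ε s * ε t * ((1# + γ) * (c t * x t) + (1# - γ) * (c s * x s) + ((1# + γ) * ∑₁ t + (1# - γ) * ∑₁ s))
        ≈⟨ *-congˡ (+-cong (+-cong (*-congʳ (sym (κ-value t s))) (*-congʳ (sym (κ-flip s t)))) sums) ⟩
      ε s * ε t * (κ t s * (c t * x t) + κ s t * (c s * x s) + (∑₀ + ∑₂))
        ≈⟨ solve 10 (λ p q a b x y c d z w → p :* q :* (a :* (c :* x) :+ b :* (d :* y) :+ (z :+ w))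
             := p :* (q :* z) :+ (b :* d :* (p :* (q :* y))
                :+ (c :* (a :* (p :* (q :* x))) :+ p :* (q :* w))))
             refl (ε s) (ε t) (κ t s) (κ s t) (x t) (x s) (c t) (c s) ∑₀ ∑₂ ⟩
      ε s * (ε t * ∑₀) + (κ s t * c s * (ε s * (ε t * x s))
        + (c t * (κ t s * (ε s * (ε t * x t))) + ε s * (ε t * ∑₂)))
        ≈⟨ +-congˡ (+-cong (*-congʳ (sym (g-insert t v s))) (+-congˡ (sym second-sum))) ⟩
      ε s * (ε t * ∑₀) + (g ((t ∷ v) ⁺) (+ s) * (ε s * (ε t * x s))
        + (c t * (κ t s * (ε s * (ε t * x t)))
           + (∑ (v ⁺) λ a → κ a t * c a * (κ a s * (ε s * (ε t * x a))))))
        ≈⟨ +-congˡ (+-congˡ (trans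
             (∑-cong ((t ∷ v) ⁺) (λ {a} _ → solve 3 (λ x y z → x :* y :* z := y :* (x :* z)) refl _ _ _))
             (∑-insert t v _))) ⟨
      ε s * (ε t * ∑₀) + (g ((t ∷ v) ⁺) (+ s) * (ε s * (ε t * x s))
        + (∑ ((t ∷ v) ⁺) λ a → κ a s * g ((t ∷ v) ⁺) (+ a) * (ε s * (ε t * x a))))
        ≈⟨ +-congˡ (∑-insert s (t ∷ v) _) ⟨
      D* (D* (M* φ)) (s ∷ t ∷ v) + M* (D* (D* φ)) (s ∷ t ∷ v) ∎
      where
      γ = (t ⊘ s)
      c x : ℕ → Carrier
      c a = g (v ⁺) (+ a)
      x a = φ (v ∷ʳ suc a)
      ∑₀ = ∑ (v ⁺) λ a → c a * x a
      ∑₁ : ℕ → Carrier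
      ∑₁ u = ∑ (v ⁺) λ a → κ a u * c a * x a
      ∑₂ = ∑ (v ⁺) λ a → κ a t * c a * (κ a s * x a)
      row : ∀ u → M* (D* φ) (u ∷ v) ≈ ε u * (c u * x u + ∑₁ u)
      row u = trans (∑-insert u v _) (trans
        (+-cong (solve 3 (λ c e x → c :* (e :* x) := e :* (c :* x)) refl _ _ _)
          (trans (∑-cong (v ⁺) (λ _ → solve 3 (λ c e x → c :* (e :* x) := e :* (c :* x)) refl _ _ _))
                 (∑-*ˡ (v ⁺) _ _)))
        (sym (distribˡ _ _ _)))
      second-sum : (∑ (v ⁺) λ a → κ a t * c a * (κ a s * (ε s * (ε t * x a)))) ≈ ε s * (ε t * ∑₂)
      second-sum = trans (∑-cong (v ⁺) (λ {a} _ → solve 6 (λ k c l p q x →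
          k :* c :* (l :* (p :* (q :* x))) := p :* q :* (k :* c :* (l :* x))) refl _ _ _ _ _ _))
        (trans (∑-*ˡ (v ⁺) _ _) (*-assoc _ _ _))
      t∉ = good-∉ (tail-good st-good)
      s∉ : s ∉ v ⁺
      s∉ (here s≡0)  = good-∉ st-good (here s≡0)
      s∉ (there s∈v) = good-∉ st-good (there (there s∈v))
      s≢t : s ≢ t
      s≢t s≡t = good-∉ st-good (there (here s≡t))
      sums : (1# + γ) * ∑₁ t + (1# - γ) * ∑₁ s ≈ ∑₀ + ∑₂
      sums = begin
        (1# + γ) * ∑₁ t + (1# - γ) * ∑₁ s
          ≈⟨ sym (trans (∑-+ (v ⁺) _ _) (+-cong (∑-*ˡ (v ⁺) _ _) (∑-*ˡ (v ⁺) _ _))) ⟩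
        (∑ (v ⁺) λ a → (1# + γ) * (κ a t * c a * x a) + (1# - γ) * (κ a s * c a * x a))
          ≈⟨ ∑-cong (v ⁺) pointwise ⟩
        (∑ (v ⁺) λ a → c a * x a + κ a t * c a * (κ a s * x a))
          ≈⟨ ∑-+ (v ⁺) _ _ ⟩
        ∑₀ + ∑₂ ∎
        where
        pointwise : ∀ {a} → a ∈ v ⁺ → (1# + γ) * (κ a t * c a * x a) + (1# - γ) * (κ a s * c a * x a)
                    ≈ c a * x a + κ a t * c a * (κ a s * x a)
        pointwise {a} a∈ = begin
          (1# + γ) * (κ a t * c a * x a) + (1# - γ) * (κ a s * c a * x a)
            ≈⟨ +-cong (*-congˡ (*-congʳ (*-congʳ at-t))) (*-congˡ (*-congʳ (*-congʳ at-s))) ⟩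
          (1# + γ) * ((1# + β) * c a * x a) + (1# - γ) * ((1# - α) * c a * x a)
            ≈⟨ solve 5 (λ γ α β c x → (:1 :+ γ) :* ((:1 :+ β) :* c :* x)
                 :+ (:1 :- γ) :* ((:1 :- α) :* c :* x)
                 := c :* x :+ (:1 :- α :+ β) :* c :* x :+ (γ :* (α :+ β)) :* c :* x)
               refl γ α β (c a) (x a) ⟩
          c a * x a + (1# - α + β) * c a * x a + (γ * (α + β)) * c a * x a
            ≈⟨ +-congˡ (*-congʳ (*-congʳ (sym split))) ⟩
          c a * x a + (1# - α + β) * c a * x a + (- (α * β)) * c a * x a
            ≈⟨ solve 4 (λ α β c x → c :* x :+ (:1 :- α :+ β) :* c :* x :+ (:- (α :* β)) :* c :* x
                 := c :* x :+ (:1 :+ β) :* c :* ((:1 :- α) :* x)) refl α β (c a) (x a) ⟩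
          c a * x a + (1# + β) * c a * ((1# - α) * x a)
            ≈⟨ +-congˡ (*-cong (*-congʳ (sym at-t)) (*-congʳ (sym at-s))) ⟩
          c a * x a + κ a t * c a * (κ a s * x a) ∎
          where
          α = (s ⊘ a)
          β = (a ⊘ t)
          at-t = κ-value a t
          at-s = κ-flip a s
          split : - (α * β) ≈ γ * (α + β)
          split = trans (-‿cong (r-split (+-≢ λ s≡a → s∉ (≡.subst (_∈ v ⁺) (≡.sym s≡a) a∈))
              (+-≢ λ a≡t → t∉ (≡.subst (_∈ v ⁺) a≡t a∈)) (+-≢ s≢t)))
            (trans (-‿distribˡ-* _ _) (*-congʳ (sym (r-flip (+ t) (+ s)))))

  κ-next : ∀ a → κ a (suc a) ≈ 0#
  κ-next a = trans (κ-value a (suc a)) (trans (+-congˡ (trans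
    (r-cong (solveℤ 1 (λ a → a ⊖ (con′ 1ℤ ⊹ a) :≡ con′ -1ℤ) ≡.refl (+ a))) r--1)) (-‿inverseʳ 1#))

  r-next : ∀ a → (suc a ⊘ a) ≈ 1#
  r-next a = trans (r-cong (solveℤ 1 (λ a → (con′ 1ℤ ⊹ a) ⊖ a :≡ con′ 1ℤ) ≡.refl (+ a))) r-1

  r-consecutive : ∀ {a b} → a ≢ b → suc a ≢ b →
                  (a ⊘ b) * (suc a ⊘ b) ≈ (a ⊘ b) - (suc a ⊘ b)
  r-consecutive {a} {b} a≢b suca≢b = begin
    x * y                 ≈⟨ solve 2 (λ x y → x :* y := y :* (:1 :+ x) :- y) refl x y ⟩
    y * (1# + x) - y      ≈⟨ +-congʳ (*-congˡ (+-congʳ (r-next a))) ⟨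
    y * ((suc a ⊘ a) + x) - y
                          ≈⟨ +-congʳ (r-split (+-≢ λ ()) (+-≢ a≢b) (+-≢ suca≢b)) ⟨
    (suc a ⊘ a) * x - y
                          ≈⟨ +-congʳ (trans (*-congʳ (r-next a)) (*-identityˡ x)) ⟩
    x - y                 ∎
    where
    x = (a ⊘ b)
    y = (suc a ⊘ b)

  -- As fractions, the factors are (b - a - 1)/(b - a) and (b - a)/(b - a - 1).
  κ-inverse : ∀ {a b} → b ≢ a → b ≢ suc a → (1# - (b ⊘ a)) * κ b (suc a) ≈ 1#
  κ-inverse {a} {b} b≢a b≢suca = begin
    (1# - (b ⊘ a)) * κ b (suc a)
      ≈⟨ *-cong (+-congˡ (sym (r-flip (+ a) (+ b)))) (κ-flip b (suc a)) ⟩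
    (1# + x) * (1# - y)
      ≈⟨ solve 2 (λ x y → (:1 :+ x) :* (:1 :- y) := :1 :+ (x :- y) :- x :* y) refl x y ⟩
    1# + (x - y) - x * y
      ≈⟨ +-congˡ (-‿cong (r-consecutive (λ a≡b → b≢a (≡.sym a≡b)) (λ a≡b → b≢suca (≡.sym a≡b)))) ⟩
    1# + (x - y) - (x - y)
      ≈⟨ solve 1 (λ z → :1 :+ z :- z := :1) refl (x - y) ⟩
    1# ∎
    where
    x = (a ⊘ b)
    y = (suc a ⊘ b)

  module _ {k : ℕ} (v : Vec ℕ k) where

    private
      c : ℕ → Carrier
      c a = g (v ⁺) (+ a)

    Φ : Functional (suc (suc k)) → ℕ → ℕ → Carrier
    Φ φ a b = φ (v ∷ʳ suc a ∷ʳ suc b)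

    ∑₂ : (ℕ → ℕ → Carrier) → Carrier
    ∑₂ f = ∑ (v ⁺) λ a → ∑ (v ⁺) λ b → f a b

    ∑₂-cong : ∀ {f f′ : ℕ → ℕ → Carrier} → (∀ {a b} → a ∈ v ⁺ → b ∈ v ⁺ → f a b ≈ f′ a b) →
              ∑₂ f ≈ ∑₂ f′
    ∑₂-cong eq = ∑-cong (v ⁺) λ a∈ → ∑-cong (v ⁺) λ b∈ → eq a∈ b∈

    ∑₂-+ : ∀ (f f′ : ℕ → ℕ → Carrier) → ∑₂ (λ a b → f a b + f′ a b) ≈ ∑₂ f + ∑₂ f′
    ∑₂-+ f f′ = trans (∑-cong (v ⁺) λ _ → ∑-+ (v ⁺) _ _) (∑-+ (v ⁺) _ _)

    S*-last : ∀ φ a b → Φ (S* (fromℕ k) φ) a b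
              ≈ (b ⊘ a) * Φ φ a b + (1# - (b ⊘ a)) * Φ φ b a
    S*-last φ a b = +-cong (*-congʳ γ≈) (*-cong (+-congˡ (-‿cong γ≈))
      (reflexive (≡.cong φ (swap-last v (suc a) (suc b)))))
      where
      γ≈ : r (gap (fromℕ k) (v ∷ʳ suc a ∷ʳ suc b)) ≈ (b ⊘ a)
      γ≈ = r-cong (≡.trans (gap-last v (suc a) (suc b))
        (solveℤ 2 (λ a b → (con′ 1ℤ ⊹ b) ⊖ (con′ 1ℤ ⊹ a) :≡ b ⊖ a) ≡.refl (+ a) (+ b)))

    S*-stacked : ∀ φ a → Φ (S* (fromℕ k) φ) a (suc a) ≈ Φ φ a (suc a)
    S*-stacked φ a = trans (S*-last φ a (suc a)) (trans
      (+-cong (*-congʳ (r-next a)) (*-congʳ (+-congˡ (-‿cong (r-next a)))))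
      (solve 2 (λ x y → :1 :* x :+ (:1 :- :1) :* y := x) refl _ _))

    -- Renaming a and b in the swapped part moves the transposition from φ to the coefficients C.
    ∑₂-S* : ∀ φ (C : ℕ → ℕ → Carrier) → ∑₂ (λ a b → C a b * Φ (S* (fromℕ k) φ) a b)
            ≈ ∑₂ (λ a b → ((b ⊘ a) * C a b + (1# + (b ⊘ a)) * C b a) * Φ φ a b)
    ∑₂-S* φ C = begin
      ∑₂ (λ a b → C a b * Φ (S* (fromℕ k) φ) a b)
        ≈⟨ ∑₂-cong (λ {a} {b} _ _ → trans (*-congˡ (S*-last φ a b))
             (solve 4 (λ C γ x y → C :* (γ :* x :+ (:1 :- γ) :* y)
               := γ :* C :* x :+ (:1 :- γ) :* C :* y) refl _ _ _ _)) ⟩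
      ∑₂ (λ a b → (b ⊘ a) * C a b * Φ φ a b + (1# - (b ⊘ a)) * C a b * Φ φ b a)
        ≈⟨ ∑₂-+ _ _ ⟩
      ∑₂ (λ a b → (b ⊘ a) * C a b * Φ φ a b) + ∑₂ (λ a b → (1# - (b ⊘ a)) * C a b * Φ φ b a)
        ≈⟨ +-congˡ (∑-swap (v ⁺) (v ⁺) _) ⟩
      ∑₂ (λ a b → (b ⊘ a) * C a b * Φ φ a b) + ∑₂ (λ a b → (1# - (a ⊘ b)) * C b a * Φ φ a b)
        ≈⟨ ∑₂-+ _ _ ⟨
      ∑₂ (λ a b → (b ⊘ a) * C a b * Φ φ a b + (1# - (a ⊘ b)) * C b a * Φ φ a b)
        ≈⟨ ∑₂-cong (λ {a} {b} _ _ → trans (+-congˡ (*-congʳ (*-congʳ (+-congˡ (-‿cong (r-flip (+ a) (+ b)))))))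
             (solve 4 (λ γ C C′ x → γ :* C :* x :+ (:1 :- (:- γ)) :* C′ :* x
               := (γ :* C :+ (:1 :+ γ) :* C′) :* x) refl _ _ _ _)) ⟩
      ∑₂ (λ a b → ((b ⊘ a) * C a b + (1# + (b ⊘ a)) * C b a) * Φ φ a b) ∎

    -- A product of factors at a and b survives only if neither box sits on the other.
    pairwise : ∀ {a b x y} → a ∈ v ⁺ → b ∈ v ⁺ →
               (a ≡ b → x ≈ y) → (a ≢ b → a ≢ suc b → b ≢ suc a → x ≈ y) → c a * c b * x ≈ c a * c b * y
    pairwise {a} {b} a∈ b∈ diagonal generic with a ℕ.≟ b
    ... | yes a≡b = *-congˡ (diagonal a≡b)
    ... | no a≢b with a ℕ.≟ suc b | b ℕ.≟ suc a
    ... | yes ≡.refl | _ = trans (vanishes _) (sym (vanishes _))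
      where
      vanishes : ∀ x → c a * c b * x ≈ 0#
      vanishes x = trans (*-congʳ (trans (*-congˡ (g-taken a∈)) (zeroʳ _))) (zeroˡ _)
    ... | no _ | yes ≡.refl = trans (vanishes _) (sym (vanishes _))
      where
      vanishes : ∀ x → c a * c b * x ≈ 0#
      vanishes x = trans (*-congʳ (trans (*-congʳ (g-taken b∈)) (zeroˡ _))) (zeroˡ _)
    ... | no a≢sucb | no b≢suca = *-congˡ (generic a≢b a≢sucb b≢suca)

    κ-inverse′ : ∀ {a b} → a ≢ b → a ≢ suc b → (1# + (b ⊘ a)) * κ a (suc b) ≈ 1#
    κ-inverse′ {a} {b} a≢b a≢sucb = trans (*-congʳ (+-congˡ (sym (trans (-‿cong (r-flip (+ a) (+ b)))
      (-‿involutive _))))) (κ-inverse a≢b a≢sucb)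

    -- The second box goes below a row of `v ⁺` or, in the single sum, directly below the first box.
    M*-M* : ∀ φ → M* (M* φ) v ≈ ∑₂ (λ a b → c a * c b * κ b (suc a) * Φ φ a b)
                                + ∑ (v ⁺) (λ a → c a * c (suc a) * Φ φ a (suc a))
    M*-M* φ = trans (∑-cong (v ⁺) λ {a} _ → trans (*-congˡ (M*-∷ʳ φ v (suc a)))
        (trans (distribˡ _ _ _) (+-cong (sym (trans (∑-cong (v ⁺) λ {b} _ →
            solve 4 (λ x y z w → x :* y :* z :* w := x :* (y :* z :* w)) refl (c a) (c b) (κ b (suc a)) (Φ φ a b))
          (∑-*ˡ (v ⁺) (c a) _))) (sym (*-assoc _ _ _)))))
      (∑-+ (v ⁺) _ _)

    -- Stacked boxes are fixed by the transposition. For the others let i = 1/(b - a): then (1 + i)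
    -- κ a (suc b) and (1 - i) κ b (suc a) are both 1 unless the residues vanish or a = b, and the
    -- former may be replaced by the latter.
    M*-M*-symmetric : ∀ φ → M* (M* (S* (fromℕ k) φ)) v ≈ M* (M* φ) v
    M*-M*-symmetric φ = begin
      M* (M* (S* (fromℕ k) φ)) v
        ≈⟨ M*-M* (S* (fromℕ k) φ) ⟩
      ∑₂ (λ a b → c a * c b * κ b (suc a) * Φ (S* (fromℕ k) φ) a b)
        + ∑ (v ⁺) (λ a → c a * c (suc a) * Φ (S* (fromℕ k) φ) a (suc a))
        ≈⟨ +-cong (trans (∑₂-S* φ _) (∑₂-cong λ a∈ b∈ → *-congʳ (weight a∈ b∈)))
                  (∑-cong (v ⁺) λ {a} _ → *-congˡ (S*-stacked φ a)) ⟩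
      ∑₂ (λ a b → c a * c b * κ b (suc a) * Φ φ a b)
        + ∑ (v ⁺) (λ a → c a * c (suc a) * Φ φ a (suc a))
        ≈⟨ M*-M* φ ⟨
      M* (M* φ) v ∎
      where
      weight : ∀ {a b} → a ∈ v ⁺ → b ∈ v ⁺ →
                    (b ⊘ a) * (c a * c b * κ b (suc a)) + (1# + (b ⊘ a)) * (c b * c a * κ a (suc b))
                    ≈ c a * c b * κ b (suc a)
      weight {a} {b} a∈ b∈ = trans
        (solve 5 (λ i x y k k′ → i :* (x :* y :* k) :+ (:1 :+ i) :* (y :* x :* k′)
          := x :* y :* (i :* k :+ (:1 :+ i) :* k′)) refl i (c a) (c b) k₁ k₂)
        (pairwise a∈ b∈
          (λ { ≡.refl → trans (+-cong (*-congˡ (κ-next a)) (*-congˡ (κ-next a)))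
             (trans (trans (+-cong (zeroʳ _) (zeroʳ _)) (+-identityˡ 0#)) (sym (κ-next a))) })
          λ a≢b a≢sucb b≢suca → trans (+-congˡ (trans (κ-inverse′ a≢b a≢sucb)
              (sym (κ-inverse (λ b≡a → a≢b (≡.sym b≡a)) b≢suca))))
            (solve 2 (λ i k → i :* k :+ (:1 :- i) :* k := k) refl i k₁))
        where
        i = (b ⊘ a)
        k₁ = κ b (suc a)
        k₂ = κ a (suc b)

    -- Terms are sorted by the places of the two boxes: stacked below s, first below s and then
    -- below a row of `v ⁺`, stacked below such a row, or both below such rows. As D removes s
    -- between the two additions, a box below s can only be the first.
    M*-D*-M* : ∀ φ s → M* (D* (M* φ)) (s ∷ v) ≈ ε s *
      (c s * c (suc s) * Φ φ s (suc s)
       + ∑ (v ⁺) (λ a → c s * c a * κ a (suc s) * Φ φ s a + κ a s * c a * c (suc a) * Φ φ a (suc a))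
       + ∑₂ (λ a b → κ a s * (c a * c b * κ b (suc a)) * Φ φ a b))
    M*-D*-M* φ s = begin
      M* (D* (M* φ)) (s ∷ v)
        ≈⟨ ∑-insert s v _ ⟩
      c s * (ε s * M* φ (v ∷ʳ suc s)) + (∑ (v ⁺) λ a → κ a s * c a * (ε s * M* φ (v ∷ʳ suc a)))
        ≈⟨ +-cong (*-congˡ (*-congˡ (M*-∷ʳ φ v (suc s)))) (trans (∑-cong (v ⁺) (λ {a} _ →
             trans (*-congˡ (*-congˡ (M*-∷ʳ φ v (suc a))))
             (trans (solve 5 (λ k c e X y → k :* c :* (e :* (X :+ y)) := e :* (k :* c :* X :+ k :* c :* y))
               refl (κ a s) (c a) (ε s) (row a) _)
             (*-congˡ (+-cong (scale a) (sym (*-assoc _ _ _)))))))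
           (trans (∑-*ˡ (v ⁺) (ε s) _) (*-congˡ (∑-+ (v ⁺) _ _)))) ⟩
      c s * (ε s * (row s + c (suc s) * Φ φ s (suc s))) + ε s * (∑₂ doubles + ∑ (v ⁺) stacks)
        ≈⟨ solve 6 (λ c e X y A B → c :* (e :* (X :+ y)) :+ e :* (A :+ B) := e :* (c :* y :+ (c :* X :+ B) :+ A))
             refl (c s) (ε s) (row s) _ (∑₂ doubles) (∑ (v ⁺) stacks) ⟩
      ε s * (c s * (c (suc s) * Φ φ s (suc s)) + (c s * row s + ∑ (v ⁺) stacks) + ∑₂ doubles)
        ≈⟨ *-congˡ (+-congʳ (+-cong (sym (*-assoc _ _ _)) (trans
             (+-congʳ (trans (sym (∑-*ˡ (v ⁺) (c s) _)) (∑-cong (v ⁺) λ {b} _ →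
               solve 4 (λ x y z w → x :* (y :* z :* w) := x :* y :* z :* w) refl _ _ _ _)))
             (sym (∑-+ (v ⁺) _ _))))) ⟩
      ε s * _ ∎
      where
      row : ℕ → Carrier
      row a = ∑ (v ⁺) λ b → c b * κ b (suc a) * Φ φ a b
      doubles : ℕ → ℕ → Carrier
      doubles a b = κ a s * (c a * c b * κ b (suc a)) * Φ φ a b
      stacks : ℕ → Carrier
      stacks a = κ a s * c a * c (suc a) * Φ φ a (suc a)
      scale : ∀ a → κ a s * c a * row a ≈ ∑ (v ⁺) (doubles a)
      scale a = trans (sym (∑-*ˡ (v ⁺) _ _)) (∑-cong (v ⁺) λ {b} _ →
        solve 5 (λ k x y z w → k :* x :* (y :* z :* w) := k :* (x :* y :* z) :* w) refl _ _ _ _ _)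

    -- Here s is still present when the second box is added. This contributes the terms `Φ φ a s` in
    -- addition, and a factor κ from s to every residue at another row. Using the place below s
    -- twice is ruled out by κ s (suc s) = 0.
    M*-M*-D* : ∀ φ s → M* (M* (D* φ)) (s ∷ v) ≈ ε s *
      (c s * c (suc s) * κ (suc s) s * Φ φ s (suc s)
       + ∑ (v ⁺) (λ a → c s * c a * (κ a s * κ a (suc s)) * Φ φ s a
           + (c s * c a * (κ a s * κ s (suc a)) * Φ φ a s + κ a s * κ (suc a) s * c a * c (suc a) * Φ φ a (suc a)))
       + ∑₂ (λ a b → κ a s * κ b s * (c a * c b * κ b (suc a)) * Φ φ a b))
    M*-M*-D* φ s = begin
      M* (M* (D* φ)) (s ∷ v)
        ≈⟨ ∑-insert s v _ ⟩
      c s * M* (D* φ) (s ∷ (v ∷ʳ suc s)) + (∑ (v ⁺) λ a → κ a s * c a * M* (D* φ) (s ∷ (v ∷ʳ suc a)))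
        ≈⟨ +-cong (*-congˡ (inner s)) (trans (∑-cong (v ⁺) (λ {a} _ →
             trans (*-congˡ (inner a))
             (trans (solve 6 (λ k c e X y z → k :* c :* (e :* (X :+ (y :+ z))) := e :* (k :* c :* X :+ (k :* c :* y :+ k :* c :* z)))
               refl (κ a s) (c a) (ε s) (row a) _ _)
             (*-congˡ (+-cong (scale a) (+-cong
               (solve 5 (λ k c d l x → k :* c :* (d :* l :* x) := d :* c :* (k :* l) :* x) refl _ _ _ _ _)
               (solve 5 (λ k c l d x → k :* c :* (l :* d :* x) := k :* l :* c :* d :* x) refl _ _ _ _ _)))))))
           (trans (∑-*ˡ (v ⁺) (ε s) _) (*-congˡ (∑-+ (v ⁺) _ _)))) ⟩
      c s * (ε s * (row s + (c s * κ s (suc s) * Φ φ s s + κ (suc s) s * c (suc s) * Φ φ s (suc s))))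
        + ε s * (∑₂ doubles + ∑ (v ⁺) singles)
        ≈⟨ +-congʳ (*-congˡ (*-congˡ (+-congˡ (+-congʳ (trans (*-congʳ (trans (*-congˡ (κ-next s)) (zeroʳ _))) (zeroˡ _)))))) ⟩
      c s * (ε s * (row s + (0# + κ (suc s) s * c (suc s) * Φ φ s (suc s))))
        + ε s * (∑₂ doubles + ∑ (v ⁺) singles)
        ≈⟨ solve 8 (λ c e X k d x A B → c :* (e :* (X :+ (:0 :+ k :* d :* x))) :+ e :* (A :+ B)
             := e :* (c :* d :* k :* x :+ (c :* X :+ B) :+ A))
             refl (c s) (ε s) (row s) _ _ _ (∑₂ doubles) (∑ (v ⁺) singles) ⟩
      ε s * (c s * c (suc s) * κ (suc s) s * Φ φ s (suc s) + (c s * row s + ∑ (v ⁺) singles) + ∑₂ doubles)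
        ≈⟨ *-congˡ (+-congʳ (+-congˡ (trans
             (+-congʳ (trans (sym (∑-*ˡ (v ⁺) (c s) _)) (∑-cong (v ⁺) λ {b} _ →
               solve 5 (λ c k d l x → c :* (k :* d :* l :* x) := c :* d :* (k :* l) :* x) refl _ _ _ _ _)))
             (sym (∑-+ (v ⁺) _ _))))) ⟩
      ε s * _ ∎
      where
      row : ℕ → Carrier
      row a = ∑ (v ⁺) λ b → κ b s * c b * κ b (suc a) * Φ φ a b
      doubles : ℕ → ℕ → Carrier
      doubles a b = κ a s * κ b s * (c a * c b * κ b (suc a)) * Φ φ a b
      singles : ℕ → Carrier
      singles a = c s * c a * (κ a s * κ s (suc a)) * Φ φ a s + κ a s * κ (suc a) s * c a * c (suc a) * Φ φ a (suc a)
      scale : ∀ a → κ a s * c a * row a ≈ ∑ (v ⁺) (doubles a)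
      scale a = trans (sym (∑-*ˡ (v ⁺) _ _)) (∑-cong (v ⁺) λ {b} _ →
        solve 6 (λ k x l y z w → k :* x :* (l :* y :* z :* w) := k :* l :* (x :* y :* z) :* w) refl _ _ _ _ _ _)
      inner : ∀ a → M* (D* φ) (s ∷ (v ∷ʳ suc a)) ≈ ε s * (row a
                + (c s * κ s (suc a) * Φ φ a s + κ (suc a) s * c (suc a) * Φ φ a (suc a)))
      inner a = begin
        M* (D* φ) (s ∷ (v ∷ʳ suc a))
          ≈⟨ ∑-insert s (v ∷ʳ suc a) _ ⟩
        g (v ⁺ ∷ʳ suc a) (+ s) * (ε s * Φ φ a s)
          + (∑ (v ⁺ ∷ʳ suc a) λ b → κ b s * g (v ⁺ ∷ʳ suc a) (+ b) * (ε s * Φ φ a b))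
          ≈⟨ +-cong (*-congʳ (G-∷ʳ (v ⁺) (suc a) 1# (+ s))) (∑-∷ʳ (v ⁺) (suc a) _) ⟩
        c s * κ s (suc a) * (ε s * Φ φ a s)
          + ((∑ (v ⁺) λ b → κ b s * g (v ⁺ ∷ʳ suc a) (+ b) * (ε s * Φ φ a b))
             + κ (suc a) s * g (v ⁺ ∷ʳ suc a) (+ suc a) * (ε s * Φ φ a (suc a)))
          ≈⟨ +-congˡ (+-cong (trans (∑-cong (v ⁺) λ {b} _ → trans
                 (*-congʳ (*-congˡ (G-∷ʳ (v ⁺) (suc a) 1# (+ b))))
                 (solve 5 (λ k c l e x → k :* (c :* l) :* (e :* x) := e :* (k :* c :* l :* x)) refl _ _ _ _ _))
               (∑-*ˡ (v ⁺) (ε s) _))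
             (*-congʳ (*-congˡ (trans (G-∷ʳ (v ⁺) (suc a) 1# (+ suc a))
               (trans (*-congˡ (factor-self 1# (suc a))) (*-identityʳ _)))))) ⟩
        c s * κ s (suc a) * (ε s * Φ φ a s) + (ε s * row a + κ (suc a) s * c (suc a) * (ε s * Φ φ a (suc a)))
          ≈⟨ solve 8 (λ c k e x R l d y → c :* k :* (e :* x) :+ (e :* R :+ l :* d :* (e :* y))
               := e :* (R :+ (c :* k :* x :+ l :* d :* y))) refl _ _ _ _ _ _ _ _ ⟩
        ε s * (row a + (c s * κ s (suc a) * Φ φ a s + κ (suc a) s * c (suc a) * Φ φ a (suc a))) ∎

  module _ {k : ℕ} {v : Vec ℕ k} {s : ℕ} (sv-good : Good (s ∷ v)) where

    private
      c : ℕ → Carrier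
      c a = g (v ⁺) (+ a)

      s∉ : s ∉ v ⁺
      s∉ = good-∉ sv-good

    -- With `κ-inverse` the factor κ b (suc a) comes out of all terms, leaving (1 + i) κ a s + (1 -
    -- i) κ b s = 1 + κ a s κ b s for i = 1/(b - a). This has the same form as the identity behind
    -- `D-M-D`.
    doubles : ∀ {a b} → a ∈ v ⁺ → b ∈ v ⁺ →
              κ a s * (c a * c b * κ b (suc a))
                + ((b ⊘ a) * (κ a s * (c a * c b * κ b (suc a)))
                   + (1# + (b ⊘ a)) * (κ b s * (c b * c a * κ a (suc b))))
              ≈ c a * c b * κ b (suc a) + κ a s * κ b s * (c a * c b * κ b (suc a))
    doubles {a} {b} a∈ b∈ = trans
      (solve 7 (λ p q i x y k k′ → p :* (x :* y :* k) :+ (i :* (p :* (x :* y :* k)) :+ (:1 :+ i) :* (q :* (y :* x :* k′)))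
        := x :* y :* ((:1 :+ i) :* p :* k :+ (:1 :+ i) :* k′ :* q))
        refl (κ a s) (κ b s) i (c a) (c b) k₁ k₂)
      (trans (pairwise v a∈ b∈ diagonal generic)
        (solve 5 (λ p q x y k → x :* y :* ((:1 :+ p :* q) :* k) := x :* y :* k :+ p :* q :* (x :* y :* k))
          refl (κ a s) (κ b s) (c a) (c b) k₁))
      where
      i = (b ⊘ a)
      k₁ = κ b (suc a)
      k₂ = κ a (suc b)
      α = (a ⊘ s)
      β = (b ⊘ s)
      diagonal : a ≡ b → (1# + i) * κ a s * k₁ + (1# + i) * k₂ * κ b s ≈ (1# + κ a s * κ b s) * k₁
      diagonal ≡.refl = trans (+-cong (*-congˡ (κ-next a)) (*-congʳ (*-congˡ (κ-next a))))
        (trans (solve 3 (λ x y z → x :* :0 :+ y :* :0 :* z := :0) refl _ _ _)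
          (sym (trans (*-congˡ (κ-next a)) (zeroʳ _))))
      generic : a ≢ b → a ≢ suc b → b ≢ suc a →
                (1# + i) * κ a s * k₁ + (1# + i) * k₂ * κ b s ≈ (1# + κ a s * κ b s) * k₁
      generic a≢b a≢sucb b≢suca = begin
        (1# + i) * κ a s * k₁ + (1# + i) * k₂ * κ b s
          ≈⟨ +-cong (*-congʳ (*-congˡ (κ-value a s))) (*-cong (trans (κ-inverse′ v a≢b a≢sucb)
               (sym (κ-inverse (λ b≡a → a≢b (≡.sym b≡a)) b≢suca))) (κ-value b s)) ⟩
        (1# + i) * (1# + α) * k₁ + (1# - i) * k₁ * (1# + β)
          ≈⟨ solve 4 (λ i α β k → (:1 :+ i) :* (:1 :+ α) :* k :+ (:1 :- i) :* k :* (:1 :+ β)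
               := (:1 :+ :1 :+ α :+ β :- i :* (β :+ :- α)) :* k) refl i α β k₁ ⟩
        (1# + 1# + α + β - i * (β + - α)) * k₁
          ≈⟨ *-congʳ (+-congˡ (-‿cong split)) ⟩
        (1# + 1# + α + β - - (α * β)) * k₁
          ≈⟨ solve 3 (λ α β k → (:1 :+ :1 :+ α :+ β :- :- (α :* β)) :* k
               := (:1 :+ (:1 :+ α) :* (:1 :+ β)) :* k) refl α β k₁ ⟩
        (1# + (1# + α) * (1# + β)) * k₁
          ≈⟨ *-congʳ (+-congˡ (*-cong (κ-value a s) (κ-value b s))) ⟨
        (1# + κ a s * κ b s) * k₁ ∎
        where
        split : i * (β + - α) ≈ - (α * β)
        split = trans (*-congˡ (+-congˡ (sym (r-flip (+ s) (+ a)))))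
          (trans (sym (r-split (+-≢ λ b≡s → s∉ (≡.subst (_∈ v ⁺) b≡s b∈))
              (+-≢ λ s≡a → s∉ (≡.subst (_∈ v ⁺) (≡.sym s≡a) a∈)) (+-≢ λ b≡a → a≢b (≡.sym b≡a))))
            (trans (*-congˡ (r-flip (+ s) (+ a))) (solve 2 (λ α β → β :* :- α := :- (α :* β)) refl α β)))

    singles : ∀ φ {a} → a ∈ v ⁺ →
              c s * c a * κ a (suc s) * Φ v φ s a + κ a s * c a * c (suc a) * Φ v φ a (suc a)
                + (c s * c a * κ a (suc s) * Φ v (S* (fromℕ k) φ) s a
                   + κ a s * c a * c (suc a) * Φ v (S* (fromℕ k) φ) a (suc a))
              ≈ c a * c (suc a) * Φ v φ a (suc a)
                + (c s * c a * (κ a s * κ a (suc s)) * Φ v φ s a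
                   + (c s * c a * (κ a s * κ s (suc a)) * Φ v φ a s
                      + κ a s * κ (suc a) s * c a * c (suc a) * Φ v φ a (suc a)))
    singles φ {a} a∈ = begin
      u * κ a (suc s) * Φ v φ s a + q * Φ v φ a (suc a)
        + (u * κ a (suc s) * Φ v (S* (fromℕ k) φ) s a + q * Φ v (S* (fromℕ k) φ) a (suc a))
        ≈⟨ +-congˡ (+-cong (*-congˡ (S*-last v φ s a)) (*-congˡ (S*-stacked v φ a))) ⟩
      u * κ a (suc s) * Φ v φ s a + q * Φ v φ a (suc a)
        + (u * κ a (suc s) * (α * Φ v φ s a + (1# - α) * Φ v φ a s) + q * Φ v φ a (suc a))
        ≈⟨ solve 7 (λ u k α q x y z → u :* k :* x :+ q :* z :+ (u :* k :* (α :* x :+ (:1 :- α) :* y) :+ q :* z)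
             := u :* ((:1 :+ α) :* k) :* x :+ (u :* ((:1 :- α) :* k) :* y :+ (q :+ q) :* z))
             refl u (κ a (suc s)) α q _ _ _ ⟩
      u * ((1# + α) * κ a (suc s)) * Φ v φ s a
        + (u * ((1# - α) * κ a (suc s)) * Φ v φ a s + (q + q) * Φ v φ a (suc a))
        ≈⟨ +-cong (*-congʳ (*-congˡ (*-congʳ (sym (κ-value a s))))) (rest (suc a ℕ.≟ s)) ⟩
      u * (κ a s * κ a (suc s)) * Φ v φ s a
        + (u * (κ a s * κ s (suc a)) * Φ v φ a s
           + (c a * c (suc a) + κ a s * κ (suc a) s * c a * c (suc a)) * Φ v φ a (suc a))
        ≈⟨ solve 5 (λ x y a b z → x :+ (y :+ (a :+ b) :* z) := a :* z :+ (x :+ (y :+ b :* z))) refl _ _ _ _ _ ⟩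
      c a * c (suc a) * Φ v φ a (suc a)
        + (u * (κ a s * κ a (suc s)) * Φ v φ s a
           + (u * (κ a s * κ s (suc a)) * Φ v φ a s
              + κ a s * κ (suc a) s * c a * c (suc a) * Φ v φ a (suc a))) ∎
      where
      u = c s * c a
      q = κ a s * c a * c (suc a)
      α = (a ⊘ s)
      a≢s : a ≢ s
      a≢s a≡s = s∉ (≡.subst (_∈ v ⁺) a≡s a∈)
      -- For a = s + 1 the two factors are not inverse to each other, but then c s, and with it u,
      -- is zero.
      a-off-s : u * ((1# - α) * κ a (suc s)) ≈ u
      a-off-s with a ℕ.≟ suc s
      ... | yes ≡.refl = trans (vanishes _) (sym (trans (sym (*-identityʳ u)) (vanishes 1#)))
        where
        vanishes : ∀ x → c s * c (suc s) * x ≈ 0#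
        vanishes x = trans (*-congʳ (trans (*-congʳ (g-taken a∈)) (zeroˡ _))) (zeroˡ _)
      ... | no a≢sucs  = trans (*-congˡ (κ-inverse a≢s a≢sucs)) (*-identityʳ u)
      rest : Dec (suc a ≡ s) →
             u * ((1# - α) * κ a (suc s)) * Φ v φ a s + (q + q) * Φ v φ a (suc a)
             ≈ u * (κ a s * κ s (suc a)) * Φ v φ a s
               + (c a * c (suc a) + κ a s * κ (suc a) s * c a * c (suc a)) * Φ v φ a (suc a)
      -- When the new box sits where s was removed, the two kinds of terms coincide and trade weight.
      rest (yes ≡.refl) = trans
        (+-cong (*-congʳ a-off-s) (*-congʳ (+-cong (*-congʳ (*-congʳ (κ-next a))) (*-congʳ (*-congʳ (κ-next a))))))
        (trans (solve 3 (λ x y z → y :* x :* z :+ (:0 :* x :* y :+ :0 :* x :* y) :* z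
                 := x :* y :* z) refl (c a) (c (suc a)) _)
        (sym (trans (+-cong (*-congʳ (*-congˡ (*-congʳ (κ-next a)))) (*-congʳ (+-congˡ (*-congʳ (*-congʳ (*-congʳ (κ-next a)))))))
          (solve 5 (λ x y z k l → y :* x :* (:0 :* k) :* z :+ (x :* y :+ :0 :* l :* x :* y) :* z
            := x :* y :* z) refl (c a) (c (suc a)) _ _ _))))
      rest (no suca≢s) = +-cong
        (*-congʳ (trans a-off-s (sym (trans (*-congˡ s-off-a) (*-identityʳ u)))))
        (*-congʳ (begin
          q + q
            ≈⟨ +-cong (*-congʳ (*-congʳ (κ-value a s))) (*-congʳ (*-congʳ (κ-value a s))) ⟩
          (1# + α) * c a * c (suc a) + (1# + α) * c a * c (suc a)
            ≈⟨ solve 4 (λ α β x y → (:1 :+ α) :* x :* y :+ (:1 :+ α) :* x :* y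
                 := x :* y :+ (:1 :+ α :+ β :+ (α :- β)) :* x :* y) refl α β (c a) (c (suc a)) ⟩
          c a * c (suc a) + (1# + α + β + (α - β)) * c a * c (suc a)
            ≈⟨ +-congˡ (*-congʳ (*-congʳ (+-congˡ (sym (r-consecutive a≢s suca≢s))))) ⟩
          c a * c (suc a) + (1# + α + β + α * β) * c a * c (suc a)
            ≈⟨ +-congˡ (*-congʳ (*-congʳ (trans
                 (solve 2 (λ α β → :1 :+ α :+ β :+ α :* β := (:1 :+ α) :* (:1 :+ β)) refl α β)
                 (sym (*-cong (κ-value a s) (κ-value (suc a) s)))))) ⟩
          c a * c (suc a) + κ a s * κ (suc a) s * c a * c (suc a) ∎))
        where
        β = (suc a ⊘ s)
        s-off-a : κ a s * κ s (suc a) ≈ 1#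
        s-off-a = trans (*-congʳ (κ-flip a s))
          (κ-inverse (λ s≡a → a≢s (≡.sym s≡a)) (λ s≡suca → suca≢s (≡.sym s≡suca)))

    M*-D*-M*-symmetrised : ∀ φ → M* (D* (M* φ)) (s ∷ v) + M* (D* (M* (S* (fromℕ k) φ))) (s ∷ v)
                           ≈ D* (M* (M* φ)) (s ∷ v) + M* (M* (D* φ)) (s ∷ v)
    M*-D*-M*-symmetrised φ = begin
      M* (D* (M* φ)) (s ∷ v) + M* (D* (M* (S* (fromℕ k) φ))) (s ∷ v)
        ≈⟨ +-cong (M*-D*-M* v φ s) (M*-D*-M* v (S* (fromℕ k) φ) s) ⟩
      ε s * (x * Φ v φ s (suc s) + A φ + B φ) + ε s * (x * Φ v ψ s (suc s) + A ψ + B ψ)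
        ≈⟨ solve 7 (λ e a b c d f h → e :* (a :+ b :+ c) :+ e :* (d :+ f :+ h) := e :* ((a :+ d) :+ (b :+ f) :+ (c :+ h)))
             refl (ε s) _ _ _ _ _ _ ⟩
      ε s * ((x * Φ v φ s (suc s) + x * Φ v ψ s (suc s)) + (A φ + A ψ) + (B φ + B ψ))
        ≈⟨ *-congˡ (+-cong (+-cong stack single) double) ⟩
      ε s * (x * κ (suc s) s * Φ v φ s (suc s) + (A₁ + A₂) + (B₁ + B₂))
        ≈⟨ solve 6 (λ e a b c d f → e :* (a :+ (b :+ c) :+ (d :+ f)) := e :* (d :+ b) :+ e :* (a :+ c :+ f)) refl _ _ _ _ _ _ ⟩
      ε s * (B₁ + A₁) + ε s * (x * κ (suc s) s * Φ v φ s (suc s) + A₂ + B₂)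
        ≈⟨ +-cong (*-congˡ (M*-M* v φ)) (M*-M*-D* v φ s) ⟨
      D* (M* (M* φ)) (s ∷ v) + M* (M* (D* φ)) (s ∷ v) ∎
      where
      ψ = S* (fromℕ k) φ
      x = c s * c (suc s)
      A B : Functional (suc (suc k)) → Carrier
      A φ = ∑ (v ⁺) λ a → c s * c a * κ a (suc s) * Φ v φ s a + κ a s * c a * c (suc a) * Φ v φ a (suc a)
      B φ = ∑₂ v λ a b → κ a s * (c a * c b * κ b (suc a)) * Φ v φ a b
      A₁ = ∑ (v ⁺) λ a → c a * c (suc a) * Φ v φ a (suc a)
      A₂ = ∑ (v ⁺) λ a → c s * c a * (κ a s * κ a (suc s)) * Φ v φ s a
           + (c s * c a * (κ a s * κ s (suc a)) * Φ v φ a s + κ a s * κ (suc a) s * c a * c (suc a) * Φ v φ a (suc a))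
      B₁ = ∑₂ v λ a b → c a * c b * κ b (suc a) * Φ v φ a b
      B₂ = ∑₂ v λ a b → κ a s * κ b s * (c a * c b * κ b (suc a)) * Φ v φ a b
      stack : x * Φ v φ s (suc s) + x * Φ v ψ s (suc s) ≈ x * κ (suc s) s * Φ v φ s (suc s)
      -- The transposition fixes the stacked pair, and κ (suc s) s = 2 accounts for the two copies.
      stack = trans (+-congˡ (*-congˡ (S*-stacked v φ s))) (trans
        (solve 2 (λ x y → x :* y :+ x :* y := x :* (:1 :+ :1) :* y) refl x _)
        (*-congʳ (*-congˡ (sym (trans (κ-value (suc s) s) (+-congˡ (r-next s)))))))
      single : A φ + A ψ ≈ A₁ + A₂
      single = trans (sym (∑-+ (v ⁺) _ _)) (trans (∑-cong (v ⁺) (singles φ)) (∑-+ (v ⁺) _ _))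
      double : B φ + B ψ ≈ B₁ + B₂
      double = trans (+-congˡ (∑₂-S* v φ _)) (trans (sym (∑₂-+ v _ _)) (trans
        (∑₂-cong v λ {a} {b} a∈ b∈ → trans (sym (distribʳ (Φ v φ a b) _ _))
          (trans (*-congʳ (doubles a∈ b∈)) (distribʳ (Φ v φ a b) _ _)))
        (∑₂-+ v _ _)))

  M-M-symmetric : ∀ {k} (v : V.Combination k) →
                  S (fromℕ k) (M (M v)) ≋ⱽ M (M v)
  M-M-symmetric {k} = ≋-from-adjoints (∘-adjoint (S-adjoint (fromℕ k)) (∘-adjoint M-adjoint M-adjoint))
    (∘-adjoint M-adjoint M-adjoint) λ φ v _ → M*-M*-symmetric v φ

  M-D-M : ∀ {k} (v : V.Combination (suc k)) →
          M (D (M v)) ++ S (fromℕ k) (M (D (M v))) ≋ⱽ M (M (D v)) ++ D (M (M v))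
  M-D-M {k} = ≋-from-adjoints
    (++-adjoint MDM (∘-adjoint (S-adjoint (fromℕ k)) MDM))
    (++-adjoint (∘-adjoint (∘-adjoint M-adjoint M-adjoint) D-adjoint) (∘-adjoint D-adjoint (∘-adjoint M-adjoint M-adjoint)))
    λ { φ (s ∷ v) sv-good → M*-D*-M*-symmetrised sv-good φ }
    where
    MDM : Adjoint (λ v → M (D (M v))) (λ φ → M* (D* (M* φ)))
    MDM = ∘-adjoint M-adjoint (∘-adjoint D-adjoint M-adjoint)

  tableauRelations : CommutationRelations V
  tableauRelations = record
    { M = M ; D = D ; S = S ; M-linear = M-linear ; D-linear = D-linear ; S-linear = S-linear
    ; S-involutive = S-involutive ; S-M = S-M-commute ; S-D = S-D-commute ; S-M-M = M-M-symmetric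
    ; D-D-S = D-D-symmetric ; M-D-M = M-D-M ; D-M-D = D-M-D }

  tableaux : ShiftAlgebra V
  tableaux = shiftAlgebra tableauRelations

  open ShiftAlgebra tableaux using (Θ)

  -- Expansion of basis vectors through M and Θ

  Θ* : ∀ {k} → Functional (suc k) → Functional (suc k)
  Θ* φ v = D* (M* φ) v + (- 1#) * M* (D* φ) v

  Θ-adjoint : ∀ {k} → Adjoint (Θ {k}) Θ*
  Θ-adjoint = ++-adjoint (∘-adjoint M-adjoint D-adjoint) (·-adjoint (- 1#) (∘-adjoint D-adjoint M-adjoint))

  module _ {k : ℕ} where

    -- The term MD cancels the 1 in κ a s = 1 - 1/(s - a). What remains is the Cauchy kernel 1/(s -
    -- a), together with the new box below s itself, which only DM can place.
    Θ*-value : ∀ φ {s} {v : Vec ℕ k} → s ∉ v ⁺ → Θ* φ (s ∷ v) ≈ ε s *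
               ((∑ (v ⁺) λ a → g (v ⁺) (+ a) * ((s ⊘ a) * φ (v ∷ʳ suc a)))
                - g (v ⁺) (+ s) * φ (v ∷ʳ suc s))
    Θ*-value φ {s} {v} s∉ = begin
      ε s * M* φ v + (- 1#) * M* (D* φ) (s ∷ v)
        ≈⟨ +-congˡ (*-congˡ (trans (∑-insert s v _) (+-cong
             (solve 3 (λ c e x → c :* (e :* x) := e :* (c :* x)) refl _ _ _)
             (trans (∑-cong (v ⁺) λ {a} _ → trans (*-congʳ (*-congʳ (κ-flip a s)))
                 (solve 4 (λ x c e y → (:1 :- x) :* c :* (e :* y) := e :* (c :* y :+ :- (c :* (x :* y)))) refl _ _ _ _))
               (trans (∑-*ˡ (v ⁺) (ε s) _) (*-congˡ (trans (∑-+ (v ⁺) _ _)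
                 (+-congˡ (∑-neg (v ⁺) _))))))))) ⟩
      ε s * M* φ v + (- 1#) * (ε s * (g (v ⁺) (+ s) * φ (v ∷ʳ suc s))
        + ε s * (M* φ v + - (∑ (v ⁺) λ a → g (v ⁺) (+ a) * ((s ⊘ a) * φ (v ∷ʳ suc a)))))
        ≈⟨ solve 4 (λ e m x y → e :* m :+ (:- :1) :* (e :* x :+ e :* (m :+ :- y)) := e :* (y :- x))
             refl (ε s) _ _ _ ⟩
      ε s * ((∑ (v ⁺) λ a → g (v ⁺) (+ a) * ((s ⊘ a) * φ (v ∷ʳ suc a)))
        - g (v ⁺) (+ s) * φ (v ∷ʳ suc s)) ∎

  -- Extension by zero to invalid vectors. It lets the expansion run over all rows p before it is
  -- known which of them carry a coefficient.
  b̃ : ∀ {k} → Vec ℕ k → V.Combination k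
  b̃ v = ifGood (good? v)
    where
    ifGood : ∀ {k} {v : Vec ℕ k} → Dec (Good v) → V.Combination k
    ifGood (yes v-good) = b (toI v-good)
    ifGood (no _)       = []

  b̃-good : ∀ {k} {v : Vec ℕ k} (v-good : Good v) → b̃ v ≡ b (toI v-good)
  b̃-good {v = v} v-good with good? v
  ... | yes _  = ≡.refl
  ... | no bad = ⊥-elim (bad v-good)

  -- The free constant ρ of `decomposition` is set to 1/z. This makes the weight of p = 0 vanish, as
  -- it must, since there is no row above 0 to rotate to the front.
  weight : ∀ {k} → Vec ℕ k → ℕ → ℕ → Carrier
  weight v z p = h (v ⁺) (+ p) * ((z ⊘ p) - r (+ z))

  module _ {B : DecSetoid 0ℓ 0ℓ} where

    open FreeModule K B using (Combination; pair; pair-++; _≋_; module ≋)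

    combine : ∀ {n} → Vec ℕ n → (ℕ → Combination) → Combination
    combine []      f = []
    combine (p ∷ S) f = f p ++ combine S f

    pair-combine : ∀ {n} φ (S : Vec ℕ n) f → pair φ (combine S f) ≈ ∑ S λ p → pair φ (f p)
    pair-combine φ []      f = refl
    pair-combine φ (p ∷ S) f = trans (pair-++ φ (f p) _) (+-congˡ (pair-combine φ S f))

    combine-cong : ∀ {n} (S : Vec ℕ n) {f f′} → (∀ {p} → p ∈ S → f p ≋ f′ p) → combine S f ≋ combine S f′
    combine-cong []      eq = ≋.≈ᴹ-refl
    combine-cong (p ∷ S) eq = ≋.+ᴹ-cong (eq (here ≡.refl)) (combine-cong S λ p∈S → eq (there p∈S))

  ε-inverse : ∀ s → ε s * (e⁻¹ s * e (pred s)) ≈ 1#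
  ε-inverse s = trans (solve 4 (λ a b c d → a :* b :* (c :* d) := (a :* c) :* (d :* b)) refl _ _ _ _)
    (trans (*-cong (e*e⁻¹ s) (e*e⁻¹ (pred s))) (*-identityˡ 1#))

  ε⁻¹ : ℕ → Carrier
  ε⁻¹ s = e⁻¹ s * e (pred s)

  module _ {k : ℕ} {v : Vec ℕ k} {z : ℕ} (vz-good : Good (v ∷ʳ z)) where

    v-good : Good v
    v-good = init-good vz-good

    z≢0 : NonZero z
    z≢0 = last-nonZero vz-good

    z∉ : z ∉ v ⁺
    z∉ (here z≡0)  = ℕ.≢-nonZero⁻¹ z {{z≢0}} z≡0
    z∉ (there z∈v) = last-∉ vz-good z∈v

    unique = anchors-unique v-good

    rotated : ℕ → V.Combination (suc k)
    rotated p = ε⁻¹ (pred p) ·ⱽ Θ (b̃ (pred p ∷ v))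

    -- Either the coefficient w is zero, and whatever stands behind it is immaterial, or the rotated
    -- vector is a valid tuple on which the recursion may be called.
    data Rotates (p : ℕ) (w : Carrier) : Set where
      dead : w ≈ 0# → Rotates p w
      live : Good (pred p ∷ v) → degree (pred p ∷ v) ℕ.< degree (v ∷ʳ z) → NonZero p → Rotates p w

    pred∉ : ∀ {p} → Avoids (+ p ℤ.- 1ℤ) (v ⁺) → NonZero p → pred p ∉ v ⁺
    pred∉ {suc p} p∉ _ p∈ = all-∈ p∉ p∈ (ℤ.[1+m]⊖[1+n]≡m⊖n p 0)

    rotates-last : Rotates z (h (v ⁺) (+ z))
    rotates-last = go (predecessor (v ⁺) unique z) ≡.refl
      where
      go : ∀ {w} → Predecessor (v ⁺) unique w → w ≡ z → Rotates z (h (v ⁺) (+ z))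
      go (present a∈)  ≡.refl = dead (h-taken a∈)
      go (absent z-1∉) ≡.refl = live (∷-good (pred∉ z-1∉ z≢0) v-good)
        (degree-rotate-< (Good.positive v-good) z≢0 λ z∈ → pred∉ z-1∉ z≢0 (there z∈)) z≢0

    rotates : ∀ {p} → p ∈ v ⁺ → Rotates p (weight v z p)
    rotates (here ≡.refl) = dead (trans (*-congˡ (trans (+-congʳ (r-cong (ℤ.+-identityʳ (+ z)))) (-‿inverseʳ _))) (zeroʳ _))
    rotates {p} (there p∈v) = go (predecessor (v ⁺) unique p) p∈v
      where
      go : ∀ {p} → Predecessor (v ⁺) unique p → p ∈ v → Rotates p (weight v z p)
      go     (present a∈)  _   = dead (trans (*-congʳ (h-taken a∈)) (zeroˡ _))
      go {p} (absent p-1∉) p∈v = live (∷-good (pred∉ p-1∉ p≢0) v-good)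
        (degree-pred-< (Good.positive v-good) z≢0 p∈v λ p∈ → pred∉ p-1∉ p≢0 (there p∈)) p≢0
        where p≢0 = all-∈ (Good.positive v-good) p∈v

    expansion : V.Combination (suc k)
    expansion = r (+ z) ·ⱽ M (b (toI v-good))
      ++ (combine {I-decSetoid (suc k)} (v ⁺) (λ p → (- weight v z p) ·ⱽ rotated p)
          ++ (- h (v ⁺) (+ z)) ·ⱽ rotated z)

    moved : Functional (suc k) → ℕ → Carrier
    moved φ = shifted (v ⁺) unique z∉ (r (+ z)) (λ y → φ (v ∷ʳ y))

    pair-rotated : ∀ φ {p w} → Rotates p w →
      V.pair (suc k) (restrict φ) ((- w) ·ⱽ rotated p)
      ≈ - (w * moved φ p)
    pair-rotated φ {p} {w} (dead w≈0) = trans (V.pair-· (suc k) (restrict φ) (- w) (rotated p))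
      (trans (sym (-‿distribˡ-* w _)) (-‿cong (trans (*-congʳ w≈0) (trans (zeroˡ _) (sym (trans (*-congʳ w≈0) (zeroˡ _)))))))
    pair-rotated φ {suc s} {w} (live sv-good _ _) = begin
      V.pair (suc k) (restrict φ) ((- w) ·ⱽ rotated (suc s))
        ≈⟨ trans (V.pair-· (suc k) (restrict φ) (- w) (rotated (suc s))) (sym (-‿distribˡ-* w _)) ⟩
      - (w * V.pair (suc k) (restrict φ) (rotated (suc s)))
        ≈⟨ -‿cong (*-congˡ (trans (V.pair-· (suc k) (restrict φ) (ε⁻¹ s) (Θ (b̃ (s ∷ v))))
             (*-congˡ (trans (adjoint Θ-adjoint φ (b̃ (s ∷ v))) (trans
               (reflexive (≡.cong (V.pair (suc k) (restrict (Θ* φ))) (b̃-good sv-good)))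
               (trans (+-identityʳ _) (trans (*-identityˡ _) (Θ*-value φ (good-∉ sv-good))))))))) ⟩
      - (w * (ε⁻¹ s * (ε s * ((∑ (v ⁺) λ a → g (v ⁺) (+ a) * ((s ⊘ a) * φ (v ∷ʳ suc a)))
                              - g (v ⁺) (+ s) * φ (v ∷ʳ suc s)))))
        ≈⟨ -‿cong (*-congˡ (trans (solve 3 (λ x y z → x :* (y :* z) := (y :* x) :* z) refl _ _ _)
             (trans (*-congʳ (ε-inverse s)) (*-identityˡ _)))) ⟩
      - (w * ((∑ (v ⁺) λ a → g (v ⁺) (+ a) * ((s ⊘ a) * φ (v ∷ʳ suc a)))
               - g (v ⁺) (+ s) * φ (v ∷ʳ suc s)))
        ≈⟨ -‿cong (*-congˡ (reflexive (≡.cong (λ u →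
             (∑ (v ⁺) λ a → g (v ⁺) (+ a) * (r (u ℤ.- + a) * φ (v ∷ʳ suc a)))
             - g (v ⁺) u * φ (v ∷ʳ suc s)) (≡.sym (ℤ.[1+m]⊖[1+n]≡m⊖n s 0))))) ⟩
      - (w * moved φ (suc s)) ∎

    -- `decomposition` tested against every functional φ, with χ y = φ (v ∷ʳ y).
    expand : expansion ≋ⱽ b (toI vz-good)
    expand = ≋-from-functionals λ φ → begin
      V.pair (suc k) (restrict φ) expansion
        ≈⟨ trans (V.pair-++ (suc k) (restrict φ) (r (+ z) ·ⱽ M (b (toI v-good))) _)
             (+-cong (trans (V.pair-· (suc k) (restrict φ) (r (+ z)) (M (b (toI v-good))))
                 (*-congˡ (trans (adjoint M-adjoint φ (b (toI v-good))) (trans (+-identityʳ _) (*-identityˡ _)))))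
               (trans (V.pair-++ (suc k) (restrict φ) (combine {I-decSetoid (suc k)} (v ⁺) (λ p → (- weight v z p) ·ⱽ rotated p)) _)
                 (+-cong (trans (pair-combine {I-decSetoid (suc k)} (restrict φ) (v ⁺) (λ p → (- weight v z p) ·ⱽ rotated p)) (trans
                   (∑-cong (v ⁺) λ p∈ → pair-rotated φ (rotates p∈)) (∑-neg (v ⁺) (λ p → weight v z p * moved φ p))))
                   (pair-rotated φ rotates-last)))) ⟩
      _ + (- _ + - _)
        ≈⟨ sym (+-assoc _ _ _) ⟩
      _ - _ - _
        ≈⟨ decomposition (v ⁺) unique z∉ (r (+ z)) (λ y → φ (v ∷ʳ y)) ⟩
      φ (v ∷ʳ z)
        ≈⟨ trans (+-identityʳ _) (*-identityˡ _) ⟨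
      V.pair (suc k) (restrict φ) (b (toI vz-good)) ∎

    generated-∷ʳ : ∀ {P : V.Combination (suc k) → Set} → IsSubmodule (V (suc k)) P → (∀ w → P (M w)) →
                   (∀ τ → degree (entries τ) ℕ.< degree (v ∷ʳ z) → P (Θ (b τ))) → P (b (toI vz-good))
    generated-∷ʳ {P} P-sub P-M P-Θ = resp expand (+∈ (*∈ (r (+ z)) (P-M (b (toI v-good)))) (+∈
      (P-combine (v ⁺) (λ p∈ → P-rotated (rotates p∈))) (P-rotated rotates-last)))
      where
      open IsSubmodule P-sub
      P-rotated : ∀ {p w} → Rotates p w → P ((- w) ·ⱽ rotated p)
      P-rotated {p} {w} (dead w≈0) = resp (V.≋.≈ᴹ-trans (suc k) (V.≋.≈ᴹ-sym (suc k) (V.≋.*ₗ-zeroˡ (suc k) (rotated p)))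
        (V.≋.*ₗ-cong (suc k) (trans (sym -0#≈0#) (-‿cong (sym w≈0))) (V.≋.≈ᴹ-refl (suc k)))) 0∈
      P-rotated {p} {w} (live pv-good smaller _) = *∈ (- w) (*∈ (ε⁻¹ (pred p))
        (≡.subst (λ u → P (Θ u)) (≡.sym (b̃-good pv-good)) (P-Θ (toI pv-good) smaller)))
      P-combine : ∀ {n} (T : Vec ℕ n) → (∀ {p} → p ∈ T → P ((- weight v z p) ·ⱽ rotated p)) →
                  P (combine {I-decSetoid (suc k)} T (λ p → (- weight v z p) ·ⱽ rotated p))
      P-combine []      f = 0∈
      P-combine (p ∷ T) f = +∈ (f (here ≡.refl)) (P-combine T (λ p∈T → f (there p∈T)))

  tableauBasis : FilteredBasis tableaux
  tableauBasis = record
    { Basis     = I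
    ; b         = b
    ; deg       = λ σ → degree (entries σ)
    ; spans     = λ {k} → spanned (I-decSetoid k)
    ; generated = generated
    ; filtered  = filtered
    }
    where
    generated : ∀ {k} (σ : I (suc k)) {P : V.Combination (suc k) → Set} → IsSubmodule (V (suc k)) P →
                (∀ w → P (M w)) → (∀ τ → degree (entries τ) ℕ.< degree (entries σ) → P (Θ (b τ))) → P (b σ)
    generated σ {P} P-sub P-M P-Θ = go (entries-good σ) (initLast (entries σ)) P-Θ
      where
      go : (σ-good : Good (entries σ)) → (∃ λ v → ∃ λ z → entries σ ≡ v ∷ʳ z) →
           (∀ τ → degree (entries τ) ℕ.< degree (entries σ) → P (Θ (b τ))) → P (b σ)
      go σ-good (v , z , eq) P-Θ = ≡.subst (λ τ → P (b τ)) (entries-injective (≡.sym eq))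
        (generated-∷ʳ (≡.subst Good eq σ-good) P-sub P-M
          λ τ lt → P-Θ τ (≡.subst (λ w → degree (entries τ) ℕ.< degree w) (≡.sym eq) lt))

    filtered : ∀ {k} (σ : I (suc (suc k))) {P : V.Combination (suc (suc k)) → Set} →
               IsSubmodule (V (suc (suc k))) P → (∀ τ → degree (entries τ) ℕ.≤ degree (entries σ) → P (b τ)) → P (S zero (b σ))
    filtered {k} σ@(tuple (a ∷ c ∷ v) _ _) {P} P-sub P-b = resp (V.≋.≈ᴹ-sym (suc (suc k))
        (extend-⟦⟧ (I-decSetoid (suc (suc k))) (I-decSetoid (suc (suc k))) (S-basis zero) σ))
      (+∈ (*∈ _ (P-b σ ℕ.≤-refl)) (swapped (pred c ℕ.≟ a)))
      where
      open IsSubmodule P-sub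
      positive = Good.positive (entries-good σ)
      swapped : Dec (pred c ≡ a) → P ((1# - (c ⊘ a)) ·ⱽ b (swapI zero σ))
      swapped (yes c≡suca) = resp (V.≋.≈ᴹ-trans (suc (suc k)) (V.≋.≈ᴹ-sym (suc (suc k)) (V.≋.*ₗ-zeroˡ (suc (suc k)) (b (swapI zero σ))))
        (V.≋.*ₗ-cong (suc (suc k)) (sym (trans (+-congˡ (-‿cong (trans (r-cong (≡.cong (λ x → + x ℤ.- + a) c≡))
          (r-next a)))) (-‿inverseʳ 1#))) (V.≋.≈ᴹ-refl (suc (suc k))))) 0∈
        where
        c≡ : c ≡ suc a
        c≡ = ≡.trans (≡.sym (ℕ.suc-pred c {{All.head (All.tail positive)}})) (≡.cong suc c≡suca)
      swapped (no c≢suca) = *∈ _ (P-b (swapI zero σ) (degree-swap-≤ (All.head positive) (All.tail (All.tail positive)) c≢suca))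

  -- The color side

  -- Equality here is equality of the polynomials F; `≋⇒≋̂` carries it over to formal sums at the
  -- end.
  V̂ᶠ : ℕ → Module K 0ℓ 0ℓ
  V̂ᶠ k = F.module≋ k

  module _ {k l : ℕ} (f : Exponents k → Exponents l) where

    -- M̂, Θ̂ and the transpositions all send monomials to monomials, so the relations among them
    -- are equalities of exponent vectors.
    relabel : F.Combination k → F.Combination l
    relabel = extend K (Exponents-decSetoid k) (Exponents-decSetoid l) (λ α → F.⟦_⟧ l (f α))

    relabel-linear : IsLinear (V̂ᶠ k) (V̂ᶠ l) relabel
    relabel-linear = extend-linear (Exponents-decSetoid k) (Exponents-decSetoid l) {λ α → F.⟦_⟧ l (f α)} λ { ≡.refl → F.≋.≈ᴹ-refl l }

    pair-relabel : ∀ φ v → F.pair l φ (relabel v) ≈ F.pair k (λ α → φ (f α)) v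
    pair-relabel φ v = trans (pair-extend (Exponents-decSetoid k) (Exponents-decSetoid l) φ (λ α → F.⟦_⟧ l (f α)) v)
      (F.pair-φ k v λ α → trans (+-identityʳ _) (*-identityˡ _))

  F-≋ : ∀ {k} {v w : F.Combination k} → (∀ φ → F.pair k φ v ≈ F.pair k φ w) → v ≋ᶠ w
  F-≋ {k} eq = F.mk≋ λ α → eq (F.δ k α)

  module _ {k l m : ℕ} (f : Exponents l → Exponents m) (f′ : Exponents k → Exponents l) where

    pair-relabel₂ : ∀ φ v → F.pair m φ (relabel f (relabel f′ v)) ≈ F.pair k (λ α → φ (f (f′ α))) v
    pair-relabel₂ φ v = trans (pair-relabel f φ (relabel f′ v)) (pair-relabel f′ _ v)

    pair-relabel₃ : ∀ {n} (f₀ : Exponents m → Exponents n) φ v →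
                    F.pair n φ (relabel f₀ (relabel f (relabel f′ v))) ≈ F.pair k (λ α → φ (f₀ (f (f′ α)))) v
    pair-relabel₃ f₀ φ v = trans (pair-relabel f₀ φ (relabel f (relabel f′ v))) (pair-relabel₂ _ v)

  same-monomials : ∀ {k l} {T U : F.Combination k → F.Combination l} {f h : Exponents k → Exponents l} →
                   (∀ φ v → F.pair l φ (T v) ≈ F.pair k (λ α → φ (f α)) v) →
                   (∀ φ v → F.pair l φ (U v) ≈ F.pair k (λ α → φ (h α)) v) →
                   (∀ α → degrees (f α) ≡ degrees (h α)) → ∀ v → T v ≋ᶠ U v
  same-monomials {k} T-pair U-pair eq v = F-≋ λ φ → trans (T-pair φ v)
    (trans (F.pair-φ k v λ α → reflexive (≡.cong φ (degrees-injective (eq α)))) (sym (U-pair φ v)))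

  swapE : ∀ {k} → Fin (suc k) → Exponents (suc (suc k)) → Exponents (suc (suc k))
  swapE i (exponents α α≢0) = exponents (swap i α) (swap-All i α≢0)

  -- F(x₁, …, x_k) ↦ x_k F(x_k, x₁, …, x_{k-1})
  rotateE : ∀ {k} → Exponents (suc k) → Exponents (suc k)
  rotateE (exponents (m ∷ α) α≢0) = exponents (α ∷ʳ suc m) (∷ʳ-all (All.tail α≢0) _)

  Θ̂ : ∀ {k} → F.Combination (suc k) → F.Combination (suc k)
  Θ̂ = relabel rotateE

  Ŝ : ∀ {k} → Fin (suc k) → F.Combination (suc (suc k)) → F.Combination (suc (suc k))
  Ŝ i = relabel (swapE i)

  updateAt-∷ʳ : ∀ {k} (α : Vec ℕ k) y f j → updateAt (α ∷ʳ y) (inject₁ j) f ≡ updateAt α j f ∷ʳ y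
  updateAt-∷ʳ (a ∷ α) y f zero    = ≡.refl
  updateAt-∷ʳ (a ∷ α) y f (suc j) = ≡.cong (a ∷_) (updateAt-∷ʳ α y f j)

  updateAt-last : ∀ {k} (α : Vec ℕ k) y f → updateAt (α ∷ʳ y) (fromℕ k) f ≡ α ∷ʳ f y
  updateAt-last []      y f = ≡.refl
  updateAt-last (a ∷ α) y f = ≡.cong (a ∷_) (updateAt-last α y f)

  D̂-on-monomials : ∀ {k} → ∃ λ f → D̂ {k} ≡ extend K (Exponents-decSetoid (suc k)) (Exponents-decSetoid k) f
  D̂-on-monomials = _ , ≡.refl

  D̂-linear : ∀ {k} → IsLinear (V̂ᶠ (suc k)) (V̂ᶠ k) D̂
  D̂-linear {k} = extend-linear (Exponents-decSetoid (suc k)) (Exponents-decSetoid k) {proj₁ D̂-on-monomials}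
    λ { ≡.refl → F.≋.≈ᴹ-refl k }

  tailE : ∀ {k} → Exponents (suc k) → Exponents k
  tailE (exponents (m ∷ α) α≢0) = exponents α (All.tail α≢0)

  D̂* : ∀ {k} → (Exponents k → Carrier) → Exponents (suc k) → Carrier
  D̂* φ α = p (head (degrees α)) * φ (tailE α) - KSum.sum (λ j → φ (raise (head (degrees α)) (tailE α) j))

  pair-FSum : ∀ {k n} φ (f : Fin n → F.Combination k) →
              F.pair k φ (FSum.sum k f) ≈ KSum.sum (λ j → F.pair k φ (f j))
  pair-FSum {n = zero}  φ f = refl
  pair-FSum {k} {suc n} φ f = trans (F.pair-++ k φ (f zero) _) (+-congˡ (pair-FSum φ (λ j → f (suc j))))

  pair-D̂ : ∀ {k} φ v → F.pair k φ (D̂ v) ≈ F.pair (suc k) (D̂* φ) v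
  pair-D̂ {k} φ v = trans (pair-extend (Exponents-decSetoid (suc k)) (Exponents-decSetoid k) φ (proj₁ D̂-on-monomials) v)
    (F.pair-φ (suc k) v monomial)
    where
    monomial : ∀ α → F.pair k φ (proj₁ D̂-on-monomials α) ≈ D̂* φ α
    monomial α@(exponents (m ∷ _) _) = trans (F.pair-++ k φ first ((- 1#) ·ᶠ FSum.sum k rest)) (+-cong
      (trans (F.pair-· k φ (p m) (F.⟦_⟧ k (tailE α))) (*-congˡ (trans (+-identityʳ _) (*-identityˡ _))))
      (trans (F.pair-neg k φ (FSum.sum k rest)) (-‿cong (trans (pair-FSum φ rest)
        (KSum.sum-cong-≋ {k} {λ j → F.pair k φ (rest j)} {λ j → φ (raise m (tailE α) j)}
          λ j → trans (+-identityʳ _) (*-identityˡ _))))))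
      where
      first = p m ·ᶠ F.⟦_⟧ k (tailE α)
      rest : Fin k → F.Combination k
      rest j = F.⟦_⟧ k (raise m (tailE α) j)

  -- After M̂ the color to be summed must also avoid the appended one. The extra subtracted term, in
  -- which x_c^m meets the appended variable and raises its exponent to m + 1, is exactly Θ̂.
  D̂-M̂ : ∀ {k} (v : F.Combination (suc k)) → D̂ (M̂ v) ++ Θ̂ v ≋ᶠ M̂ (D̂ v)
  D̂-M̂ {k} v = F-≋ λ φ → begin
    F.pair (suc k) φ (D̂ (M̂ v) ++ Θ̂ v)
      ≈⟨ trans (F.pair-++ (suc k) φ (D̂ (M̂ v)) (Θ̂ v)) (+-cong
           (trans (pair-D̂ φ (M̂ v)) (pair-relabel _⋆x (D̂* φ) v)) (pair-relabel rotateE φ v)) ⟩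
    F.pair (suc k) (λ α → D̂* φ (α ⋆x)) v + F.pair (suc k) (λ α → φ (rotateE α)) v
      ≈⟨ F.pair-+ (suc k) (λ α → D̂* φ (α ⋆x)) (λ α → φ (rotateE α)) v ⟨
    F.pair (suc k) (λ α → D̂* φ (α ⋆x) + φ (rotateE α)) v
      ≈⟨ F.pair-φ (suc k) v (monomial φ) ⟩
    F.pair (suc k) (D̂* (λ α → φ (α ⋆x))) v
      ≈⟨ trans (pair-relabel _⋆x φ (D̂ v)) (pair-D̂ (λ α → φ (α ⋆x)) v) ⟨
    F.pair (suc k) φ (M̂ (D̂ v)) ∎
    where
    monomial : ∀ φ (α : Exponents (suc k)) → D̂* φ (α ⋆x) + φ (rotateE α) ≈ D̂* (λ α → φ (α ⋆x)) α
    monomial φ α@(exponents (m ∷ β) β≢0) = trans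
      (+-congʳ (+-congˡ (-‿cong (trans (KSum.sum-init-last (λ j → φ (raise m (tailE α ⋆x) j)))
        (+-cong (KSum.sum-cong-≋ λ j → reflexive (≡.cong φ (degrees-injective (updateAt-∷ʳ β 1 (ℕ._+ m) j))))
          (reflexive (≡.cong φ (degrees-injective (updateAt-last β 1 (ℕ._+ m))))))))))
      (solve 3 (λ x s y → x :- (s :+ y) :+ y := x :- s) refl _ _ _)

  -- Both sides subtract one term per remaining variable. The variable that Θ̂ moves to the back
  -- comes last in the sum on the left and first in the one on the right.
  D̂-Θ̂ : ∀ {k} (v : F.Combination (suc (suc k))) → D̂ (Θ̂ v) ≋ᶠ Θ̂ (D̂ (Ŝ zero v))
  D̂-Θ̂ {k} v = F-≋ λ φ → trans (pair-D̂ φ (Θ̂ v)) (trans (pair-relabel rotateE (D̂* φ) v)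
    (trans (F.pair-φ (suc (suc k)) v (monomial φ))
    (sym (trans (pair-relabel rotateE φ (D̂ (Ŝ zero v))) (trans (pair-D̂ (λ α → φ (rotateE α)) (Ŝ zero v))
      (pair-relabel (swapE zero) _ v))))))
    where
    monomial : ∀ φ (α : Exponents (suc (suc k))) → D̂* φ (rotateE α) ≈ D̂* (λ α → φ (rotateE α)) (swapE zero α)
    monomial φ α@(exponents (m ∷ n ∷ β) β≢0) = +-congˡ (-‿cong (trans (KSum.sum-init-last (λ j → φ (raise n (tailE (rotateE α)) j)))
      (trans (+-comm _ _) (+-cong
        (reflexive (≡.cong φ (degrees-injective (updateAt-last β (suc m) (ℕ._+ n)))))
        (KSum.sum-cong-≋ λ j → reflexive (≡.cong φ (degrees-injective (updateAt-∷ʳ β (suc m) (ℕ._+ n) j))))))))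

  colorings : ShiftAlgebra V̂ᶠ
  colorings = record
    { M = M̂ ; D = D̂ ; Θ = Θ̂ ; S = Ŝ
    ; M-linear = relabel-linear _⋆x ; D-linear = D̂-linear
    ; Θ-linear = relabel-linear rotateE ; S-linear = λ i → relabel-linear (swapE i)
    ; D-M   = D̂-M̂
    ; D-Θ   = D̂-Θ̂
    ; S-M   = λ {k} i → same-monomials {T = λ v → Ŝ (inject₁ i) (M̂ v)} {λ v → M̂ (Ŝ i v)}
        (pair-relabel₂ (swapE (inject₁ i)) _⋆x) (pair-relabel₂ _⋆x (swapE i)) λ α → swap-∷ʳ i (degrees α) 1
    ; S-Θ   = λ i → same-monomials {T = λ v → Ŝ (inject₁ i) (Θ̂ v)} {λ v → Θ̂ (Ŝ (suc i) v)}
        (pair-relabel₂ (swapE (inject₁ i)) rotateE) (pair-relabel₂ rotateE (swapE (suc i)))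
        λ { (exponents (m ∷ α) _) → swap-∷ʳ i α (suc m) }
    ; S-M-M = λ {k} → same-monomials {T = λ v → Ŝ (fromℕ k) (M̂ (M̂ v))} {λ v → M̂ (M̂ v)}
        (pair-relabel₃ _⋆x _⋆x (swapE (fromℕ k))) (pair-relabel₂ _⋆x _⋆x) λ α → swap-last (degrees α) 1 1
    ; S-M-Θ = λ {k} → same-monomials {T = λ v → Ŝ (fromℕ k) (M̂ (Θ̂ v))} {λ v → Θ̂ (M̂ v)}
        (pair-relabel₃ _⋆x rotateE (swapE (fromℕ k))) (pair-relabel₂ rotateE _⋆x)
        λ { (exponents (m ∷ α) _) → swap-last α (suc m) 1 }
    ; S-Θ-M = λ {k} → same-monomials {T = λ v → Ŝ (fromℕ k) (Θ̂ (M̂ v))} {λ v → M̂ (Θ̂ v)}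
        (pair-relabel₃ rotateE _⋆x (swapE (fromℕ k))) (pair-relabel₂ _⋆x rotateE)
        λ { (exponents (m ∷ α) _) → swap-last α 1 (suc m) }
    ; S-Θ-Θ = λ {k} → same-monomials {T = λ v → Ŝ (fromℕ k) (Θ̂ (Θ̂ v))} {λ v → Θ̂ (Θ̂ (Ŝ zero v))}
        (pair-relabel₃ rotateE rotateE (swapE (fromℕ k))) (pair-relabel₃ rotateE (swapE zero) rotateE)
        λ { (exponents (m ∷ n ∷ α) _) → swap-last α (suc m) (suc n) }
    }

  -- Recursive construction of U

  turned : ∀ {k} → (Vec ℕ (suc k) → F.Combination (suc k)) → Vec ℕ k → ℕ → F.Combination (suc k)
  turned {k} lower v q = ε⁻¹ (pred q) ·ᶠ Θ̂ (lower (pred q ∷ v))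

  -- The counterpart of `expansion` with M̂ and Θ̂; the values of U on shorter tuples and on rotated
  -- tuples are parameters.
  step : ∀ {k} → (Vec ℕ k → F.Combination k) → (Vec ℕ (suc k) → F.Combination (suc k)) →
         Vec ℕ k → ℕ → F.Combination (suc k)
  step {k} shorter lower v z = r (+ z) ·ᶠ M̂ (shorter v)
    ++ (combine {Exponents-decSetoid (suc k)} (v ⁺) (λ q → (- weight v z q) ·ᶠ turned lower v q)
        ++ (- h (v ⁺) (+ z)) ·ᶠ turned lower v z)

  -- The calls of u (suc k) n with a nonzero coefficient lower the degree, so n > degree v is enough fuel.
  u : ∀ k → ℕ → Vec ℕ k → F.Combination k
  u zero    n       v = b̂∅
  u (suc k) zero    v = []
  u (suc k) (suc n) v = step (λ w → u k (suc (degree w)) w) (u (suc k) n) (init v) (last v)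

  u-∷ʳ : ∀ {k} n (v : Vec ℕ k) z → u (suc k) (suc n) (v ∷ʳ z) ≡ step (λ w → u k (suc (degree w)) w) (u (suc k) n) v z
  u-∷ʳ {k} n v z = ≡.cong₂ (step (λ w → u k (suc (degree w)) w) (u (suc k) n)) (Vec.init-∷ʳ z v) (Vec.last-∷ʳ z v)

  module Θ̂ {k} = IsLinear (relabel-linear (rotateE {k}))

  turned-cong : ∀ {k v z} (vz-good : Good (v ∷ʳ z)) {q w} → Rotates {k} vz-good q w → ∀ lower lower′ →
                (degree (pred q ∷ v) ℕ.< degree (v ∷ʳ z) → Good (pred q ∷ v) →
                  lower (pred q ∷ v) ≋ᶠ lower′ (pred q ∷ v)) →
                (- w) ·ᶠ turned lower v q ≋ᶠ (- w) ·ᶠ turned lower′ v q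
  turned-cong {k} {v} vz-good {q} {w} (dead w≈0) lower lower′ _ = ≋.≈ᴹ-trans (vanishes lower) (≋.≈ᴹ-sym (vanishes lower′))
    where
    open F (suc k) using (module ≋)
    vanishes : ∀ lower → (- w) ·ᶠ turned lower v q ≋ᶠ []
    vanishes lower = ≋.≈ᴹ-trans (≋.*ₗ-cong (trans (-‿cong w≈0) -0#≈0#) (≋.≈ᴹ-refl {turned lower v q})) (≋.*ₗ-zeroˡ (turned lower v q))
  turned-cong {k} {v} vz-good {q} {w} (live q-good smaller _) lower lower′ stable =
    ≋.*ₗ-cong refl (≋.*ₗ-cong refl (Θ̂.cong (stable smaller q-good)))
    where open F (suc k) using (module ≋)

  step-cong : ∀ {k v z} (vz-good : Good (v ∷ʳ z)) shorter lower lower′ →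
              (∀ q → degree (q ∷ v) ℕ.< degree (v ∷ʳ z) → Good (q ∷ v) →
                lower (q ∷ v) ≋ᶠ lower′ (q ∷ v)) →
              step shorter lower v z ≋ᶠ step shorter lower′ v z
  step-cong {k} {v} {z} vz-good shorter lower lower′ stable =
    +ᴹ-cong {first} {first} {turns lower ++ final lower} {turns lower′ ++ final lower′} ≈ᴹ-refl
      (+ᴹ-cong {turns lower} {turns lower′} {final lower} {final lower′}
        (combine-cong {Exponents-decSetoid (suc k)} (v ⁺) λ q∈ → turned-cong vz-good (rotates vz-good q∈) lower lower′ (stable _))
        (turned-cong vz-good (rotates-last vz-good) lower lower′ (stable _)))
    where
    open F (suc k) using (module ≋)
    open ≋ using (+ᴹ-cong; ≈ᴹ-refl)
    first = r (+ z) ·ᶠ M̂ (shorter v)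
    turns final : (Vec ℕ (suc k) → F.Combination (suc k)) → F.Combination (suc k)
    turns lower = combine {Exponents-decSetoid (suc k)} (v ⁺) (λ q → (- weight v z q) ·ᶠ turned lower v q)
    final lower = (- h (v ⁺) (+ z)) ·ᶠ turned lower v z

  -- The recursion hands the same remaining fuel to rotated tuples of various degrees, whereas `f`
  -- allots each tuple its own; this makes the two agree.
  u-stable : ∀ k m n (v : Vec ℕ k) → Good v → degree v ℕ.< m → degree v ℕ.< n → u k m v ≋ᶠ u k n v
  u-stable zero    m       n       v _      _         _         = F.≋.≈ᴹ-refl 0
  u-stable (suc k) (suc m) (suc n) v v-good (s≤s v≤m) (s≤s v≤n) with initLast v
  ... | w , z , ≡.refl = step-cong v-good (λ w → u k (suc (degree w)) w) (u (suc k) m) (u (suc k) n) λ q smaller q-good →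
    u-stable (suc k) m n (q ∷ w) q-good (ℕ.<-≤-trans smaller v≤m) (ℕ.<-≤-trans smaller v≤n)

  f : ∀ {k} → Vec ℕ k → F.Combination k
  f {k} v = u k (suc (degree v)) v

  U : ∀ k → V.Combination k → F.Combination k
  U k = extend K (I-decSetoid k) (Exponents-decSetoid k) (λ σ → f (entries σ))

  U-linear : ∀ k → IsLinear (V k) (V̂ᶠ k) (U k)
  U-linear k = extend-linear (I-decSetoid k) (Exponents-decSetoid k) {λ σ → f (entries σ)} λ { ≡.refl → F.≋.≈ᴹ-refl k }

  U-b : ∀ {k} (σ : I k) → U k (b σ) ≋ᶠ f (entries σ)
  U-b {k} = extend-⟦⟧ (I-decSetoid k) (Exponents-decSetoid k) (λ σ → f (entries σ))

  module _ {k : ℕ} (ψ : Exponents (suc k) → Carrier) where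

    -- Composing U with a functional ψ on the color side turns UM = M̂U and UΘ = Θ̂U into the scalar
    -- equations solved by `interpolant`.
    read : Functional (suc k)
    read v = F.pair (suc k) ψ (f v)

    pair-U : ∀ w → F.pair (suc k) ψ (U (suc k) w) ≈ V.pair (suc k) (restrict read) w
    pair-U = pair-extend (I-decSetoid (suc k)) (Exponents-decSetoid (suc k)) ψ (λ σ → f (entries σ))

    module _ (v : Vec ℕ k) where

      X : Carrier
      X = F.pair (suc k) ψ (M̂ (f v))

      Y : ℕ → Carrier
      Y q = F.pair (suc k) ψ (ε⁻¹ (pred q) ·ᶠ Θ̂ (f (pred q ∷ v)))

      read-∷ʳ : ∀ {z} → Good (v ∷ʳ z) → read (v ∷ʳ z) ≈ r (+ z) * X
                - (∑ (v ⁺) λ q → weight v z q * Y q) - h (v ⁺) (+ z) * Y z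
      read-∷ʳ {z} vz-good = begin
        F.pair (suc k) ψ (f (v ∷ʳ z))
          ≈⟨ reflexive (≡.cong (F.pair (suc k) ψ) (u-∷ʳ n v z)) ⟩
        F.pair (suc k) ψ (step f (u (suc k) n) v z)
          ≈⟨ trans (F.pair-++ (suc k) ψ (r (+ z) ·ᶠ M̂ (f v)) _) (+-cong
               (F.pair-· (suc k) ψ (r (+ z)) (M̂ (f v)))
               (trans (F.pair-++ (suc k) ψ (combine {Exponents-decSetoid (suc k)} (v ⁺) turns) _) (+-cong
                 (trans (pair-combine {Exponents-decSetoid (suc k)} ψ (v ⁺) turns)
                   (trans (∑-cong (v ⁺) λ q∈ → read-turned (rotates vz-good q∈)) (∑-neg (v ⁺) _)))
                 (read-turned (rotates-last vz-good))))) ⟩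
        r (+ z) * X + (- (∑ (v ⁺) λ q → weight v z q * Y q) + - (h (v ⁺) (+ z) * Y z))
          ≈⟨ +-assoc _ _ _ ⟨
        r (+ z) * X - (∑ (v ⁺) λ q → weight v z q * Y q) - h (v ⁺) (+ z) * Y z ∎
        where
        n = degree (v ∷ʳ z)
        turns : ℕ → F.Combination (suc k)
        turns q = (- weight v z q) ·ᶠ turned (u (suc k) n) v q
        read-turned : ∀ {q w} → Rotates vz-good q w → F.pair (suc k) ψ ((- w) ·ᶠ turned (u (suc k) n) v q) ≈ - (w * Y q)
        read-turned {q} {w} rot = trans
          (F.pair-cong (suc k) (λ { ≡.refl → refl }) (turned-cong vz-good rot (u (suc k) n) f λ smaller q-good →
            u-stable (suc k) n _ (pred q ∷ v) q-good smaller ℕ.≤-refl))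
          (trans (F.pair-· (suc k) ψ (- w) (ε⁻¹ (pred q) ·ᶠ Θ̂ (f (pred q ∷ v)))) (sym (-‿distribˡ-* w _)))

      module _ (v-good : Good v) where

        private
          v! = anchors-unique v-good

          extended : ∀ {a} → suc a ∉ v → Good (v ∷ʳ suc a)
          extended suca∉v = ∷ʳ-good _ suca∉v v-good

          value : ℕ → Carrier
          value = interpolant (v ⁺) v! (here ≡.refl) X Y

        -- At a vector with a repeated entry `f` need not follow the interpolation formula, but
        -- there the coefficient is zero.
        weighted-read : ∀ a → g (v ⁺) (+ a) * read (v ∷ʳ suc a) ≈ g (v ⁺) (+ a) * value (suc a)
        weighted-read a with suc a ∈? v
        ... | yes suca∈v = trans (vanishes _) (sym (vanishes _))
          where
          vanishes : ∀ x → g (v ⁺) (+ a) * x ≈ 0#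
          vanishes x = trans (*-congʳ (g-taken {S = v ⁺} {a} (there suca∈v))) (zeroˡ x)
        ... | no suca∉v  = *-congˡ (read-∷ʳ (extended suca∉v))

        M*-read : M* read v ≈ X
        M*-read = trans (∑-cong (v ⁺) λ {a} _ → weighted-read a)
          (sum-of-values (v ⁺) v! (here ≡.refl) X Y)

        Θ*-read : ∀ {s} → s ∉ v ⁺ → Θ* read (s ∷ v) ≈ ε s * Y (suc s)
        Θ*-read {s} s∉ = trans (Θ*-value read s∉) (*-congˡ (trans
          (+-cong (∑-cong (v ⁺) λ {a} _ → trans (solve 3 (λ x y z → x :* (y :* z) := y :* (x :* z)) refl _ _ _)
              (trans (*-congˡ (weighted-read a)) (solve 3 (λ x y z → y :* (x :* z) := x :* y :* z) refl _ _ _)))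
            (-‿cong (weighted-read s)))
          (weighted-sum-of-values (v ⁺) v! (here ≡.refl) X Y s∉)))

  U-M : ∀ k (w : V.Combination k) → U (suc k) (M w) ≋ᶠ M̂ (U k w)
  U-M k = spanned (I-decSetoid k)
    (equalizer (∘-linear (U-linear (suc k)) M-linear) (∘-linear (relabel-linear _⋆x) (U-linear k)))
    λ σ → F-≋ λ ψ → trans (pair-U ψ (M (b σ))) (trans (adjoint M-adjoint (read ψ) (b σ))
      (trans (+-identityʳ _) (trans (*-identityˡ _) (trans (M*-read ψ (entries σ) (entries-good σ))
        (F.pair-cong (suc k) (λ { ≡.refl → refl }) (IsLinear.cong (relabel-linear _⋆x) (F.≋.≈ᴹ-sym k (U-b σ))))))))

  U-Θ : ∀ k (w : V.Combination (suc k)) → U (suc k) (Θ w) ≋ᶠ Θ̂ (U (suc k) w)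
  U-Θ k = spanned (I-decSetoid (suc k))
    (equalizer (∘-linear (U-linear (suc k)) (ShiftAlgebra.Θ-linear tableaux)) (∘-linear (relabel-linear rotateE) (U-linear (suc k))))
    λ { σ@(tuple (s ∷ v) _ _) → F-≋ λ ψ → trans (pair-U ψ (Θ (b σ))) (trans (adjoint Θ-adjoint (read ψ) (b σ))
      (trans (+-identityʳ _) (trans (*-identityˡ _) (trans
        (Θ*-read ψ v (tail-good (entries-good σ)) (good-∉ (entries-good σ)))
        (trans (*-congˡ (F.pair-· (suc k) ψ (ε⁻¹ s) (Θ̂ (f (s ∷ v))))) (trans (sym (*-assoc _ _ _))
        (trans (*-congʳ (ε-inverse s)) (trans (*-identityˡ _)
        (F.pair-cong (suc k) (λ { ≡.refl → refl }) (IsLinear.cong (relabel-linear rotateE) (F.≋.≈ᴹ-sym (suc k) (U-b σ)))))))))))) }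

  -- Newton's identities and the case k = 1

  -- e_{z-1} q₁ - e_{z-2} q₂ + ⋯ ± e₀ q_z
  alternating : (ℕ → Carrier) → ℕ → Carrier
  alternating q zero    = 0#
  alternating q (suc n) = e n * q 1 - alternating (λ j → q (suc j)) n

  alternating-scale : ∀ q x n → alternating (λ j → q j * x) n ≈ alternating q n * x
  alternating-scale q x zero    = sym (zeroˡ x)
  alternating-scale q x (suc n) = trans (+-congˡ (-‿cong (alternating-scale (λ j → q (suc j)) x n)))
    (solve 4 (λ e q a x → e :* (q :* x) :- a :* x := (e :* q :- a) :* x) refl _ _ _ _)

  sign : ℕ → Carrier
  sign n = (- 1#) KExp.^ n

  sign² : ∀ n → sign n * sign n ≈ 1#
  sign² zero    = *-identityˡ 1#
  sign² (suc n) = trans (solve 1 (λ s → (:- :1 :* s) :* (:- :1 :* s) := s :* s) refl (sign n)) (sign² n)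

  convolution : (ℕ → Carrier) → ℕ → Carrier
  convolution q n = KSum.sum {n} λ i → sign (toℕ i) * (e (suc (toℕ i)) * q (n ℕ.∸ toℕ i))

  -- Isolates q (suc n), whose coefficient is e 0 = 1 up to sign, so that the recursion of
  -- `powerSums` can be substituted for it.
  alternating-convolution : ∀ q n → alternating q (suc n) ≈ sign n * (q (suc n) - convolution q n)
  alternating-convolution q zero    = trans (+-congʳ (trans (*-congʳ e-0) (*-identityˡ _)))
    (solve 1 (λ x → x :- :0 := :1 :* (x :- :0)) refl _)
  alternating-convolution q (suc n) = begin
    e (suc n) * q 1 - alternating (λ j → q (suc j)) (suc n)
      ≈⟨ +-congˡ (-‿cong (alternating-convolution (λ j → q (suc j)) n)) ⟩
    e (suc n) * q 1 - sign n * (q (suc (suc n)) - C)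
      ≈⟨ solve 4 (λ x s y C → x :- s :* (y :- C) := :1 :* x :- s :* (y :- C)) refl _ _ _ _ ⟩
    1# * (e (suc n) * q 1) - sign n * (q (suc (suc n)) - C)
      ≈⟨ +-congʳ (*-congʳ (sign² n)) ⟨
    sign n * sign n * (e (suc n) * q 1) - sign n * (q (suc (suc n)) - C)
      ≈⟨ solve 4 (λ s x y C → s :* s :* x :- s :* (y :- C) := (:- :1) :* s :* (y :- (C :+ s :* x))) refl _ _ _ _ ⟩
    sign (suc n) * (q (suc (suc n)) - (C + sign n * (e (suc n) * q 1)))
      ≈⟨ *-congˡ (+-congˡ (-‿cong (trans (KSum.sum-init-last (summand (suc n))) (+-cong
           (KSum.sum-cong-≋ {n} {λ i → summand (suc n) (inject₁ i)} shifted-summand) last-summand)))) ⟨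
    sign (suc n) * (q (suc (suc n)) - convolution q (suc n)) ∎
    where
    C = convolution (λ j → q (suc j)) n
    summand : ∀ n → Fin n → Carrier
    summand n i = sign (toℕ i) * (e (suc (toℕ i)) * q (n ℕ.∸ toℕ i))
    shifted-summand : ∀ i → summand (suc n) (inject₁ i) ≈ sign (toℕ i) * (e (suc (toℕ i)) * q (suc (n ℕ.∸ toℕ i)))
    shifted-summand i = reflexive (≡.trans
      (≡.cong (λ j → sign j * (e (suc j) * q (suc n ℕ.∸ j))) (Fin.toℕ-inject₁ i))
      (≡.cong (λ j → sign (toℕ i) * (e (suc (toℕ i)) * q j)) (ℕ.+-∸-assoc 1 (ℕ.<⇒≤ (Fin.toℕ<n i)))))
    last-summand : summand (suc n) (fromℕ n) ≈ sign n * (e (suc n) * q 1)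
    last-summand = reflexive (≡.trans
      (≡.cong (λ j → sign j * (e (suc j) * q (suc n ℕ.∸ j))) (Fin.toℕ-fromℕ n))
      (≡.cong (λ j → sign n * (e (suc n) * q j)) (ℕ.m+n∸n≡m 1 n)))

  ×≈num : ∀ n x → n KMult.× x ≈ num (+ n) * x
  ×≈num zero    x = sym (trans (*-congʳ num-0) (zeroˡ x))
  ×≈num (suc n) x = trans (+-cong (sym (*-identityˡ x)) (×≈num n x))
    (trans (sym (distribʳ x _ _)) (*-congʳ (sym (trans (num-+ 1ℤ (+ n)) (+-congʳ num-1)))))

  lookup-powerSums : ∀ n i → lookup (powerSums n) i ≡ p (n ℕ.∸ toℕ i)
  lookup-powerSums (suc n) zero    = ≡.refl
  lookup-powerSums (suc n) (suc i) = lookup-powerSums n i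

  newton : ∀ n → alternating p (suc n) ≈ num (+ suc n) * e (suc n)
  newton n = begin
    alternating p (suc n)
      ≈⟨ alternating-convolution p n ⟩
    sign n * (p (suc n) - convolution p n)
      ≈⟨ *-congˡ (+-congʳ (+-cong (KSum.sum-cong-≋ {n} λ i → *-congˡ (*-congˡ (reflexive (lookup-powerSums n i))))
           (*-congˡ (×≈num (suc n) (e (suc n)))))) ⟩
    sign n * (convolution p n + sign n * (num (+ suc n) * e (suc n)) - convolution p n)
      ≈⟨ solve 3 (λ s C x → s :* (C :+ s :* x :- C) := s :* s :* x) refl _ _ _ ⟩
    sign n * sign n * (num (+ suc n) * e (suc n))
      ≈⟨ trans (*-congʳ (sign² n)) (*-identityˡ _) ⟩
    num (+ suc n) * e (suc n) ∎

  monomial : ℕ → Exponents 1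
  monomial n = exponents (suc n ∷ []) (_ ∷ [])

  -- Solves the recursion for k = 1: with z = n + 1, U b_z is (e_{z-1} x - e_{z-2} x² + ⋯ ± x^z)/(z
  -- e_{z-1}). Since ψ is arbitrary, multiplication by x in Θ̂ becomes a shift of ψ, which drives
  -- the induction.
  f-single : ∀ n (ψ : ℕ → Carrier) → num (+ suc n) * e n * F.pair 1 (λ α → ψ (head (degrees α))) (f (suc n ∷ []))
             ≈ alternating ψ (suc n)
  f-single n ψ = begin
    num (+ z) * e n * read ψ′ (z ∷ [])
      ≈⟨ *-congˡ (read-∷ʳ ψ′ [] (single-good n)) ⟩
    num (+ z) * e n * (r (+ z) * X ψ′ [] - (weight [] z 0 * Y ψ′ [] 0 + 0#) - h ([] ⁺) (+ z) * Y ψ′ [] z)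
      ≈⟨ *-congˡ (+-cong (+-cong (*-congˡ X-value) (-‿cong (trans (+-identityʳ _) (trans (*-congʳ dead-weight) (zeroˡ _)))))
           (-‿cong (*-cong h-value Y-value))) ⟩
    num (+ z) * e n * (r (+ z) * ψ 1 - 0# - (1# - r (+ z)) * (ε⁻¹ n * rest))
      ≈⟨ solve 6 (λ N e r x i t → N :* e :* (r :* x :- :0 :- (:1 :- r) :* (i :* t))
           := (N :* r) :* (e :* x) :- (N :- N :* r) :* (e :* i) :* t) refl _ _ _ _ _ _ ⟩
    (num (+ z) * r (+ z)) * (e n * ψ 1) - (num (+ z) - num (+ z) * r (+ z)) * (e n * ε⁻¹ n) * rest
      ≈⟨ +-cong (trans (*-congʳ (num*r λ ())) (*-identityˡ _)) (-‿cong (*-congʳ (*-cong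
           (trans (+-congˡ (-‿cong (num*r λ ()))) predecessor-num)
           (trans (sym (*-assoc _ _ _)) (trans (*-congʳ (e*e⁻¹ n)) (*-identityˡ _)))))) ⟩
    e n * ψ 1 - num (+ n) * e (pred n) * rest
      ≈⟨ +-congˡ (-‿cong (remaining n)) ⟩
    alternating ψ z ∎
    where
    z = suc n
    ψ′ : Exponents 1 → Carrier
    ψ′ α = ψ (head (degrees α))
    rest-of : ℕ → Carrier
    rest-of n = F.pair 1 (λ α → ψ (suc (head (degrees α)))) (f (n ∷ []))
    rest = rest-of n
    single-good : ∀ n → Good (suc n ∷ [])
    single-good n = good (_ ∷ []) ([] ∷ [])
    X-value : X ψ′ [] ≈ ψ 1
    X-value = trans (+-identityʳ _) (trans (*-congʳ (*-identityˡ _)) (*-identityˡ _))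
    dead-weight : weight [] z 0 ≈ 0#
    dead-weight = trans (*-congˡ (trans (+-congʳ (r-cong (ℤ.+-identityʳ (+ z)))) (-‿inverseʳ _))) (zeroʳ _)
    h-value : h ([] ⁺) (+ z) ≈ 1# - r (+ z)
    h-value = trans (*-identityʳ _) (+-congˡ (trans (-1*x≈-x _) (-‿cong (r-cong (ℤ.+-identityʳ (+ z))))))
    Y-value : Y ψ′ [] z ≈ ε⁻¹ n * rest
    Y-value = trans (F.pair-· 1 ψ′ (ε⁻¹ n) (Θ̂ (f (n ∷ [])))) (*-congˡ (trans (pair-relabel rotateE ψ′ (f (n ∷ [])))
      (F.pair-φ 1 (f (n ∷ [])) λ { (exponents (m ∷ []) _) → refl })))
    predecessor-num : num (+ z) - 1# ≈ num (+ n)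
    predecessor-num = trans (+-congʳ (trans (num-+ 1ℤ (+ n)) (+-congʳ num-1)))
      (solve 1 (λ x → :1 :+ x :- :1 := x) refl _)
    remaining : ∀ n → num (+ n) * e (pred n) * rest-of n ≈ alternating (λ j → ψ (suc j)) n
    -- The vector is (0), which is not a tuple; its coefficient z - 1 is zero.
    remaining zero    = trans (*-congʳ (trans (*-congʳ num-0) (zeroˡ _))) (zeroˡ _)
    remaining (suc n) = f-single n (λ j → ψ (suc j))

  -- D̂ replaces x^j by p_j, so Newton's identity turns the formula of `f-single` into z e_z/(z
  -- e_{z-1}), which is the scalar in D b_z.
  U-D₀ : ∀ w → D̂ (U 1 w) ≋ᶠ U 0 (D w)
  U-D₀ = spanned (I-decSetoid 1) (equalizer (∘-linear D̂-linear (U-linear 1)) (∘-linear (U-linear 0) D-linear))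
    λ { σ@(tuple (suc n ∷ []) _ _) → F-≋ λ φ → on-basis n σ ≡.refl φ
      ; σ@(tuple (zero ∷ []) _ _)  → ⊥-elim (ℕ.≢-nonZero⁻¹ 0 {{head-nonZero (entries-good σ)}} ≡.refl) }
    where
    on-basis : ∀ n (σ : I 1) → entries σ ≡ suc n ∷ [] → ∀ φ → F.pair 0 φ (D̂ (U 1 (b σ))) ≈ F.pair 0 φ (U 0 (D (b σ)))
    on-basis n σ ≡.refl φ = begin
      F.pair 0 φ (D̂ (U 1 (b σ)))
        ≈⟨ trans (pair-D̂ φ (U 1 (b σ))) (F.pair-cong 1 (λ { ≡.refl → refl }) (U-b σ)) ⟩
      F.pair 1 (D̂* φ) (f (suc n ∷ []))
        ≈⟨ F.pair-φ 1 (f (suc n ∷ [])) (λ { (exponents (m ∷ []) _) → trans (+-congˡ -0#≈0#) (+-identityʳ _) }) ⟩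
      F.pair 1 (λ α → p (head (degrees α)) * x) (f (suc n ∷ []))
        ≈⟨ trans (sym (*-identityˡ _)) (*-congʳ (sym (trans
             (solve 4 (λ r i N e → (r :* i) :* (N :* e) := (N :* r) :* (e :* i)) refl (r (+ suc n)) (e⁻¹ n) (num (+ suc n)) (e n))
             (trans (*-cong (num*r {+ suc n} λ ()) (e*e⁻¹ n)) (*-identityˡ 1#))))) ⟩
      (r (+ suc n) * e⁻¹ n) * (num (+ suc n) * e n) * _
        ≈⟨ trans (*-assoc _ _ _) (*-congˡ (trans (f-single n (λ j → p j * x)) (trans (alternating-scale p x (suc n))
             (*-congʳ (newton n))))) ⟩
      (r (+ suc n) * e⁻¹ n) * (num (+ suc n) * e (suc n) * x)
        ≈⟨ solve 5 (λ r i N e x → (r :* i) :* (N :* e :* x) := (N :* r) :* (e :* i :* x)) refl _ _ _ _ _ ⟩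
      (num (+ suc n) * r (+ suc n)) * (e (suc n) * e⁻¹ n * x)
        ≈⟨ trans (*-congʳ (num*r λ ())) (*-identityˡ _) ⟩
      ε (suc n) * x
        ≈⟨ solve 2 (λ a x → a :* x := :1 :* (a :* :1) :* :1 :* x :+ :0) refl _ _ ⟩
      F.pair 0 φ (U 0 (D (b σ))) ∎
      where x = φ (exponents [] [])

  private
    intertwines : IntertwinesShifts tableaux colorings U
    intertwines = record { U-linear = U-linear ; U-M = U-M ; U-Θ = U-Θ ; U-D₀ = U-D₀ }

  U-D : ∀ k w → D̂ (U (suc k) w) ≋ᶠ U k (D w)
  U-D = Intertwining.U-D tableauBasis intertwines

  U-homomorphism : ∀ k → IsModuleHomomorphism (Module.rawModule (V k)) (Module.rawModule (V̂ k)) (U k)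
  U-homomorphism k = record
    { isBimoduleHomomorphism = record
      { +ᴹ-isGroupHomomorphism = record
        { isMonoidHomomorphism = record
          { isMagmaHomomorphism = record
            { isRelHomomorphism = record { cong = λ e → ≋⇒≋̂ (cong e) }
            ; homo = λ v w → ≋⇒≋̂ (+-hom v w) }
          ; ε-homo = ≋⇒≋̂ 0-hom }
        ; ⁻¹-homo = λ v → ≋⇒≋̂ (*-hom (- 1#) v) }
      ; *ₗ-homo = λ a v → ≋⇒≋̂ (*-hom a v)
      ; *ᵣ-homo = λ a v → ≋⇒≋̂ (*-hom a v) } }
    where open IsLinear (U-linear k)

  solution : Σ ((k : ℕ) → Module.Carrierᴹ (V k) → Module.Carrierᴹ (V̂ k)) λ U →
    ((k : ℕ) → IsModuleHomomorphism (Module.rawModule (V k)) (Module.rawModule (V̂ k)) (U k))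
    × Module._≈ᴹ_ (V̂ 0) (U 0 (b ∅)) b̂∅
    × ((k : ℕ) (v : Module.Carrierᴹ (V k)) → Module._≈ᴹ_ (V̂ (suc k)) (U (suc k) (M v)) (M̂ (U k v)))
    × ((k : ℕ) (v : Module.Carrierᴹ (V (suc k))) → Module._≈ᴹ_ (V̂ k) (D̂ (U (suc k) v)) (U k (D v)))
  solution = U , U-homomorphism , ≋⇒≋̂ (U-b ∅) , (λ k v → ≋⇒≋̂ (U-M k v)) , (λ k v → ≋⇒≋̂ (U-D k v))

-- The field of rational functions in the e_j

open import Defs

module Embedding {a ℓ : Level} (R : CommutativeRing a ℓ) (1≉0 : ¬ IsZero R (CommutativeRing.1# R))
                 (nonzero-* : NoZeroDivisors R) (≈0-stable : ∀ x → ¬ ¬ IsZero R x → IsZero R x) where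

  open CommutativeRing R
  open RingProperties ring using (-‿distribˡ-*)
  open FractionField R 1≉0 nonzero-* ≈0-stable using (↑_; mk≃; fractionField)

  private
    module Fractions = CommutativeRing fractionField

  ↑-cong : ∀ {x y} → x ≈ y → (↑ x) Fractions.≈ (↑ y)
  ↑-cong x≈y = mk≃ (*-congʳ x≈y)

  ↑-+ : ∀ x y → (↑ (x + y)) Fractions.≈ (↑ x) Fractions.+ (↑ y)
  ↑-+ x y = mk≃ (*-cong (sym (+-cong (*-identityʳ x) (*-identityʳ y))) (*-identityˡ 1#))

  ↑-* : ∀ x y → (↑ (x * y)) Fractions.≈ (↑ x) Fractions.* (↑ y)
  ↑-* x y = mk≃ (*-congˡ (*-identityˡ 1#))

constant : ℚ → ℚ[e].Polynomial
constant q = (q , []) ∷ []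

module ↑ = Embedding ℚ[e].polynomialRing (ℚ[e].monomial≉0 []) ℚ[e].nonzero-⊛ ℚ[e].≋0-stable

fromℚ-algebra : RationalAlgebra K fromℚ
fromℚ-algebra = record
  { fromℚ-+ = λ p q → K.trans (↑.↑-cong (constant-+ p q)) (↑.↑-+ (constant p) (constant q))
  ; fromℚ-* = λ p q → ↑.↑-* (constant p) (constant q)
  ; fromℚ-- = λ q → ↑.↑-cong (constant-- q)
  ; fromℚ-0 = ↑.↑-cong constant-0
  ; fromℚ-1 = K.refl
  }
  where
  open ≡.≡-Reasoning
  constant-+ : ∀ p q → constant (p ℚ.+ q) ℚ[e].≋ constant p ++ constant q
  constant-+ p q = ℚ[e].mk≋ λ α → let d = ℚ[e].δ α [] in begin
    (p ℚ.+ q) ℚ.* d ℚ.+ 0ℚ             ≡⟨ ≡.cong (ℚ._+ 0ℚ) (ℚ.*-distribʳ-+ d p q) ⟩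
    p ℚ.* d ℚ.+ q ℚ.* d ℚ.+ 0ℚ         ≡⟨ ℚ.+-assoc (p ℚ.* d) (q ℚ.* d) 0ℚ ⟩
    p ℚ.* d ℚ.+ (q ℚ.* d ℚ.+ 0ℚ)       ∎
  constant-- : ∀ q → constant (ℚ.- q) ℚ[e].≋ (ℚ.- 1ℚ) ℚ[e].· constant q
  constant-- q = ℚ[e].mk≋ λ α → ≡.cong (λ x → x ℚ.* ℚ[e].δ α [] ℚ.+ 0ℚ)
    (≡.trans (≡.cong ℚ.-_ (≡.sym (ℚ.*-identityˡ q))) (ℚ.neg-distribˡ-* 1ℚ q))
  constant-0 : constant 0ℚ ℚ[e].≋ []
  constant-0 = ℚ[e].mk≋ λ α → ≡.cong (ℚ._+ 0ℚ) (ℚ.*-zeroˡ (ℚ[e].δ α []))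

theorem15 : Σ ((k : ℕ) → Module.Carrierᴹ (V k) → Module.Carrierᴹ (V̂ k)) λ U →
    ((k : ℕ) → IsModuleHomomorphism (Module.rawModule (V k)) (Module.rawModule (V̂ k)) (U k))
    × Module._≈ᴹ_ (V̂ 0) (U 0 (b ∅)) b̂∅
    × ((k : ℕ) (v : Module.Carrierᴹ (V k)) → Module._≈ᴹ_ (V̂ (suc k)) (U (suc k) (M v)) (M̂ (U k v)))
    × ((k : ℕ) (v : Module.Carrierᴹ (V (suc k))) → Module._≈ᴹ_ (V̂ k) (D̂ (U (suc k) v)) (U k (D v)))
-- By construction `num` is `fromℚ` of `ratio`, and `e 0` is 1 by the convention t₀ = 1; so both
-- conditions hold by reflexivity.
theorem15 = Tableaux.solution K fromℚ fromℚ-algebra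
  (RationalInverses.integerInverses fromℚ-algebra) (λ _ → K.refl) e e⁻¹
  (λ j → ℚ⟨e⟩.⁻¹-inverseʳ (e j) (e≉0 j)) K.refl
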